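{- Let $q$ be an odd prime power and $n\ge3$ with $(q^n-1)/2$ even, and let $Q=(q^n-1)/(q-1)$. Write $Q=k\,p_1\cdots p_s$ with $p_1,\dots,p_s$ distinct primes dividing $Q$ (and not dividing $k$), set $\delta=1-\sum_{i=1}^s1/p_i$, and assume $\delta>0$. Then $$\mathcal{N}_0(Q)\ >\ \delta\,\theta(k)\,q^{\frac n2}\Big\{q^{\frac n2-1}-2\Big(\frac{s-1}{\delta}+2\Big)W(k)\Big\}.$$ Hence, if $q^{\frac n2-1}>2\big(\frac{s-1}{\delta}+2\big)W(k)$, then $\mathcal{N}_0(q^n-1)>0$.
   Context: For a divisor $m$ of $q^n-1$, an element $\xi\in\mathbb{F}_{q^n}^*$ is $m$-free if $\xi=\zeta^d$ with $d\mid m$ and $\zeta\in\mathbb{F}_{q^n}^*$ implies $d=1$. $\mathcal{N}_0(m)$ is the number of $m$-free $\xi\in\mathbb{F}_{q^n}^*$ with $\mathrm{Tr}(\xi^2)=0$, where $\mathrm{Tr}(\xi)=\sum_{i=0}^{n-1}\xi^{q^i}$. $\theta(k)=\phi(k)/k$ and $W(t)$ is the number of square-free divisors of $t$. -}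

module Defs where

open import Level using (Level; _⊔_) renaming (suc to lsuc)
open import Data.Bool using (Bool; true; false; not; _∧_; if_then_else_)
open import Data.Nat as ℕ using (ℕ; zero; suc; _∸_)
open import Data.Nat.Divisibility using (_∣_; _∣?_)
open import Data.Nat.Coprimality using (coprime?)
open import Data.Integer as ℤ using (ℤ; +_)
open import Data.Rational as ℚ using (ℚ; 0ℚ; 1ℚ)
open import Data.List using (List; []; _∷_; length; filter; foldr)
open import Data.List.Relation.Unary.All using (All)
open import Data.List.Relation.Unary.Any using (Any)
open import Data.List.Relation.Unary.AllPairs using (AllPairs)
open import Data.Product using (Σ; _×_)
open import Data.Sum using (_⊎_)
open import Relation.Nullary using (¬_; yes; no)
open import Relation.Nullary.Decidable using (⌊_⌋)
open import Relation.Binary.PropositionalEquality using (_≡_)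
open import Relation.Binary.Definitions using (Decidable)
open import Algebra.Bundles using (CommutativeRing)

record FiniteField (c ℓ : Level) : Set (lsuc (c ⊔ ℓ)) where
  field
    commRing : CommutativeRing c ℓ
  open CommutativeRing commRing public
  field
    _≈?_     : Decidable _≈_
    1≉0      : ¬ (1# ≈ 0#)
    inverse  : ∀ x → ¬ (x ≈ 0#) → Σ Carrier (λ y → (x * y) ≈ 1#)
    elems    : List Carrier
    complete : ∀ x → Any (x ≈_) elems
    distinct : AllPairs (λ a b → ¬ (a ≈ b)) elems

  card : ℕ
  card = length elems

  pow : Carrier → ℕ → Carrier
  pow x zero    = 1#
  pow x (suc m) = x * pow x m

  Tr : (q n : ℕ) → Carrier → Carrier
  Tr q zero    x = 0#
  Tr q (suc i) x = Tr q i x + pow x (q ℕ.^ i)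

  Free : ℕ → Carrier → Set (c ⊔ ℓ)
  Free m ξ = ∀ (d : ℕ) → d ∣ m → ∀ (ζ : Carrier) → ¬ (ζ ≈ 0#) →
             ξ ≈ pow ζ d → d ≡ 1

  N0Prop : (q n m : ℕ) → Carrier → Set (c ⊔ ℓ)
  N0Prop q n m ξ = ¬ (ξ ≈ 0#) × Free m ξ × (Tr q n (ξ * ξ) ≈ 0#)

  IsCount : (Carrier → Set (c ⊔ ℓ)) → ℕ → Set (c ⊔ ℓ)
  IsCount P N = Σ (List Carrier) λ L →
    (length L ≡ N) × All P L × AllPairs (λ a b → ¬ (a ≈ b)) L ×
    (∀ x → P x → Any (x ≈_) L)

  IsN0 : (q n m N : ℕ) → Set (c ⊔ ℓ)
  IsN0 q n m N = IsCount (N0Prop q n m) N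

range : ℕ → ℕ → List ℕ
range a zero      = []
range a (suc len) = a ∷ range (suc a) len

countB : (ℕ → Bool) → List ℕ → ℕ
countB f xs = length (filter (λ x → Data.Bool._≟_ (f x) true) xs)

totient : ℕ → ℕ
totient k = countB (λ i → ⌊ coprime? i k ⌋) (range 1 k)

allB : (ℕ → Bool) → List ℕ → Bool
allB f = foldr (λ x b → f x ∧ b) true

squareFreeB : ℕ → Bool
squareFreeB d = allB (λ m → not ⌊ (m ℕ.* m) ∣? d ⌋) (range 2 d)

W : ℕ → ℕ
W t = countB (λ d → ⌊ d ∣? t ⌋ ∧ squareFreeB d) (range 1 t)

ℕtoℚ : ℕ → ℚ
ℕtoℚ n = (+ n) ℚ./ 1

ℤtoℚ : ℤ → ℚ
ℤtoℚ z = z ℚ./ 1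

-- total division on ℚ (x / 0 := 0; only ever used with nonzero divisor)
divℚ : ℚ → ℚ → ℚ
divℚ p r with r ℚ.≟ 0ℚ
... | yes _  = 0ℚ
... | no r≢0 = ℚ._÷_ p r {{ℚ.≢-nonZero r≢0}}

θ : ℕ → ℚ
θ k = divℚ (ℕtoℚ (totient k)) (ℕtoℚ k)

sumRecip : List ℕ → ℚ
sumRecip ps = foldr (λ p acc → divℚ 1ℚ (ℕtoℚ p) ℚ.+ acc) 0ℚ ps

-- Comparisons with square roots, without reals.
-- For c ≥ 0 and z ≥ 0:  a < c·√z   ⇔   a < 0  or  a² < c²·z.

_<_·√_ : ℚ → ℚ → ℚ → Set
a < c ·√ z = (a ℚ.< 0ℚ) ⊎ ((a ℚ.* a) ℚ.< ((c ℚ.* c) ℚ.* z))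

{-# OPTIONS --safe #-}

-- No characters are needed.  With a generator g of F*, the indicator of the m-free elements g ^ a is a combination
-- of the Ramanujan sums c_d (a), d a squarefree divisor of m, and q times the indicator of Tr (ξ²) = 0 is 1 + T (a)
-- for the integer function T (a) = t (g ^ (2 a)), t (x) = q [Tr x = 0] - 1.  The dilates of t are orthogonal:
-- ∑_x t (x) t (r x) vanishes unless r lies in the subfield of q elements, so the matrix T (a + b) has operator norm at
-- most 2 (q - 1) √qⁿ.  Since c_d is a reproducing kernel (its convolution square modulo d is d c_d), the
-- Cauchy–Schwarz inequality turns the operator norm into |∑_a c_d (a) T (a)| ≤ φ(d) 2 (q - 1) √qⁿ, the usual
-- consequence of the bound for Gauss sums.  The estimate follows with the sieve inequality
-- [Q-free] ≥ [k-free] (1 - ∑ᵢ [pᵢ ∣ a]) = [k-free] (δ - ∑ᵢ c_{pᵢ} (a) / pᵢ).  All estimates are made over ℤ with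
-- cleared denominators and squared, since √qⁿ may be irrational.

module Submission where

open import Defs
open import Level using (Level; _⊔_)
import Algebra.Properties.AbelianGroup as AbelianGroupProperties
import Algebra.Properties.CommutativeSemiring.Binomial as Binomial
import Algebra.Properties.Monoid.Mult as MonoidMult
import Algebra.Properties.Monoid.Sum as MonoidSum
import Algebra.Properties.Ring as RingProperties
import Algebra.Properties.Semiring.Exp as SemiringExp
import Algebra.Properties.Semiring.Mult as SemiringMult
import Algebra.Solver.Ring.NaturalCoefficients.Default as SemiringSolver
open import Data.Bool using (Bool; true; not; _∧_)
import Data.Bool as Bool
open import Data.Empty using (⊥; ⊥-elim)
open import Data.Fin using (Fin; toℕ; inject₁; fromℕ)
import Data.Fin as Fin
import Data.Fin.Properties as Finₚ
open import Data.Integer using (ℤ; +_; 0ℤ; 1ℤ)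
  renaming (_+_ to _+ᶻ_; _*_ to _*ᶻ_; _-_ to _-ᶻ_; -_ to -ᶻ_; _≤_ to _≤ᶻ_; _<_ to _<ᶻ_)
import Data.Integer as ℤ
import Data.Integer.Properties as ℤₚ
open import Data.Integer.Tactic.RingSolver using (solve-∀)
open import Data.List using (List; []; _∷_; _++_; map; length; upTo; foldr; filter)
import Data.List.Membership.Setoid as Membership
import Data.List.Membership.Setoid.Properties as Membershipₚ
open import Data.List.Membership.Propositional using (_∈_)
import Data.List.Membership.Propositional.Properties as ∈ₚ
open import Data.List.Properties using (map-upTo; length-upTo; length-++; length-map; ++-identityʳ)
import Data.List.Relation.Binary.Permutation.Setoid as Permutation
import Data.List.Relation.Binary.Permutation.Setoid.Properties as Permutationₚ
open import Data.List.Relation.Binary.Pointwise using (Pointwise; []; _∷_)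
open import Data.List.Relation.Unary.All as All using (All; []; _∷_)
import Data.List.Relation.Unary.All.Properties as Allₚ
open import Data.List.Relation.Unary.AllPairs as AllPairs using (AllPairs; []; _∷_)
import Data.List.Relation.Unary.AllPairs.Properties as AllPairsₚ
open import Data.List.Relation.Unary.Any as Any using (Any; here; there)
open import Data.List.Relation.Unary.Unique.Propositional using (Unique)
import Data.List.Relation.Unary.Unique.Propositional.Properties as Uniqueₚ
open import Data.Maybe using (nothing)
open import Data.Nat using (ℕ; zero; suc; _+_; _*_; _^_; _∸_; _≤_; _<_; z≤n; s≤s; NonZero; _!)
import Data.Nat as ℕ
import Data.Nat.Properties as ℕₚ
open import Data.Nat.Combinatorics using (_C_; nCn≡1; nCk≡n!/k![n-k]!; k![n∸k]!∣n!)
open import Data.Nat.Coprimality as Coprimality using (Coprime; coprime?)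
open import Data.Nat.DivMod using (m/n*n≡m)
open import Data.Nat.Divisibility
open import Data.Nat.GCD using (module Bézout; gcd; gcd[m,n]∣m; gcd[m,n]∣n; gcd-GCD)
open import Data.Nat.ListAction using (product)
open import Data.Nat.ListAction.Properties using (∈⇒∣product)
open import Data.Nat.Primality using (Prime; prime?; euclidsLemma; prime⇒nonZero; prime⇒nonTrivial; prime⇒irreducible;
  productOfPrimes≥1; ¬prime[0]; ¬prime[1])
open import Data.Nat.Primality.Factorisation using (factorise)
import Data.Nat.Tactic.RingSolver as ℕ-Solver
open import Data.Product using (Σ; _×_; _,_; proj₁; proj₂)
open import Data.Rational as ℚ using (ℚ; 0ℚ; 1ℚ) renaming (_+_ to _+ℚ_; _*_ to _*ℚ_; _-_ to _-ℚ_)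
import Data.Rational.Properties as ℚₚ
open import Data.Rational.Unnormalised using (mkℚᵘ; *≡*; *<*; _≃_)
import Data.Rational.Unnormalised.Properties as ℚᵘₚ
open import Data.Sum as Sum using (_⊎_; inj₁; inj₂; [_,_]′)
open import Function using (_∘_; id)
open import Relation.Binary.Bundles using (Setoid)
open import Relation.Binary.PropositionalEquality hiding (J)
import Relation.Binary.Reasoning.Setoid as SetoidReasoning
open import Relation.Nullary using (¬_; Dec; yes; no; ¬?)
open import Relation.Nullary.Decidable using (_×-dec_; ⌊_⌋)
import Tactic.RingSolver as RingSolver
open import Tactic.RingSolver.Core.AlmostCommutativeRing using (AlmostCommutativeRing; fromCommutativeRing)

-- The kernel loses nothing. The sum of c_d T over one period N is 1/N times the bilinear form of
-- the matrix T (a + b) at (c_d, c_d), and the squared norm of c_d is N φ(d); so the operator norm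
-- is paid exactly φ(d) times, as with φ(d) characters of order d.
--
-- Orthogonality comes from lines. If r lies outside the subfield, some w has Tr w = 0 and Tr (r w)
-- ≠ 0; moving x along the multiples of w by the subfield keeps t (x) fixed and averages t (r x) to
-- zero.
--
-- The constant 4 = 2² in the squared operator norm is a product of two factors 2, both because
-- doubling of exponents is two-to-one modulo N: one enters in passing from the exponents 2 b to all
-- exponents, the other in counting the pairs with Q ∣ 2 (b - a).
--
-- The main term carries N = qⁿ - 1 instead of qⁿ. The missing unit is absorbed because the stated
-- bound has q where the operator norm gives q - 1, and this also makes the inequality strict.
--
-- The passage from Q-free to primitive elements uses that a factor from the subfield multiplies Tr
-- (ξ²) only by a square.

-- Inequalities over ℤ, and bounds by a multiple of a square root

square-nonneg : ∀ x → 0ℤ ≤ᶻ x *ᶻ x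
square-nonneg (+ n) = subst (0ℤ ≤ᶻ_) (ℤₚ.pos-* n n) (ℤ.+≤+ z≤n)
square-nonneg (ℤ.-[1+ n ]) = ℤ.+≤+ z≤n

*ᶻ-monoˡ : ∀ {x a b} → 0ℤ ≤ᶻ x → a ≤ᶻ b → x *ᶻ a ≤ᶻ x *ᶻ b
*ᶻ-monoˡ {x} 0≤x a≤b = ℤₚ.*-monoˡ-≤-nonNeg x {{ℤ.nonNegative 0≤x}} a≤b

*ᶻ-nonneg : ∀ {x y} → 0ℤ ≤ᶻ x → 0ℤ ≤ᶻ y → 0ℤ ≤ᶻ x *ᶻ y
*ᶻ-nonneg {x} {y} 0≤x 0≤y = subst (_≤ᶻ x *ᶻ y) (ℤₚ.*-zeroʳ x) (*ᶻ-monoˡ 0≤x 0≤y)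

*ᶻ-positive : ∀ {x y} → 0ℤ <ᶻ x → 0ℤ <ᶻ y → 0ℤ <ᶻ x *ᶻ y
*ᶻ-positive {x} {y} 0<x 0<y = subst (_<ᶻ x *ᶻ y) (ℤₚ.*-zeroʳ x) (ℤₚ.*-monoˡ-<-pos x {{ℤ.positive 0<x}} 0<y)

+ᶻ-nonneg : ∀ {x y} → 0ℤ ≤ᶻ x → 0ℤ ≤ᶻ y → 0ℤ ≤ᶻ x +ᶻ y
+ᶻ-nonneg = ℤₚ.+-mono-≤

*ᶻ-mono : ∀ {a b c d} → 0ℤ ≤ᶻ a → 0ℤ ≤ᶻ d → a ≤ᶻ b → c ≤ᶻ d → a *ᶻ c ≤ᶻ b *ᶻ d
*ᶻ-mono {a} {b} {c} {d} 0≤a 0≤d a≤b c≤d = ℤₚ.≤-trans (*ᶻ-monoˡ 0≤a c≤d)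
  (subst₂ _≤ᶻ_ (ℤₚ.*-comm d a) (ℤₚ.*-comm d b) (*ᶻ-monoˡ 0≤d a≤b))

square-cancel-≤ : ∀ {x y} → 0ℤ ≤ᶻ y → x *ᶻ x ≤ᶻ y *ᶻ y → x ≤ᶻ y
square-cancel-≤ {x} {y} 0≤y x²≤y² with x ℤₚ.≤? y
... | yes x≤y = x≤y
... | no x≰y = ⊥-elim (ℤₚ.<-irrefl refl (ℤₚ.<-≤-trans y²<x² x²≤y²))
  where
  y<x : y <ᶻ x
  y<x = ℤₚ.≰⇒> x≰y
  0<x : 0ℤ <ᶻ x
  0<x = ℤₚ.≤-<-trans 0≤y y<x
  y²<x² : y *ᶻ y <ᶻ x *ᶻ x
  y²<x² = ℤₚ.≤-<-trans (*ᶻ-monoˡ 0≤y (ℤₚ.<⇒≤ y<x))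
    (ℤₚ.*-monoʳ-<-pos x {{ℤ.positive 0<x}} y<x)

-- "∣x∣ ≤ w √Z" without the square root
record Bounded (Z w x : ℤ) : Set where
  constructor bounded
  field
    weight≥0 : 0ℤ ≤ᶻ w
    square≤ : x *ᶻ x ≤ᶻ w *ᶻ w *ᶻ Z
open Bounded public

-- The triangle inequality. The cross term `x y` is compared with `w v Z` through the squares of
-- both, so that no root of `Z` is taken.
bounded-+ : ∀ {Z w v x y} → 0ℤ ≤ᶻ Z → Bounded Z w x → Bounded Z v y → Bounded Z (w +ᶻ v) (x +ᶻ y)
bounded-+ {Z} {w} {v} {x} {y} 0≤Z (bounded 0≤w x²) (bounded 0≤v y²) =
  bounded (+ᶻ-nonneg 0≤w 0≤v)
    (subst₂ _≤ᶻ_ (sq x y) (sqZ w v Z) (ℤₚ.+-mono-≤ x² (ℤₚ.+-mono-≤ (ℤₚ.+-mono-≤ xy xy) y²)))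
  where
  sq : ∀ x y → x *ᶻ x +ᶻ (x *ᶻ y +ᶻ x *ᶻ y +ᶻ y *ᶻ y) ≡ (x +ᶻ y) *ᶻ (x +ᶻ y)
  sq = solve-∀
  sqZ : ∀ w v Z → w *ᶻ w *ᶻ Z +ᶻ (w *ᶻ v *ᶻ Z +ᶻ w *ᶻ v *ᶻ Z +ᶻ v *ᶻ v *ᶻ Z)
      ≡ (w +ᶻ v) *ᶻ (w +ᶻ v) *ᶻ Z
  sqZ = solve-∀
  swap² : ∀ a b → (a *ᶻ a) *ᶻ (b *ᶻ b) ≡ (a *ᶻ b) *ᶻ (a *ᶻ b)
  swap² = solve-∀
  swapZ : ∀ w v Z → (w *ᶻ w *ᶻ Z) *ᶻ (v *ᶻ v *ᶻ Z) ≡ (w *ᶻ v *ᶻ Z) *ᶻ (w *ᶻ v *ᶻ Z)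
  swapZ = solve-∀
  xy : x *ᶻ y ≤ᶻ w *ᶻ v *ᶻ Z
  xy = square-cancel-≤ (*ᶻ-nonneg (*ᶻ-nonneg 0≤w 0≤v) 0≤Z)
    (subst₂ _≤ᶻ_ (swap² x y) (swapZ w v Z)
      (*ᶻ-mono (square-nonneg x) (*ᶻ-nonneg (square-nonneg v) 0≤Z) x² y²))

bounded-scale : ∀ {Z w x} c → 0ℤ ≤ᶻ c → Bounded Z w x → Bounded Z (c *ᶻ w) (c *ᶻ x)
bounded-scale {Z} {w} {x} c 0≤c (bounded 0≤w x²) =
  bounded (*ᶻ-nonneg 0≤c 0≤w) (subst₂ _≤ᶻ_ (e₁ c x) (e₂ c w Z) (*ᶻ-monoˡ (square-nonneg c) x²))
  where
  e₁ : ∀ c x → c *ᶻ c *ᶻ (x *ᶻ x) ≡ c *ᶻ x *ᶻ (c *ᶻ x)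
  e₁ = solve-∀
  e₂ : ∀ c w Z → c *ᶻ c *ᶻ (w *ᶻ w *ᶻ Z) ≡ c *ᶻ w *ᶻ (c *ᶻ w) *ᶻ Z
  e₂ = solve-∀

bounded-neg : ∀ {Z w x} → Bounded Z w x → Bounded Z w (-ᶻ x)
bounded-neg {Z} {w} {x} (bounded 0≤w x²) = bounded 0≤w (subst (_≤ᶻ w *ᶻ w *ᶻ Z) (e x) x²)
  where
  e : ∀ x → x *ᶻ x ≡ -ᶻ x *ᶻ -ᶻ x
  e = solve-∀

-- Finite sums of integers

∑ : ∀ {a} {A : Set a} → List A → (A → ℤ) → ℤ
∑ [] f = 0ℤ
∑ (x ∷ xs) f = f x +ᶻ ∑ xs f

module _ {a} {A : Set a} where

  ∑-cong : ∀ (xs : List A) {f g : A → ℤ} → (∀ x → f x ≡ g x) → ∑ xs f ≡ ∑ xs g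
  ∑-cong [] f≡g = refl
  ∑-cong (x ∷ xs) f≡g = cong₂ _+ᶻ_ (f≡g x) (∑-cong xs f≡g)

  ∑-mono : ∀ (xs : List A) {f g : A → ℤ} → (∀ x → f x ≤ᶻ g x) → ∑ xs f ≤ᶻ ∑ xs g
  ∑-mono [] f≤g = ℤₚ.≤-refl
  ∑-mono (x ∷ xs) f≤g = ℤₚ.+-mono-≤ (f≤g x) (∑-mono xs f≤g)

  ∑-zero : ∀ (xs : List A) {f : A → ℤ} → (∀ x → f x ≡ 0ℤ) → ∑ xs f ≡ 0ℤ
  ∑-zero [] f≡0 = refl
  ∑-zero (x ∷ xs) f≡0 = cong₂ _+ᶻ_ (f≡0 x) (∑-zero xs f≡0)

  ∑-nonneg : ∀ (xs : List A) {f : A → ℤ} → (∀ x → 0ℤ ≤ᶻ f x) → 0ℤ ≤ᶻ ∑ xs f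
  ∑-nonneg [] 0≤f = ℤₚ.≤-refl
  ∑-nonneg (x ∷ xs) 0≤f = +ᶻ-nonneg (0≤f x) (∑-nonneg xs 0≤f)

  ∑-+ : ∀ (xs : List A) (f g : A → ℤ) → ∑ xs (λ x → f x +ᶻ g x) ≡ ∑ xs f +ᶻ ∑ xs g
  ∑-+ [] f g = refl
  ∑-+ (x ∷ xs) f g = trans (cong (f x +ᶻ g x +ᶻ_) (∑-+ xs f g)) (e (f x) (g x) (∑ xs f) (∑ xs g))
    where
    e : ∀ a b c d → a +ᶻ b +ᶻ (c +ᶻ d) ≡ a +ᶻ c +ᶻ (b +ᶻ d)
    e = solve-∀

  ∑-*ˡ : ∀ (xs : List A) c (f : A → ℤ) → ∑ xs (λ x → c *ᶻ f x) ≡ c *ᶻ ∑ xs f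
  ∑-*ˡ [] c f = sym (ℤₚ.*-zeroʳ c)
  ∑-*ˡ (x ∷ xs) c f = trans (cong (c *ᶻ f x +ᶻ_) (∑-*ˡ xs c f)) (sym (ℤₚ.*-distribˡ-+ c (f x) (∑ xs f)))

  ∑-*ʳ : ∀ (xs : List A) c (f : A → ℤ) → ∑ xs (λ x → f x *ᶻ c) ≡ ∑ xs f *ᶻ c
  ∑-*ʳ xs c f = trans (∑-cong xs (λ x → ℤₚ.*-comm (f x) c)) (trans (∑-*ˡ xs c f) (ℤₚ.*-comm c (∑ xs f)))

  ∑-neg : ∀ (xs : List A) (f : A → ℤ) → ∑ xs (λ x → -ᶻ f x) ≡ -ᶻ ∑ xs f
  ∑-neg [] f = refl
  ∑-neg (x ∷ xs) f = trans (cong (-ᶻ f x +ᶻ_) (∑-neg xs f)) (sym (ℤₚ.neg-distrib-+ (f x) (∑ xs f)))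

  ∑-- : ∀ (xs : List A) (f g : A → ℤ) → ∑ xs (λ x → f x -ᶻ g x) ≡ ∑ xs f -ᶻ ∑ xs g
  ∑-- xs f g = trans (∑-+ xs f (λ x → -ᶻ g x)) (cong (∑ xs f +ᶻ_) (∑-neg xs g))

  ∑-const : ∀ (xs : List A) c → ∑ xs (λ _ → c) ≡ + length xs *ᶻ c
  ∑-const [] c = sym (ℤₚ.*-zeroˡ c)
  ∑-const (x ∷ xs) c = trans (cong (c +ᶻ_) (∑-const xs c)) (sym (ℤₚ.suc-* (+ length xs) c))

  ∑-map : ∀ {b} {B : Set b} (h : B → A) (xs : List B) (f : A → ℤ) → ∑ (map h xs) f ≡ ∑ xs (f ∘ h)
  ∑-map h [] f = refl
  ∑-map h (x ∷ xs) f = cong (f (h x) +ᶻ_) (∑-map h xs f)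

  ∑-square : ∀ (xs : List A) (f : A → ℤ) → ∑ xs f *ᶻ ∑ xs f ≡ ∑ xs (λ x → ∑ xs (λ y → f x *ᶻ f y))
  ∑-square xs f = trans (sym (∑-*ʳ xs (∑ xs f) f)) (∑-cong xs (λ x → sym (∑-*ˡ xs (f x) f)))

  -- Induction on the list. The new cross term satisfies 2uvS ≤ u²B + v²A: by induction 4u²v²S² ≤
  -- 4u²v²AB, and the right side is (u²B + v²A)² minus the square of u²B - v²A.
  cauchy-schwarz : ∀ (xs : List A) (f g : A → ℤ) →
    ∑ xs (λ x → f x *ᶻ g x) *ᶻ ∑ xs (λ x → f x *ᶻ g x) ≤ᶻ ∑ xs (λ x → f x *ᶻ f x) *ᶻ ∑ xs (λ x → g x *ᶻ g x)
  cauchy-schwarz [] f g = ℤₚ.≤-refl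
  cauchy-schwarz (x ∷ xs) f g = subst₂ _≤ᶻ_ (e₁ u v S) (e₂ u v A′ B′)
    (ℤₚ.+-monoʳ-≤ (u *ᶻ v *ᶻ (u *ᶻ v)) (ℤₚ.+-mono-≤ cross (cauchy-schwarz xs f g)))
    where
    u = f x
    v = g x
    S = ∑ xs (λ x → f x *ᶻ g x)
    A′ = ∑ xs (λ x → f x *ᶻ f x)
    B′ = ∑ xs (λ x → g x *ᶻ g x)
    0≤A = ∑-nonneg xs (λ x → square-nonneg (f x))
    0≤B = ∑-nonneg xs (λ x → square-nonneg (g x))
    e₁ : ∀ u v S → u *ᶻ v *ᶻ (u *ᶻ v) +ᶻ (+ 2 *ᶻ (u *ᶻ v *ᶻ S) +ᶻ S *ᶻ S) ≡ (u *ᶻ v +ᶻ S) *ᶻ (u *ᶻ v +ᶻ S)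
    e₁ = solve-∀
    e₂ : ∀ u v A B → u *ᶻ v *ᶻ (u *ᶻ v) +ᶻ (u *ᶻ u *ᶻ B +ᶻ v *ᶻ v *ᶻ A +ᶻ A *ᶻ B)
       ≡ (u *ᶻ u +ᶻ A) *ᶻ (v *ᶻ v +ᶻ B)
    e₂ = solve-∀
    e₃ : ∀ u v S → + 4 *ᶻ (u *ᶻ u) *ᶻ (v *ᶻ v) *ᶻ (S *ᶻ S) ≡ + 2 *ᶻ (u *ᶻ v *ᶻ S) *ᶻ (+ 2 *ᶻ (u *ᶻ v *ᶻ S))
    e₃ = solve-∀
    e₄ : ∀ u v A B → + 4 *ᶻ (u *ᶻ u) *ᶻ (v *ᶻ v) *ᶻ (A *ᶻ B)
         +ᶻ (u *ᶻ u *ᶻ B -ᶻ v *ᶻ v *ᶻ A) *ᶻ (u *ᶻ u *ᶻ B -ᶻ v *ᶻ v *ᶻ A)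
       ≡ (u *ᶻ u *ᶻ B +ᶻ v *ᶻ v *ᶻ A) *ᶻ (u *ᶻ u *ᶻ B +ᶻ v *ᶻ v *ᶻ A)
    e₄ = solve-∀
    cross : + 2 *ᶻ (u *ᶻ v *ᶻ S) ≤ᶻ u *ᶻ u *ᶻ B′ +ᶻ v *ᶻ v *ᶻ A′
    cross = square-cancel-≤
      (+ᶻ-nonneg (*ᶻ-nonneg (square-nonneg u) 0≤B) (*ᶻ-nonneg (square-nonneg v) 0≤A))
      (subst₂ _≤ᶻ_ (trans (ℤₚ.+-identityʳ _) (e₃ u v S)) (e₄ u v A′ B′)
        (ℤₚ.+-mono-≤
          (*ᶻ-monoˡ (*ᶻ-nonneg (*ᶻ-nonneg (ℤ.+≤+ {0} {4} z≤n) (square-nonneg u)) (square-nonneg v)) (cauchy-schwarz xs f g))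
          (square-nonneg (u *ᶻ u *ᶻ B′ -ᶻ v *ᶻ v *ᶻ A′))))

∑-swap : ∀ {a b} {A : Set a} {B : Set b} (xs : List A) (ys : List B) (f : A → B → ℤ) →
         ∑ xs (λ x → ∑ ys (f x)) ≡ ∑ ys (λ y → ∑ xs (λ x → f x y))
∑-swap [] ys f = sym (∑-zero ys (λ _ → refl))
∑-swap (x ∷ xs) ys f = trans (cong (∑ ys (f x) +ᶻ_) (∑-swap xs ys f))
  (sym (∑-+ ys (f x) (λ y → ∑ xs (λ x → f x y))))

-- Sums of periodic functions

∑< : ℕ → (ℕ → ℤ) → ℤ
∑< n f = ∑ (upTo n) f

∑<-suc : ∀ n f → ∑< (suc n) f ≡ f 0 +ᶻ ∑< n (f ∘ suc)
∑<-suc n f = cong (f 0 +ᶻ_) (trans (cong (λ l → ∑ l f) (sym (map-upTo suc n))) (∑-map suc (upTo n) f))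

∑<-+ : ∀ m n f → ∑< (m + n) f ≡ ∑< m f +ᶻ ∑< n (λ i → f (m + i))
∑<-+ zero n f = sym (ℤₚ.+-identityˡ _)
∑<-+ (suc m) n f = begin
  ∑< (suc (m + n)) f ≡⟨ ∑<-suc (m + n) f ⟩
  f 0 +ᶻ ∑< (m + n) (f ∘ suc) ≡⟨ cong (f 0 +ᶻ_) (∑<-+ m n (f ∘ suc)) ⟩
  f 0 +ᶻ (∑< m (f ∘ suc) +ᶻ ∑< n (λ i → f (suc m + i))) ≡⟨ sym (ℤₚ.+-assoc (f 0) _ _) ⟩
  f 0 +ᶻ ∑< m (f ∘ suc) +ᶻ ∑< n (λ i → f (suc m + i)) ≡⟨ cong (_+ᶻ ∑< n (λ i → f (suc m + i))) (sym (∑<-suc m f)) ⟩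
  ∑< (suc m) f +ᶻ ∑< n (λ i → f (suc m + i)) ∎
  where open ≡-Reasoning

∑<-const : ∀ n c → ∑< n (λ _ → c) ≡ + n *ᶻ c
∑<-const n c = trans (∑-const (upTo n) c) (cong (λ k → + k *ᶻ c) (length-upTo n))

∑<-blocks : ∀ y x f → ∑< (y * x) f ≡ ∑< y (λ j → ∑< x (λ i → f (j * x + i)))
∑<-blocks zero x f = refl
∑<-blocks (suc y) x f = begin
  ∑< (x + y * x) f ≡⟨ ∑<-+ x (y * x) f ⟩
  ∑< x f +ᶻ ∑< (y * x) (λ i → f (x + i)) ≡⟨ cong (∑< x f +ᶻ_) (∑<-blocks y x (λ i → f (x + i))) ⟩
  ∑< x f +ᶻ ∑< y (λ j → ∑< x (λ i → f (x + (j * x + i))))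
    ≡⟨ cong (∑< x f +ᶻ_) (∑-cong (upTo y) (λ j → ∑-cong (upTo x) (λ i → cong f (sym (ℕₚ.+-assoc x (j * x) i))))) ⟩
  ∑< x f +ᶻ ∑< y (λ j → ∑< x (λ i → f (suc j * x + i)))
    ≡⟨ sym (∑<-suc y (λ j → ∑< x (λ i → f (j * x + i)))) ⟩
  ∑< (suc y) (λ j → ∑< x (λ i → f (j * x + i))) ∎
  where open ≡-Reasoning

Periodic : ℕ → (ℕ → ℤ) → Set
Periodic m f = ∀ i → f (m + i) ≡ f i

periodic-multiple : ∀ {m f} → Periodic m f → ∀ j → Periodic (j * m) f
periodic-multiple per zero i = refl
periodic-multiple {m} {f} per (suc j) i =
  trans (cong f (ℕₚ.+-assoc m (j * m) i)) (trans (per (j * m + i)) (periodic-multiple per j i))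

periodic-* : ∀ {m f g} → Periodic m f → Periodic m g → Periodic m (λ i → f i *ᶻ g i)
periodic-* pf pg i = cong₂ _*ᶻ_ (pf i) (pg i)

∑<-shift : ∀ {m f} → Periodic m f → ∀ s → ∑< m (λ i → f (s + i)) ≡ ∑< m f
∑<-shift per zero = refl
∑<-shift {m} {f} per (suc s) = trans (∑<-shift {m} {f ∘ suc} (λ i → trans (cong f (sym (ℕₚ.+-suc m i))) (per (suc i))) s) step
  where
  open ≡-Reasoning
  cancel : ∀ a b c → a +ᶻ b ≡ c +ᶻ (a +ᶻ 0ℤ) → b ≡ c
  cancel a b c eq = AbelianGroupProperties.∙-cancelˡ ℤₚ.+-0-abelianGroup a b c (trans eq (trans (cong (c +ᶻ_) (ℤₚ.+-identityʳ a)) (ℤₚ.+-comm c a)))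
  step : ∑< m (f ∘ suc) ≡ ∑< m f
  step = cancel (f 0) _ _ (begin
    f 0 +ᶻ ∑< m (f ∘ suc) ≡⟨ sym (∑<-suc m f) ⟩
    ∑< (suc m) f ≡⟨ cong (λ k → ∑< k f) (ℕₚ.+-comm 1 m) ⟩
    ∑< (m + 1) f ≡⟨ ∑<-+ m 1 f ⟩
    ∑< m f +ᶻ (f (m + 0) +ᶻ 0ℤ) ≡⟨ cong (λ z → ∑< m f +ᶻ (z +ᶻ 0ℤ)) (per 0) ⟩
    ∑< m f +ᶻ (f 0 +ᶻ 0ℤ) ∎)

∑<-periods : ∀ {m f} → Periodic m f → ∀ j → ∑< (j * m) f ≡ + j *ᶻ ∑< m f
∑<-periods {m} {f} per j = trans (∑<-blocks j m f)
  (trans (∑-cong (upTo j) (λ i → ∑-cong (upTo m) (periodic-multiple per i))) (∑<-const j _))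

-- No permutation of the residues is constructed. As a function of `i` the left side has the periods
-- `x` and `y`, hence by Bézout the period 1, and averaging over `i` identifies the constant.
∑<-stretch : ∀ y x g i → Periodic y g → Coprime x y → ∑< y (λ j → g (i + x * j)) ≡ ∑< y g
∑<-stretch zero x g i per cop = refl
∑<-stretch y@(suc _) x g i per cop = trans (G-const i) (sym average)
  where
  open ≡-Reasoning
  G : ℕ → ℤ
  G i = ∑< y (λ j → g (i + x * j))
  inner : ∀ i → Periodic y (λ j → g (i + x * j))
  inner i j = trans (cong g (e i x y j)) (periodic-multiple per x (i + x * j))
    where
    e : ∀ i x y j → i + x * (y + j) ≡ x * y + (i + x * j)
    e = ℕ-Solver.solve-∀
  G-x : Periodic x G
  G-x i = trans (∑-cong (upTo y) (λ j → cong g (e i x j))) (∑<-shift (inner i) 1)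
    where
    e : ∀ i x j → x + i + x * j ≡ i + x * (1 + j)
    e = ℕ-Solver.solve-∀
  G-y : Periodic y G
  G-y i = ∑-cong (upTo y) (λ j → trans (cong g (ℕₚ.+-assoc y i (x * j))) (per (i + x * j)))
  G-suc : ∀ i → G (suc i) ≡ G i
  G-suc i with Coprimality.coprime-Bézout cop
  ... | Bézout.+- u v eq = begin
    G (suc i) ≡⟨ sym (periodic-multiple G-y v (suc i)) ⟩
    G (v * y + suc i) ≡⟨ cong G (trans (ℕₚ.+-suc (v * y) i) (cong (_+ i) eq)) ⟩
    G (u * x + i) ≡⟨ periodic-multiple G-x u i ⟩
    G i ∎
  ... | Bézout.-+ u v eq = begin
    G (suc i) ≡⟨ sym (periodic-multiple G-x u (suc i)) ⟩
    G (u * x + suc i) ≡⟨ cong G (trans (ℕₚ.+-suc (u * x) i) (cong (_+ i) eq)) ⟩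
    G (v * y + i) ≡⟨ periodic-multiple G-y v i ⟩
    G i ∎
  G-zero : ∀ i → G i ≡ G 0
  G-zero zero = refl
  G-zero (suc i) = trans (G-suc i) (G-zero i)
  G-const : ∀ i → G i ≡ G 0
  G-const = G-zero
  average : ∑< y g ≡ G 0
  average = ℤₚ.*-cancelˡ-≡ (+ y) _ _ (begin
    + y *ᶻ ∑< y g ≡⟨ sym (∑<-const y (∑< y g)) ⟩
    ∑< y (λ _ → ∑< y g) ≡⟨ ∑-cong (upTo y) (λ j → sym (∑<-shift per (x * j))) ⟩
    ∑< y (λ j → ∑< y (λ i → g (x * j + i))) ≡⟨ ∑-swap (upTo y) (upTo y) (λ j i → g (x * j + i)) ⟩
    ∑< y (λ i → ∑< y (λ j → g (x * j + i)))
      ≡⟨ ∑-cong (upTo y) (λ i → ∑-cong (upTo y) (λ j → cong g (ℕₚ.+-comm (x * j) i))) ⟩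
    ∑< y G ≡⟨ ∑-cong (upTo y) G-zero ⟩
    ∑< y (λ _ → G 0) ≡⟨ ∑<-const y (G 0) ⟩
    + y *ᶻ G 0 ∎)

-- The Chinese remainder theorem for sums: with the index written as `j * x + i`, the first factor
-- depends on `i` only, while the second runs through a full period as `j` varies.
∑<-independent : ∀ {x y f g} → Periodic x f → Periodic y g → Coprime x y →
  ∑< (x * y) (λ i → f i *ᶻ g i) ≡ ∑< x f *ᶻ ∑< y g
∑<-independent {x} {y} {f} {g} pf pg cop = begin
  ∑< (x * y) (λ i → f i *ᶻ g i) ≡⟨ cong (λ k → ∑< k (λ i → f i *ᶻ g i)) (ℕₚ.*-comm x y) ⟩
  ∑< (y * x) (λ i → f i *ᶻ g i) ≡⟨ ∑<-blocks y x _ ⟩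
  ∑< y (λ j → ∑< x (λ i → f (j * x + i) *ᶻ g (j * x + i)))
    ≡⟨ ∑-swap (upTo y) (upTo x) (λ j i → f (j * x + i) *ᶻ g (j * x + i)) ⟩
  ∑< x (λ i → ∑< y (λ j → f (j * x + i) *ᶻ g (j * x + i)))
    ≡⟨ ∑-cong (upTo x) (λ i → ∑-cong (upTo y) (λ j → cong₂ _*ᶻ_ (periodic-multiple pf j i) (cong g (e j x i)))) ⟩
  ∑< x (λ i → ∑< y (λ j → f i *ᶻ g (i + x * j)))
    ≡⟨ ∑-cong (upTo x) (λ i → trans (∑-*ˡ (upTo y) (f i) _) (cong (f i *ᶻ_) (∑<-stretch y x g i pg cop))) ⟩
  ∑< x (λ i → f i *ᶻ ∑< y g) ≡⟨ ∑-*ʳ (upTo x) (∑< y g) f ⟩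
  ∑< x f *ᶻ ∑< y g ∎
  where
  open ≡-Reasoning
  e : ∀ j x i → j * x + i ≡ i + x * j
  e = ℕ-Solver.solve-∀

-- Doubling is at most two-to-one modulo `m`: the even numbers below 2m are among all numbers below
-- 2m, which form two periods.
∑<-even : ∀ {m f} → Periodic m f → (∀ i → 0ℤ ≤ᶻ f i) → ∑< m (λ i → f (i * 2)) ≤ᶻ + 2 *ᶻ ∑< m f
∑<-even {m} {f} per 0≤f = subst (∑< m (λ i → f (i * 2)) ≤ᶻ_) (∑<-periods per 2)
  (subst (λ k → ∑< m (λ i → f (i * 2)) ≤ᶻ ∑< k f) (ℕₚ.*-comm m 2)
    (subst (∑< m (λ i → f (i * 2)) ≤ᶻ_) (sym (∑<-blocks m 2 f)) (∑-mono (upTo m) bound)))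
  where
  bound : ∀ i → f (i * 2) ≤ᶻ f (i * 2 + 0) +ᶻ (f (i * 2 + 1) +ᶻ 0ℤ)
  bound i = subst (_≤ᶻ f (i * 2 + 0) +ᶻ (f (i * 2 + 1) +ᶻ 0ℤ))
    (trans (ℤₚ.+-identityʳ _) (cong f (ℕₚ.+-identityʳ (i * 2))))
    (ℤₚ.+-monoʳ-≤ (f (i * 2 + 0)) (+ᶻ-nonneg (0≤f (i * 2 + 1)) ℤₚ.≤-refl))

∑<-cong : ∀ n {f g : ℕ → ℤ} → (∀ i → i < n → f i ≡ g i) → ∑< n f ≡ ∑< n g
∑<-cong zero f≡g = refl
∑<-cong (suc n) {f} {g} f≡g = begin
  ∑< (suc n) f ≡⟨ ∑<-suc n f ⟩
  f 0 +ᶻ ∑< n (f ∘ suc) ≡⟨ cong₂ _+ᶻ_ (f≡g 0 (s≤s z≤n)) (∑<-cong n (λ i i<n → f≡g (suc i) (s≤s i<n))) ⟩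
  g 0 +ᶻ ∑< n (g ∘ suc) ≡⟨ sym (∑<-suc n g) ⟩
  ∑< (suc n) g ∎
  where open ≡-Reasoning

periodic-affine : ∀ {m f} → Periodic m f → ∀ c x → Periodic m (λ b → f (c + x * b))
periodic-affine {m} {f} per c x b = trans (cong f (e c x m b)) (periodic-multiple per x (c + x * b))
  where
  e : ∀ c x m b → c + x * (m + b) ≡ x * m + (c + x * b)
  e = ℕ-Solver.solve-∀

periodic-∣ : ∀ {m n f} → m ∣ n → Periodic m f → Periodic n f
periodic-∣ (divides j refl) per = periodic-multiple per j

-- Indicators

⟦_⟧ : ∀ {a} {A : Set a} → Dec A → ℤ
⟦ yes _ ⟧ = 1ℤ
⟦ no _ ⟧ = 0ℤ

⟦⟧-cong : ∀ {a b} {A : Set a} {B : Set b} (A? : Dec A) (B? : Dec B) → (A → B) → (B → A) → ⟦ A? ⟧ ≡ ⟦ B? ⟧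
⟦⟧-cong (yes a) (yes b) f g = refl
⟦⟧-cong (yes a) (no ¬b) f g = ⊥-elim (¬b (f a))
⟦⟧-cong (no ¬a) (yes b) f g = ⊥-elim (¬a (g b))
⟦⟧-cong (no ¬a) (no ¬b) f g = refl

⟦⟧-true : ∀ {a} {A : Set a} (A? : Dec A) → A → ⟦ A? ⟧ ≡ 1ℤ
⟦⟧-true (yes _) a = refl
⟦⟧-true (no ¬a) a = ⊥-elim (¬a a)

⟦⟧-false : ∀ {a} {A : Set a} (A? : Dec A) → ¬ A → ⟦ A? ⟧ ≡ 0ℤ
⟦⟧-false (yes a) ¬a = ⊥-elim (¬a a)
⟦⟧-false (no _) ¬a = refl

⟦⟧-nonneg : ∀ {a} {A : Set a} (A? : Dec A) → 0ℤ ≤ᶻ ⟦ A? ⟧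
⟦⟧-nonneg (yes _) = ℤ.+≤+ z≤n
⟦⟧-nonneg (no _) = ℤ.+≤+ z≤n

⟦∣⟧-periodic : ∀ p → Periodic p (λ a → ⟦ p ∣? a ⟧)
⟦∣⟧-periodic p i = ⟦⟧-cong (p ∣? (p + i)) (p ∣? i) (λ d → ∣m+n∣m⇒∣n d ∣-refl) (∣m∣n⇒∣m+n ∣-refl)

∑<-⟦∣⟧ : ∀ p .{{_ : NonZero p}} (f : ℕ → ℤ) → ∑< p (λ b → ⟦ p ∣? b ⟧ *ᶻ f b) ≡ f 0
∑<-⟦∣⟧ p@(suc m) f = begin
  ∑< p (λ b → ⟦ p ∣? b ⟧ *ᶻ f b) ≡⟨ ∑<-suc m (λ b → ⟦ p ∣? b ⟧ *ᶻ f b) ⟩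
  ⟦ p ∣? 0 ⟧ *ᶻ f 0 +ᶻ ∑< m (λ b → ⟦ p ∣? suc b ⟧ *ᶻ f (suc b))
    ≡⟨ cong₂ _+ᶻ_ (trans (cong (_*ᶻ f 0) (⟦⟧-true (p ∣? 0) (p ∣0))) (ℤₚ.*-identityˡ (f 0)))
        (trans (∑<-cong m (λ b b<m → trans (cong (_*ᶻ f (suc b)) (⟦⟧-false (p ∣? suc b) (>⇒∤ (s≤s b<m)))) (ℤₚ.*-zeroˡ (f (suc b)))))
          (∑-zero (upTo m) (λ _ → refl))) ⟩
  f 0 +ᶻ 0ℤ ≡⟨ ℤₚ.+-identityʳ (f 0) ⟩
  f 0 ∎
  where open ≡-Reasoning

∑<-count-∣ : ∀ p .{{_ : NonZero p}} → ∑< p (λ b → ⟦ p ∣? b ⟧) ≡ 1ℤ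
∑<-count-∣ p = trans (∑-cong (upTo p) (λ b → sym (ℤₚ.*-identityʳ ⟦ p ∣? b ⟧))) (∑<-⟦∣⟧ p (λ _ → 1ℤ))

-- Ramanujan sums: h p = c_p for a prime p, and H D is their product over the list D, i.e. c_d with
-- d = product D squarefree.

h : ℕ → ℕ → ℤ
h p a = + p *ᶻ ⟦ p ∣? a ⟧ -ᶻ 1ℤ

H : List ℕ → ℕ → ℤ
H [] a = 1ℤ
H (p ∷ D) a = h p a *ᶻ H D a

-- Euler's totient of `product D` when `D` consists of distinct primes.
φ : List ℕ → ℤ
φ [] = 1ℤ
φ (p ∷ D) = (+ p -ᶻ 1ℤ) *ᶻ φ D

-- Coprimality of each member to the product of the later ones is what makes the factors of `H D`
-- independent in the sense of `∑<-independent`.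
data CoprimeFactors : List ℕ → Set where
  [] : CoprimeFactors []
  _∷_ : ∀ {p D} → NonZero p × Coprime p (product D) → CoprimeFactors D → CoprimeFactors (p ∷ D)

h-periodic : ∀ p → Periodic p (h p)
h-periodic p i = cong (λ z → + p *ᶻ z -ᶻ 1ℤ) (⟦∣⟧-periodic p i)

H-periodic : ∀ D → Periodic (product D) (H D)
H-periodic [] i = refl
H-periodic (p ∷ D) = periodic-* (periodic-∣ (m∣m*n (product D)) (h-periodic p)) (periodic-∣ (n∣m*n p) (H-periodic D))

h-at-0 : ∀ p → h p 0 ≡ + p -ᶻ 1ℤ
h-at-0 p = cong (_-ᶻ 1ℤ) (trans (cong (+ p *ᶻ_) (⟦⟧-true (p ∣? 0) (p ∣0))) (ℤₚ.*-identityʳ (+ p)))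

H-at-0 : ∀ D → H D 0 ≡ φ D
H-at-0 [] = refl
H-at-0 (p ∷ D) = cong₂ _*ᶻ_ (h-at-0 p) (H-at-0 D)

∑<-h : ∀ p .{{_ : NonZero p}} → ∑< p (h p) ≡ 0ℤ
∑<-h p = begin
  ∑< p (h p) ≡⟨ ∑-- (upTo p) (λ b → + p *ᶻ ⟦ p ∣? b ⟧) (λ _ → 1ℤ) ⟩
  ∑< p (λ b → + p *ᶻ ⟦ p ∣? b ⟧) -ᶻ ∑< p (λ _ → 1ℤ)
    ≡⟨ cong₂ _-ᶻ_ (trans (∑-*ˡ (upTo p) (+ p) _) (cong (+ p *ᶻ_) (∑<-count-∣ p))) (∑<-const p 1ℤ) ⟩
  + p *ᶻ 1ℤ -ᶻ + p *ᶻ 1ℤ ≡⟨ ℤₚ.+-inverseʳ (+ p *ᶻ 1ℤ) ⟩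
  0ℤ ∎
  where open ≡-Reasoning

-- In `h p b` the multiple of the indicator picks out `b = 0`, and the -1 sums the other factor over
-- a full period, where `h p` has mean zero.
h-convolution : ∀ p .{{_ : NonZero p}} x → Coprime x p → ∀ c →
  ∑< p (λ b → h p b *ᶻ h p (c + x * b)) ≡ + p *ᶻ h p c
h-convolution p x cop c = begin
  ∑< p (λ b → h p b *ᶻ h p (c + x * b))
    ≡⟨ ∑-cong (upTo p) (λ b → e (+ p) ⟦ p ∣? b ⟧ (h p (c + x * b))) ⟩
  ∑< p (λ b → ⟦ p ∣? b ⟧ *ᶻ (+ p *ᶻ h p (c + x * b)) -ᶻ h p (c + x * b))
    ≡⟨ ∑-- (upTo p) (λ b → ⟦ p ∣? b ⟧ *ᶻ (+ p *ᶻ h p (c + x * b))) (λ b → h p (c + x * b)) ⟩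
  ∑< p (λ b → ⟦ p ∣? b ⟧ *ᶻ (+ p *ᶻ h p (c + x * b))) -ᶻ ∑< p (λ b → h p (c + x * b))
    ≡⟨ cong₂ _-ᶻ_ (∑<-⟦∣⟧ p (λ b → + p *ᶻ h p (c + x * b)))
         (trans (∑<-stretch p x (h p) c (h-periodic p) cop) (∑<-h p)) ⟩
  + p *ᶻ h p (c + x * 0) -ᶻ 0ℤ ≡⟨ ℤₚ.+-identityʳ _ ⟩
  + p *ᶻ h p (c + x * 0) ≡⟨ cong (λ z → + p *ᶻ h p z) (trans (cong (λ y → c + y) (ℕₚ.*-zeroʳ x)) (ℕₚ.+-identityʳ c)) ⟩
  + p *ᶻ h p c ∎
  where
  open ≡-Reasoning
  e : ∀ p i y → (p *ᶻ i -ᶻ 1ℤ) *ᶻ y ≡ i *ᶻ (p *ᶻ y) -ᶻ y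
  e = solve-∀

coprime-∣ʳ : ∀ {x m n} → Coprime x n → m ∣ n → Coprime x m
coprime-∣ʳ cop m∣n (d∣x , d∣m) = cop (d∣x , ∣-trans d∣m m∣n)

coprime-* : ∀ {a b c} → Coprime a c → Coprime b c → Coprime (a * b) c
coprime-* {a} {b} {c} ca cb {d} (d∣ab , d∣c) = cb (Coprimality.coprime-divisor d⊥a d∣ab , d∣c)
  where
  d⊥a : Coprime d a
  d⊥a (e∣d , e∣a) = ca (e∣a , ∣-trans e∣d d∣c)

-- The multiplier `x` covers two uses: `x = 1` gives the norm of the kernel, and `x = N - 1`, which
-- stands for -1, gives the convolution.
H-convolution : ∀ {D} → CoprimeFactors D → ∀ x → Coprime x (product D) → ∀ c →
  ∑< (product D) (λ b → H D b *ᶻ H D (c + x * b)) ≡ + product D *ᶻ H D c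
H-convolution [] x cop c = refl
H-convolution {p ∷ D} ((p≢0 , p⊥D) ∷ cf) x cop c = begin
  ∑< (p * product D) (λ b → h p b *ᶻ H D b *ᶻ (h p (c + x * b) *ᶻ H D (c + x * b)))
    ≡⟨ ∑-cong (upTo (p * product D)) (λ b → e (h p b) (H D b) (h p (c + x * b)) (H D (c + x * b))) ⟩
  ∑< (p * product D) (λ b → (h p b *ᶻ h p (c + x * b)) *ᶻ (H D b *ᶻ H D (c + x * b)))
    ≡⟨ ∑<-independent (periodic-* (h-periodic p) (periodic-affine (h-periodic p) c x))
                      (periodic-* (H-periodic D) (periodic-affine (H-periodic D) c x)) p⊥D ⟩
  ∑< p (λ b → h p b *ᶻ h p (c + x * b)) *ᶻ ∑< (product D) (λ b → H D b *ᶻ H D (c + x * b))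
    ≡⟨ cong₂ _*ᶻ_ (h-convolution p {{p≢0}} x (coprime-∣ʳ cop (m∣m*n (product D))) c)
                  (H-convolution cf x (coprime-∣ʳ cop (n∣m*n p)) c) ⟩
  (+ p *ᶻ h p c) *ᶻ (+ product D *ᶻ H D c) ≡⟨ e (+ p) (h p c) (+ product D) (H D c) ⟩
  (+ p *ᶻ + product D) *ᶻ (h p c *ᶻ H D c) ≡⟨ cong (_*ᶻ (h p c *ᶻ H D c)) (sym (ℤₚ.pos-* p (product D))) ⟩
  + (p * product D) *ᶻ (h p c *ᶻ H D c) ∎
  where
  open ≡-Reasoning
  e : ∀ a b c d → a *ᶻ b *ᶻ (c *ᶻ d) ≡ (a *ᶻ c) *ᶻ (b *ᶻ d)
  e = solve-∀

coprime-pred : ∀ n → Coprime n (suc n)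
coprime-pred n {d} (d∣n , d∣1+n) = ∣1⇒≡1 (∣m+n∣m⇒∣n (subst (d ∣_) (ℕₚ.+-comm 1 n) d∣1+n) d∣n)

φ-nonneg : ∀ {D} → CoprimeFactors D → 0ℤ ≤ᶻ φ D
φ-nonneg [] = ℤ.+≤+ z≤n
φ-nonneg {suc p ∷ D} (_ ∷ cf) = *ᶻ-nonneg (ℤ.+≤+ {0} {p} z≤n) (φ-nonneg cf)

∑<-scaled-period : ∀ {d f c} N → d ∣ N → Periodic d f → ∑< d f ≡ + d *ᶻ c → ∑< N f ≡ + N *ᶻ c
∑<-scaled-period {d} {f} {c} N (divides j refl) per eq = begin
  ∑< (j * d) f ≡⟨ ∑<-periods per j ⟩
  + j *ᶻ ∑< d f ≡⟨ cong (+ j *ᶻ_) eq ⟩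
  + j *ᶻ (+ d *ᶻ c) ≡⟨ sym (ℤₚ.*-assoc (+ j) (+ d) c) ⟩
  + j *ᶻ + d *ᶻ c ≡⟨ cong (_*ᶻ c) (sym (ℤₚ.pos-* j d)) ⟩
  + (j * d) *ᶻ c ∎
  where open ≡-Reasoning

-- The operator bound for the convolution matrix T (a + b), evaluated on the reproducing kernel H D, bounds
-- the single value ∑ H D · T.
module _ (n : ℕ) (T : ℕ → ℤ) (T-periodic : Periodic (suc n) T) (L : ℤ)
  (operator-bound : ∀ (u : ℕ → ℤ) →
    ∑< (suc n) (λ b → ∑< (suc n) (λ a → u a *ᶻ T (a + b)) *ᶻ ∑< (suc n) (λ a → u a *ᶻ T (a + b)))
      ≤ᶻ L *ᶻ ∑< (suc n) (λ a → u a *ᶻ u a)) where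

  private
    N = suc n

  H-sum-bound : ∀ {D} → CoprimeFactors D → product D ∣ N → Bounded L (φ D) (∑< N (λ a → H D a *ᶻ T a))
  H-sum-bound {D} cf d∣N = bounded (φ-nonneg cf)
    (ℤₚ.*-cancelˡ-≤-pos (S *ᶻ S) (φ D *ᶻ φ D *ᶻ L) (+ N *ᶻ + N) (begin
      + N *ᶻ + N *ᶻ (S *ᶻ S) ≡⟨ e₁ (+ N) S ⟩
      (+ N *ᶻ S) *ᶻ (+ N *ᶻ S) ≡⟨ cong₂ _*ᶻ_ reproduce reproduce ⟩
      ∑< N (λ b → H D b *ᶻ F b) *ᶻ ∑< N (λ b → H D b *ᶻ F b) ≤⟨ cauchy-schwarz (upTo N) (H D) F ⟩
      ∑< N (λ b → H D b *ᶻ H D b) *ᶻ ∑< N (λ b → F b *ᶻ F b)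
        ≤⟨ *ᶻ-monoˡ (∑-nonneg (upTo N) (λ b → square-nonneg (H D b))) (operator-bound (H D)) ⟩
      ∑< N (λ b → H D b *ᶻ H D b) *ᶻ (L *ᶻ ∑< N (λ b → H D b *ᶻ H D b)) ≡⟨ cong₂ (λ y z → y *ᶻ (L *ᶻ z)) norm norm ⟩
      (+ N *ᶻ φ D) *ᶻ (L *ᶻ (+ N *ᶻ φ D)) ≡⟨ e₂ (+ N) (φ D) L ⟩
      + N *ᶻ + N *ᶻ (φ D *ᶻ φ D *ᶻ L) ∎))
    where
    open ℤₚ.≤-Reasoning
    S = ∑< N (λ a → H D a *ᶻ T a)
    F : ℕ → ℤ
    F b = ∑< N (λ a → H D a *ᶻ T (a + b))
    e₁ : ∀ N S → N *ᶻ N *ᶻ (S *ᶻ S) ≡ (N *ᶻ S) *ᶻ (N *ᶻ S)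
    e₁ = solve-∀
    e₂ : ∀ N f L → (N *ᶻ f) *ᶻ (L *ᶻ (N *ᶻ f)) ≡ N *ᶻ N *ᶻ (f *ᶻ f *ᶻ L)
    e₂ = solve-∀
    convolution : ∀ x → Coprime x N → ∀ c → ∑< N (λ b → H D b *ᶻ H D (c + x * b)) ≡ + N *ᶻ H D c
    convolution x cop c = ∑<-scaled-period N d∣N
      (periodic-* (H-periodic D) (periodic-affine (H-periodic D) c x))
      (H-convolution cf x (coprime-∣ʳ cop d∣N) c)
    -- The norm is the convolution with multiplier 1 at `c = 0`, where the Ramanujan sum equals φ.
    norm : ∑< N (λ b → H D b *ᶻ H D b) ≡ + N *ᶻ φ D
    norm = trans (∑-cong (upTo N) (λ b → cong (λ z → H D b *ᶻ H D z) (sym (ℕₚ.+-identityʳ b))))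
      (trans (convolution 1 (Coprimality.1-coprimeTo N) 0) (cong (+ N *ᶻ_) (H-at-0 D)))
    -- The substitution of a - b for a. Since `N = suc n`, the number `n * b` represents -b modulo
    -- N.
    shifted : ∀ b → F b ≡ ∑< N (λ a → H D (a + n * b) *ᶻ T a)
    shifted b = trans
      (sym (∑<-shift (periodic-* (periodic-∣ d∣N (H-periodic D))
             (λ a → trans (cong T (ℕₚ.+-assoc N a b)) (T-periodic (a + b)))) (n * b)))
      (∑-cong (upTo N) (λ a → cong₂ (λ y z → H D y *ᶻ z) (ℕₚ.+-comm (n * b) a)
        (trans (cong T (e a b n)) (periodic-multiple T-periodic b a))))
      where
      e : ∀ a b n → n * b + a + b ≡ b * suc n + a
      e = ℕ-Solver.solve-∀
    -- Summing over `b` before `a` leaves the convolution of the kernel with itself, which is N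
    -- times the kernel.
    reproduce : + N *ᶻ S ≡ ∑< N (λ b → H D b *ᶻ F b)
    reproduce = sym (begin-equality
      ∑< N (λ b → H D b *ᶻ F b)
        ≡⟨ ∑-cong (upTo N) (λ b → trans (cong (H D b *ᶻ_) (shifted b)) (sym (∑-*ˡ (upTo N) (H D b) _))) ⟩
      ∑< N (λ b → ∑< N (λ a → H D b *ᶻ (H D (a + n * b) *ᶻ T a)))
        ≡⟨ ∑-swap (upTo N) (upTo N) (λ b a → H D b *ᶻ (H D (a + n * b) *ᶻ T a)) ⟩
      ∑< N (λ a → ∑< N (λ b → H D b *ᶻ (H D (a + n * b) *ᶻ T a)))
        ≡⟨ ∑-cong (upTo N) (λ a → trans
             (∑-cong (upTo N) (λ b → sym (ℤₚ.*-assoc (H D b) (H D (a + n * b)) (T a))))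
             (trans (∑-*ʳ (upTo N) (T a) (λ b → H D b *ᶻ H D (a + n * b)))
               (cong (_*ᶻ T a) (convolution n (coprime-pred n) a)))) ⟩
      ∑< N (λ a → + N *ᶻ H D a *ᶻ T a)
        ≡⟨ ∑-cong (upTo N) (λ a → ℤₚ.*-assoc (+ N) (H D a) (T a)) ⟩
      ∑< N (λ a → + N *ᶻ (H D a *ᶻ T a)) ≡⟨ ∑-*ˡ (upTo N) (+ N) (λ a → H D a *ᶻ T a) ⟩
      + N *ᶻ S ∎)

-- The sieve expanded in Ramanujan sums

-- sieve P a is product P if no member of P divides a, and 0 otherwise.
sieve : List ℕ → ℕ → ℤ
sieve [] a = 1ℤ
sieve (p ∷ P) a = (+ p -ᶻ 1ℤ -ᶻ h p a) *ᶻ sieve P a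

-- The definition displays a constant minus a Ramanujan sum, which is the form to multiply out; the
-- right side here shows that it is p times the indicator of p ∤ a.
sieve-factor : ∀ p a → + p -ᶻ 1ℤ -ᶻ h p a ≡ + p -ᶻ + p *ᶻ ⟦ p ∣? a ⟧
sieve-factor p a = e (+ p) ⟦ p ∣? a ⟧
  where
  e : ∀ p i → p -ᶻ 1ℤ -ᶻ (p *ᶻ i -ᶻ 1ℤ) ≡ p -ᶻ p *ᶻ i
  e = solve-∀

sieve-factor-∣ : ∀ p a → p ∣ a → + p -ᶻ 1ℤ -ᶻ h p a ≡ 0ℤ
sieve-factor-∣ p a p∣a = trans (sieve-factor p a)
  (trans (cong (λ i → + p -ᶻ + p *ᶻ i) (⟦⟧-true (p ∣? a) p∣a)) (e (+ p)))
  where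
  e : ∀ p → p -ᶻ p *ᶻ 1ℤ ≡ 0ℤ
  e = solve-∀

sieve-factor-∤ : ∀ p a → ¬ p ∣ a → + p -ᶻ 1ℤ -ᶻ h p a ≡ + p
sieve-factor-∤ p a p∤a = trans (sieve-factor p a)
  (trans (cong (λ i → + p -ᶻ + p *ᶻ i) (⟦⟧-false (p ∣? a) p∤a)) (e (+ p)))
  where
  e : ∀ p → p -ᶻ p *ᶻ 0ℤ ≡ p
  e = solve-∀

sieve-∤ : ∀ {P a} → All (λ p → ¬ p ∣ a) P → sieve P a ≡ + product P
sieve-∤ [] = refl
sieve-∤ {p ∷ P} {a} (p∤a ∷ P∤a) =
  trans (cong₂ _*ᶻ_ (sieve-factor-∤ p a p∤a) (sieve-∤ P∤a)) (sym (ℤₚ.pos-* p (product P)))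

sieve-∣ : ∀ {P a} → ¬ All (λ p → ¬ p ∣ a) P → sieve P a ≡ 0ℤ
sieve-∣ {[]} ¬all = ⊥-elim (¬all [])
sieve-∣ {p ∷ P} {a} ¬all with p ∣? a
... | yes p∣a = trans (cong (_*ᶻ sieve P a) (e (+ p))) (ℤₚ.*-zeroˡ (sieve P a))
  where
  e : ∀ p → p -ᶻ 1ℤ -ᶻ (p *ᶻ 1ℤ -ᶻ 1ℤ) ≡ 0ℤ
  e = solve-∀
... | no p∤a = trans (cong (c *ᶻ_) (sieve-∣ (λ all → ¬all (p∤a ∷ all)))) (ℤₚ.*-zeroʳ c)
  where
  c = + p -ᶻ 1ℤ -ᶻ (+ p *ᶻ 0ℤ -ᶻ 1ℤ)

unsieved? : ∀ P a → Dec (All (λ p → ¬ p ∣ a) P)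
unsieved? P a = All.all? (λ p → ¬? (p ∣? a)) P

sieve-value : ∀ P a → sieve P a ≡ + product P *ᶻ ⟦ unsieved? P a ⟧
sieve-value P a with unsieved? P a
... | yes P∤a = trans (sieve-∤ P∤a) (sym (ℤₚ.*-identityʳ (+ product P)))
... | no ¬P∤a = trans (sieve-∣ ¬P∤a) (sym (ℤₚ.*-zeroʳ (+ product P)))

sieve-nonneg : ∀ P a → 0ℤ ≤ᶻ sieve P a
sieve-nonneg P a = subst (0ℤ ≤ᶻ_) (sym (sieve-value P a)) (*ᶻ-nonneg {+ product P} (ℤ.+≤+ z≤n) (⟦⟧-nonneg (unsieved? P a)))

sieve-upper : ∀ P a → sieve P a ≤ᶻ + product P
sieve-upper P a with unsieved? P a
... | yes P∤a = ℤₚ.≤-reflexive (sieve-∤ P∤a)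
... | no ¬P∤a = subst (_≤ᶻ + product P) (sym (sieve-∣ ¬P∤a)) (ℤ.+≤+ z≤n)

sieve-periodic : ∀ P → Periodic (product P) (sieve P)
sieve-periodic [] i = refl
sieve-periodic (p ∷ P) = periodic-*
  (periodic-∣ (m∣m*n (product P)) (λ i → cong (λ z → + p -ᶻ 1ℤ -ᶻ z) (h-periodic p i)))
  (periodic-∣ (n∣m*n p) (sieve-periodic P))

-- A stage in multiplying out `sieve`: the members of `D` have contributed their `h p`, those of `P`
-- are still to be expanded. `sifted-tail` and `sifted-shift` are the two choices for the next
-- factor.
record Sifted (N : ℕ) (D P : List ℕ) : Set where
  constructor sifted
  field
    factorsD : CoprimeFactors D
    factorsP : CoprimeFactors P
    D⊥P : Coprime (product D) (product P)
    DP∣N : product D * product P ∣ N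

sifted-tail : ∀ {N D p P} → Sifted N D (p ∷ P) → Sifted N D P
sifted-tail {N} {D} {p} {P} (sifted cD (_ ∷ cP) D⊥P DP∣N) =
  sifted cD cP (coprime-∣ʳ D⊥P (n∣m*n p)) (∣-trans (*-monoʳ-∣ (product D) (n∣m*n p)) DP∣N)

sifted-shift : ∀ {N D p P} → Sifted N D (p ∷ P) → Sifted N (p ∷ D) P
sifted-shift {N} {D} {p} {P} (sifted cD ((p≢0 , p⊥P) ∷ cP) D⊥P DP∣N) = sifted
  ((p≢0 , Coprimality.sym (coprime-∣ʳ D⊥P (m∣m*n (product P)))) ∷ cD) cP
  (coprime-* p⊥P (coprime-∣ʳ D⊥P (n∣m*n p)))
  (subst (_∣ N) (e (product D) p (product P)) DP∣N)
  where
  e : ∀ d p P → d * (p * P) ≡ p * d * P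
  e = ℕ-Solver.solve-∀

-- The factor `h p` has mean zero and is independent of the remaining factors.
H-sum-zero : ∀ {p D} N → CoprimeFactors (p ∷ D) → p * product D ∣ N → ∑< N (H (p ∷ D)) ≡ 0ℤ
H-sum-zero {p} {D} N ((p≢0 , p⊥D) ∷ _) d∣N =
  trans (∑<-scaled-period {c = 0ℤ} N d∣N (H-periodic (p ∷ D))
    (trans (∑<-independent (h-periodic p) (H-periodic D) p⊥D)
      (trans (cong (_*ᶻ ∑< (product D) (H D)) (∑<-h p {{p≢0}}))
        (trans (ℤₚ.*-zeroˡ (∑< (product D) (H D))) (sym (ℤₚ.*-zeroʳ (+ (p * product D))))))))
  (ℤₚ.*-zeroʳ (+ N))

private
  sieve-step : ∀ p D P a y → H D a *ᶻ sieve (p ∷ P) a *ᶻ y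
         ≡ (+ p -ᶻ 1ℤ) *ᶻ (H D a *ᶻ sieve P a *ᶻ y) -ᶻ H (p ∷ D) a *ᶻ sieve P a *ᶻ y
  sieve-step p D P a y = e (H D a) (+ p -ᶻ 1ℤ) (h p a) (sieve P a) y
    where
    e : ∀ H c h s y → H *ᶻ ((c -ᶻ h) *ᶻ s) *ᶻ y ≡ c *ᶻ (H *ᶻ s *ᶻ y) -ᶻ h *ᶻ H *ᶻ s *ᶻ y
    e = solve-∀

  ∑-sieve-step : ∀ N p D P (y : ℕ → ℤ) → ∑< N (λ a → H D a *ᶻ sieve (p ∷ P) a *ᶻ y a)
    ≡ (+ p -ᶻ 1ℤ) *ᶻ ∑< N (λ a → H D a *ᶻ sieve P a *ᶻ y a) -ᶻ ∑< N (λ a → H (p ∷ D) a *ᶻ sieve P a *ᶻ y a)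
  ∑-sieve-step N p D P y = trans (∑-cong (upTo N) (λ a → sieve-step p D P a (y a)))
    (trans (∑-- (upTo N) (λ a → (+ p -ᶻ 1ℤ) *ᶻ (H D a *ᶻ sieve P a *ᶻ y a)) (λ a → H (p ∷ D) a *ᶻ sieve P a *ᶻ y a))
      (cong (_-ᶻ ∑< N (λ a → H (p ∷ D) a *ᶻ sieve P a *ᶻ y a))
        (∑-*ˡ (upTo N) (+ p -ᶻ 1ℤ) (λ a → H D a *ᶻ sieve P a *ᶻ y a))))

H-sieve-sum-zero : ∀ {N p D} P → Sifted N (p ∷ D) P → ∑< N (λ a → H (p ∷ D) a *ᶻ sieve P a *ᶻ 1ℤ) ≡ 0ℤ
H-sieve-sum-zero {N} {p} {D} [] (sifted cD _ _ DP∣N) =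
  trans (∑-cong (upTo N) (λ a → trans (ℤₚ.*-identityʳ _) (ℤₚ.*-identityʳ _)))
    (H-sum-zero {p} {D} N cD (∣-trans (m∣m*n 1) DP∣N))
H-sieve-sum-zero {N} {p} {D} (r ∷ P) s = trans (∑-sieve-step N r (p ∷ D) P (λ _ → 1ℤ))
  (trans (cong₂ (λ y z → (+ r -ᶻ 1ℤ) *ᶻ y -ᶻ z) (H-sieve-sum-zero P (sifted-tail s)) (H-sieve-sum-zero P (sifted-shift s)))
    (e (+ r -ᶻ 1ℤ)))
  where
  e : ∀ c → c *ᶻ 0ℤ -ᶻ 0ℤ ≡ 0ℤ
  e = solve-∀

-- Of all terms of the expansion only the one without any `h` survives summation; its coefficient is
-- the product of the p - 1.
sieve-sum : ∀ {N} P → Sifted N [] P → ∑< N (sieve P) ≡ + N *ᶻ φ P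
sieve-sum {N} P s = trans (∑-cong (upTo N) (λ a → sym (trans (ℤₚ.*-identityʳ _) (ℤₚ.*-identityˡ _)))) (go P s)
  where
  e : ∀ c N f → c *ᶻ (N *ᶻ f) -ᶻ 0ℤ ≡ N *ᶻ (c *ᶻ f)
  e = solve-∀
  go : ∀ P → Sifted N [] P → ∑< N (λ a → 1ℤ *ᶻ sieve P a *ᶻ 1ℤ) ≡ + N *ᶻ φ P
  go [] s = ∑<-const N 1ℤ
  go (p ∷ P) s = trans (∑-sieve-step N p [] P (λ _ → 1ℤ))
    (trans (cong₂ (λ y z → (+ p -ᶻ 1ℤ) *ᶻ y -ᶻ z) (go P (sifted-tail s)) (H-sieve-sum-zero P (sifted-shift s)))
      (e (+ p -ᶻ 1ℤ) (+ N) (φ P)))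

2^∣_∣ : List ℕ → ℤ
2^∣ [] ∣ = 1ℤ
2^∣ p ∷ P ∣ = + 2 *ᶻ 2^∣ P ∣

-- E ps / product ps is the sum of the reciprocals of ps; K and V are, over the same denominator, the sums
-- of h p a / p and of (p - 1) / p.

E : List ℕ → ℤ
E [] = 0ℤ
E (p ∷ ps) = + p *ᶻ E ps +ᶻ + product ps

K : List ℕ → ℕ → ℤ
K [] a = 0ℤ
K (p ∷ ps) a = + p *ᶻ K ps a +ᶻ + product ps *ᶻ h p a

V : List ℕ → ℤ
V [] = 0ℤ
V (p ∷ ps) = + p *ᶻ V ps +ᶻ + product ps *ᶻ (+ p -ᶻ 1ℤ)

V-closed : ∀ ps → V ps ≡ + length ps *ᶻ + product ps -ᶻ E ps
V-closed [] = refl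
V-closed (p ∷ ps) = begin
  + p *ᶻ V ps +ᶻ Π *ᶻ (+ p -ᶻ 1ℤ) ≡⟨ cong (λ v → + p *ᶻ v +ᶻ Π *ᶻ (+ p -ᶻ 1ℤ)) (V-closed ps) ⟩
  + p *ᶻ (s *ᶻ Π -ᶻ E ps) +ᶻ Π *ᶻ (+ p -ᶻ 1ℤ) ≡⟨ e (+ p) s Π (E ps) ⟩
  (1ℤ +ᶻ s) *ᶻ (+ p *ᶻ Π) -ᶻ (+ p *ᶻ E ps +ᶻ Π)
    ≡⟨ cong (λ z → + suc (length ps) *ᶻ z -ᶻ (+ p *ᶻ E ps +ᶻ Π)) (sym (ℤₚ.pos-* p (product ps))) ⟩
  + suc (length ps) *ᶻ + (p * product ps) -ᶻ (+ p *ᶻ E ps +ᶻ Π) ∎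
  where
  open ≡-Reasoning
  Π = + product ps
  s = + length ps
  e : ∀ p s Π E → p *ᶻ (s *ᶻ Π -ᶻ E) +ᶻ Π *ᶻ (p -ᶻ 1ℤ) ≡ (1ℤ +ᶻ s) *ᶻ (p *ᶻ Π) -ᶻ (p *ᶻ E +ᶻ Π)
  e = solve-∀

-- Bonferroni: [no member of ps divides a] ≥ 1 - #{p : p ∣ a}, multiplied by product ps.
sieve-lower : ∀ ps a → + product ps -ᶻ E ps -ᶻ K ps a ≤ᶻ sieve ps a
sieve-lower [] a = ℤₚ.≤-refl
sieve-lower (p ∷ ps) a = subst (_≤ᶻ sieve (p ∷ ps) a) (sym split) (step (p ∣? a))
  where
  Π = + product ps
  l = Π -ᶻ E ps -ᶻ K ps a
  e : ∀ p Π E K i → p *ᶻ Π -ᶻ (p *ᶻ E +ᶻ Π) -ᶻ (p *ᶻ K +ᶻ Π *ᶻ (p *ᶻ i -ᶻ 1ℤ))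
    ≡ p *ᶻ ((Π -ᶻ E -ᶻ K) -ᶻ Π *ᶻ i)
  e = solve-∀
  split : + (p * product ps) -ᶻ E (p ∷ ps) -ᶻ K (p ∷ ps) a ≡ + p *ᶻ (l -ᶻ Π *ᶻ ⟦ p ∣? a ⟧)
  split = trans (cong (λ z → z -ᶻ E (p ∷ ps) -ᶻ K (p ∷ ps) a) (ℤₚ.pos-* p (product ps)))
    (e (+ p) Π (E ps) (K ps a) ⟦ p ∣? a ⟧)
  e₀ : ∀ l Π → l ≡ l -ᶻ Π *ᶻ 0ℤ
  e₀ = solve-∀
  e₁ : ∀ l Π → l -ᶻ Π ≡ l -ᶻ Π *ᶻ 1ℤ
  e₁ = solve-∀
  step : Dec (p ∣ a) → + p *ᶻ (l -ᶻ Π *ᶻ ⟦ p ∣? a ⟧) ≤ᶻ sieve (p ∷ ps) a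
  -- If `p` divides `a`, the sieve vanishes, so its lower bound must be nonpositive: `l` is at most
  -- `sieve ps a`, hence at most `Π`.
  step (yes p∣a) = subst₂ _≤ᶻ_
    (cong (λ z → + p *ᶻ z) (trans (e₁ l Π) (cong (λ i → l -ᶻ Π *ᶻ i) (sym (⟦⟧-true (p ∣? a) p∣a)))))
    (trans (ℤₚ.*-zeroʳ (+ p)) (sym (trans (cong (_*ᶻ sieve ps a) (sieve-factor-∣ p a p∣a)) (ℤₚ.*-zeroˡ (sieve ps a)))))
    (*ᶻ-monoˡ {+ p} (ℤ.+≤+ z≤n) (ℤₚ.i≤j⇒i-j≤0 (ℤₚ.≤-trans (sieve-lower ps a) (sieve-upper ps a))))
  step (no p∤a) = subst₂ _≤ᶻ_
    (cong (λ z → + p *ᶻ z) (trans (e₀ l Π) (cong (λ i → l -ᶻ Π *ᶻ i) (sym (⟦⟧-false (p ∣? a) p∤a)))))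
    (cong (_*ᶻ sieve ps a) (sym (sieve-factor-∤ p a p∤a)))
    (*ᶻ-monoˡ {+ p} (ℤ.+≤+ z≤n) (sieve-lower ps a))

module _ (N : ℕ) (T : ℕ → ℤ) (L : ℤ) (0≤L : 0ℤ ≤ᶻ L)
  (H-bound : ∀ {D} → CoprimeFactors D → product D ∣ N → Bounded L (φ D) (∑< N (λ a → H D a *ᶻ T a))) where

  -- Multiplying out `sieve P` gives one term for each subset of `P`. A chosen `h p` costs φ(p)
  -- through `H-bound`, and an unchosen one leaves the coefficient p - 1, so all 2^|P| terms have
  -- the same weight φ(D) φ(P).
  H-sieve-bound : ∀ {D} P → Sifted N D P →
    Bounded L (φ D *ᶻ (φ P *ᶻ 2^∣ P ∣)) (∑< N (λ a → H D a *ᶻ sieve P a *ᶻ T a))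
  H-sieve-bound {D} [] (sifted cD _ _ DP∣N) = subst₂ (Bounded L)
    (sym (ℤₚ.*-identityʳ (φ D))) (∑-cong (upTo N) (λ a → cong (_*ᶻ T a) (sym (ℤₚ.*-identityʳ (H D a)))))
    (H-bound cD (∣-trans (m∣m*n 1) DP∣N))
  H-sieve-bound {D} (suc p ∷ P) s = subst₂ (Bounded L) (e (+ p) (φ D) (φ P) 2^∣ P ∣) (sym (∑-sieve-step N (suc p) D P T))
    (bounded-+ 0≤L (bounded-scale (+ p) (ℤ.+≤+ z≤n) (H-sieve-bound {D} P (sifted-tail s)))
                   (bounded-neg (H-sieve-bound {suc p ∷ D} P (sifted-shift s))))
    where
    e : ∀ c d f b → c *ᶻ (d *ᶻ (f *ᶻ b)) +ᶻ c *ᶻ d *ᶻ (f *ᶻ b) ≡ d *ᶻ (c *ᶻ f *ᶻ (+ 2 *ᶻ b))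
    e = solve-∀
  H-sieve-bound {D} (zero ∷ P) (sifted _ ((() , _) ∷ _) _ _)

  K-bound : ∀ {P} ps → Sifted N [] P → All (λ p → Sifted N (p ∷ []) P) ps →
    Bounded L (V ps *ᶻ (φ P *ᶻ 2^∣ P ∣)) (∑< N (λ a → K ps a *ᶻ sieve P a *ᶻ T a))
  K-bound {P} [] s [] = subst₂ (Bounded L) (sym (ℤₚ.*-zeroˡ (φ P *ᶻ 2^∣ P ∣)))
    (sym (∑-zero (upTo N) (λ a → trans (cong (_*ᶻ T a) (ℤₚ.*-zeroˡ (sieve P a))) (ℤₚ.*-zeroˡ (T a)))))
    (bounded ℤₚ.≤-refl ℤₚ.≤-refl)
  K-bound {P} (p ∷ ps) s (sp ∷ sps) = subst₂ (Bounded L)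
    (e₁ (+ p) (V ps) (φ P *ᶻ 2^∣ P ∣) (+ product ps)) (sym sum)
    (bounded-+ 0≤L (bounded-scale (+ p) (ℤ.+≤+ z≤n) (K-bound ps s sps))
                   (bounded-scale (+ product ps) (ℤ.+≤+ z≤n) (H-sieve-bound P sp)))
    where
    e₁ : ∀ p v f Π → p *ᶻ (v *ᶻ f) +ᶻ Π *ᶻ ((p -ᶻ 1ℤ) *ᶻ 1ℤ *ᶻ f) ≡ (p *ᶻ v +ᶻ Π *ᶻ (p -ᶻ 1ℤ)) *ᶻ f
    e₁ = solve-∀
    e₂ : ∀ p K Π h f t → (p *ᶻ K +ᶻ Π *ᶻ h) *ᶻ f *ᶻ t ≡ p *ᶻ (K *ᶻ f *ᶻ t) +ᶻ Π *ᶻ (h *ᶻ 1ℤ *ᶻ f *ᶻ t)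
    e₂ = solve-∀
    sum : ∑< N (λ a → K (p ∷ ps) a *ᶻ sieve P a *ᶻ T a)
        ≡ + p *ᶻ ∑< N (λ a → K ps a *ᶻ sieve P a *ᶻ T a)
          +ᶻ + product ps *ᶻ ∑< N (λ a → H (p ∷ []) a *ᶻ sieve P a *ᶻ T a)
    sum = trans (∑-cong (upTo N) (λ a → e₂ (+ p) (K ps a) (+ product ps) (h p a) (sieve P a) (T a)))
      (trans (∑-+ (upTo N) (λ a → + p *ᶻ (K ps a *ᶻ sieve P a *ᶻ T a))
                           (λ a → + product ps *ᶻ (H (p ∷ []) a *ᶻ sieve P a *ᶻ T a)))
        (cong₂ _+ᶻ_ (∑-*ˡ (upTo N) (+ p) _) (∑-*ˡ (upTo N) (+ product ps) _)))

-- Each `h p` in `K` belongs to a prime independent of `P`, so that no term of the expansion is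
-- constant. Hence `K` contributes to the error only.
K-sieve-sum-zero : ∀ {N P} ps → All (λ p → Sifted N (p ∷ []) P) ps → ∑< N (λ a → K ps a *ᶻ sieve P a) ≡ 0ℤ
K-sieve-sum-zero {N} {P} [] [] = ∑-zero (upTo N) (λ a → ℤₚ.*-zeroˡ (sieve P a))
K-sieve-sum-zero {N} {P} (p ∷ ps) (sp ∷ sps) = begin
  ∑< N (λ a → K (p ∷ ps) a *ᶻ sieve P a)
    ≡⟨ ∑-cong (upTo N) (λ a → e (+ p) (K ps a) (+ product ps) (h p a) (sieve P a)) ⟩
  ∑< N (λ a → + p *ᶻ (K ps a *ᶻ sieve P a) +ᶻ + product ps *ᶻ (H (p ∷ []) a *ᶻ sieve P a *ᶻ 1ℤ))
    ≡⟨ ∑-+ (upTo N) (λ a → + p *ᶻ (K ps a *ᶻ sieve P a)) (λ a → + product ps *ᶻ (H (p ∷ []) a *ᶻ sieve P a *ᶻ 1ℤ)) ⟩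
  ∑< N (λ a → + p *ᶻ (K ps a *ᶻ sieve P a)) +ᶻ ∑< N (λ a → + product ps *ᶻ (H (p ∷ []) a *ᶻ sieve P a *ᶻ 1ℤ))
    ≡⟨ cong₂ _+ᶻ_
         (trans (∑-*ˡ (upTo N) (+ p) (λ a → K ps a *ᶻ sieve P a)) (cong (λ z → + p *ᶻ z) (K-sieve-sum-zero ps sps)))
         (trans (∑-*ˡ (upTo N) (+ product ps) (λ a → H (p ∷ []) a *ᶻ sieve P a *ᶻ 1ℤ))
           (cong (λ z → + product ps *ᶻ z) (H-sieve-sum-zero P sp))) ⟩
  + p *ᶻ 0ℤ +ᶻ + product ps *ᶻ 0ℤ ≡⟨ cong₂ _+ᶻ_ (ℤₚ.*-zeroʳ (+ p)) (ℤₚ.*-zeroʳ (+ product ps)) ⟩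
  0ℤ ∎
  where
  open ≡-Reasoning
  e : ∀ p K Π h f → (p *ᶻ K +ᶻ Π *ᶻ h) *ᶻ f ≡ p *ᶻ (K *ᶻ f) +ᶻ Π *ᶻ (h *ᶻ 1ℤ *ᶻ f *ᶻ 1ℤ)
  e = solve-∀

module _ (N : ℕ) (T : ℕ → ℤ) (L : ℤ) (0≤L : 0ℤ ≤ᶻ L)
  (H-bound : ∀ {D} → CoprimeFactors D → product D ∣ N → Bounded L (φ D) (∑< N (λ a → H D a *ᶻ T a)))
  (0≤1+T : ∀ a → 0ℤ ≤ᶻ T a +ᶻ 1ℤ) where

  -- Both `sieve P` and `T + 1` are nonnegative, so the Bonferroni bound for `ps` may be inserted
  -- under the sum. The main term then comes from `sieve P` alone, and the error is the part linear
  -- in `T`.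
  sieve-inequality : ∀ {P} ps → Sifted N [] P → All (λ p → Sifted N (p ∷ []) P) ps → 0ℤ ≤ᶻ + product ps -ᶻ E ps →
    Σ ℤ λ err → Bounded L ((+ product ps -ᶻ E ps +ᶻ V ps) *ᶻ (φ P *ᶻ 2^∣ P ∣)) err ×
      (+ product ps -ᶻ E ps) *ᶻ (+ N *ᶻ φ P) +ᶻ err ≤ᶻ ∑< N (λ a → sieve P a *ᶻ sieve ps a *ᶻ (T a +ᶻ 1ℤ))
  sieve-inequality {P} ps s sps 0≤δ = δ *ᶻ X -ᶻ Y ,
    subst (λ w → Bounded L w (δ *ᶻ X -ᶻ Y)) (sym (ℤₚ.*-distribʳ-+ (φ P *ᶻ 2^∣ P ∣) δ (V ps)))
      (bounded-+ 0≤L (bounded-scale δ 0≤δ X-bound) (bounded-neg (K-bound N T L 0≤L H-bound ps s sps))) ,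
    subst (_≤ᶻ ∑< N (λ a → sieve P a *ᶻ sieve ps a *ᶻ (T a +ᶻ 1ℤ))) evaluate
      (∑-mono (upTo N) (λ a → subst₂ _≤ᶻ_ (e₁ (sieve P a) (δ -ᶻ K ps a) (T a)) (e₁ (sieve P a) (sieve ps a) (T a))
        (*ᶻ-monoˡ (*ᶻ-nonneg (sieve-nonneg P a) (0≤1+T a)) (sieve-lower ps a))))
    where
    open ≡-Reasoning
    δ = + product ps -ᶻ E ps
    X = ∑< N (λ a → sieve P a *ᶻ T a)
    Y = ∑< N (λ a → K ps a *ᶻ sieve P a *ᶻ T a)
    X-bound : Bounded L (φ P *ᶻ 2^∣ P ∣) X
    X-bound = subst₂ (Bounded L) (ℤₚ.*-identityˡ _)
      (∑-cong (upTo N) (λ a → cong (_*ᶻ T a) (ℤₚ.*-identityˡ (sieve P a))))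
      (H-sieve-bound N T L 0≤L H-bound P s)
    e₁ : ∀ f g t → f *ᶻ (t +ᶻ 1ℤ) *ᶻ g ≡ f *ᶻ g *ᶻ (t +ᶻ 1ℤ)
    e₁ = solve-∀
    e₂ : ∀ f d K t → f *ᶻ (d -ᶻ K) *ᶻ (t +ᶻ 1ℤ) ≡ (d *ᶻ (f *ᶻ t) +ᶻ d *ᶻ f) -ᶻ (K *ᶻ f *ᶻ t +ᶻ K *ᶻ f)
    e₂ = solve-∀
    e₃ : ∀ d X S Y → d *ᶻ X +ᶻ d *ᶻ S -ᶻ (Y +ᶻ 0ℤ) ≡ d *ᶻ S +ᶻ (d *ᶻ X -ᶻ Y)
    e₃ = solve-∀
    evaluate : ∑< N (λ a → sieve P a *ᶻ (δ -ᶻ K ps a) *ᶻ (T a +ᶻ 1ℤ)) ≡ δ *ᶻ (+ N *ᶻ φ P) +ᶻ (δ *ᶻ X -ᶻ Y)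
    evaluate = begin
      ∑< N (λ a → sieve P a *ᶻ (δ -ᶻ K ps a) *ᶻ (T a +ᶻ 1ℤ))
        ≡⟨ ∑-cong (upTo N) (λ a → e₂ (sieve P a) δ (K ps a) (T a)) ⟩
      ∑< N (λ a → (δ *ᶻ (sieve P a *ᶻ T a) +ᶻ δ *ᶻ sieve P a) -ᶻ (K ps a *ᶻ sieve P a *ᶻ T a +ᶻ K ps a *ᶻ sieve P a))
        ≡⟨ ∑-- (upTo N) (λ a → δ *ᶻ (sieve P a *ᶻ T a) +ᶻ δ *ᶻ sieve P a)
                        (λ a → K ps a *ᶻ sieve P a *ᶻ T a +ᶻ K ps a *ᶻ sieve P a) ⟩
      ∑< N (λ a → δ *ᶻ (sieve P a *ᶻ T a) +ᶻ δ *ᶻ sieve P a)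
        -ᶻ ∑< N (λ a → K ps a *ᶻ sieve P a *ᶻ T a +ᶻ K ps a *ᶻ sieve P a)
        ≡⟨ cong₂ _-ᶻ_
             (trans (∑-+ (upTo N) (λ a → δ *ᶻ (sieve P a *ᶻ T a)) (λ a → δ *ᶻ sieve P a))
               (cong₂ _+ᶻ_ (∑-*ˡ (upTo N) δ _) (∑-*ˡ (upTo N) δ _)))
             (trans (∑-+ (upTo N) (λ a → K ps a *ᶻ sieve P a *ᶻ T a) (λ a → K ps a *ᶻ sieve P a))
               (cong (Y +ᶻ_) (K-sieve-sum-zero ps sps))) ⟩
      δ *ᶻ X +ᶻ δ *ᶻ ∑< N (sieve P) -ᶻ (Y +ᶻ 0ℤ) ≡⟨ e₃ δ X (∑< N (sieve P)) Y ⟩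
      δ *ᶻ ∑< N (sieve P) +ᶻ (δ *ᶻ X -ᶻ Y) ≡⟨ cong (λ z → δ *ᶻ z +ᶻ (δ *ᶻ X -ᶻ Y)) (sieve-sum P s) ⟩
      δ *ᶻ (+ N *ᶻ φ P) +ᶻ (δ *ᶻ X -ᶻ Y) ∎

-- Counting with lists free of repetitions

module Distinctness {c ℓ : Level} (S : Setoid c ℓ) where
  open Setoid S using (Carrier; _≈_) renaming (sym to ≈-sym; trans to ≈-trans)
  open Permutation S using (_↭_; ↭-refl; ↭-trans; ↭-sym; ↭-prep; ↭-swap; prep)
  open Permutationₚ S using (∈-resp-↭; xs↭ys⇒|xs|≡|ys|; ↭-shift; ++⁺ˡ)
  open Membership S using () renaming (_∈_ to _∈ₛ_)

  Distinct : List Carrier → Set _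
  Distinct = AllPairs (λ a b → ¬ (a ≈ b))

  ∈⇒↭∷ : ∀ {x ys} → x ∈ₛ ys → Σ (List Carrier) λ zs → ys ↭ x ∷ zs
  ∈⇒↭∷ {x} {y ∷ ys} (here x≈y) = ys , prep (≈-sym x≈y) ↭-refl
  ∈⇒↭∷ {x} {y ∷ ys} (there x∈ys) with ∈⇒↭∷ x∈ys
  ... | zs , ys↭ = y ∷ zs , ↭-trans (↭-prep y ys↭) (↭-swap y x ↭-refl)

  -- The pigeonhole principle with the remainder `zs` kept: it yields the comparison of lengths, and
  -- for equal lengths the permutation, because `zs` is then empty.
  distinct-⊆⇒↭ : ∀ {xs ys} → Distinct xs → (∀ {z} → z ∈ₛ xs → z ∈ₛ ys) → Σ (List Carrier) λ zs → ys ↭ xs ++ zs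
  distinct-⊆⇒↭ {[]} {ys} [] xs⊆ys = ys , ↭-refl
  distinct-⊆⇒↭ {x ∷ xs} {ys} (x∉xs ∷ dxs) xs⊆ys
    with zs , ys↭ ← distinct-⊆⇒↭ dxs (λ z∈xs → xs⊆ys (there z∈xs))
    with Membershipₚ.∈-++⁻ S xs (∈-resp-↭ ys↭ (xs⊆ys (here (Setoid.refl S))))
  ... | inj₁ x∈xs = ⊥-elim (Allₚ.All¬⇒¬Any x∉xs x∈xs)
  ... | inj₂ x∈zs with ws , zs↭ ← ∈⇒↭∷ x∈zs =
    ws , ↭-trans ys↭ (↭-trans (++⁺ˡ xs zs↭) (↭-shift xs ws))

  distinct-⊆⇒length≤ : ∀ {xs ys} → Distinct xs → (∀ {z} → z ∈ₛ xs → z ∈ₛ ys) → length xs ≤ length ys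
  distinct-⊆⇒length≤ {xs} dxs xs⊆ys with zs , ys↭ ← distinct-⊆⇒↭ dxs xs⊆ys =
    subst (length xs ≤_) (sym (trans (xs↭ys⇒|xs|≡|ys| ys↭) (length-++ xs))) (ℕₚ.m≤m+n (length xs) (length zs))

  distinct-⊆-length⇒↭ : ∀ {xs ys} → Distinct xs → (∀ {z} → z ∈ₛ xs → z ∈ₛ ys) → length ys ≤ length xs → ys ↭ xs
  distinct-⊆-length⇒↭ {xs} {ys} dxs xs⊆ys len with distinct-⊆⇒↭ dxs xs⊆ys
  ... | [] , ys↭ = subst (λ l → ys ↭ l) (++-identityʳ xs) ys↭
  ... | z ∷ zs , ys↭ = ⊥-elim (ℕₚ.<⇒≱
    (subst (length xs <_) (sym (trans (xs↭ys⇒|xs|≡|ys| ys↭) (length-++ xs))) (ℕₚ.m<m+n (length xs) (s≤s z≤n))) len)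

-- Prime divisors

prime-divisor : ∀ n .{{_ : NonZero n}} → ¬ n ≡ 1 → Σ ℕ λ p → Prime p × p ∣ n
prime-divisor n n≢1 with factorise n
... | record { factors = [] ; isFactorisation = n≡1 } = ⊥-elim (n≢1 n≡1)
... | record { factors = p ∷ ps ; isFactorisation = refl ; factorsPrime = pp ∷ _ } = p , pp , m∣m*n (product ps)

prime∣product⇒∈ : ∀ {p} D → Prime p → All Prime D → p ∣ product D → p ∈ D
prime∣product⇒∈ [] pp [] p∣1 = ⊥-elim (¬prime[1] (subst Prime (∣1⇒≡1 p∣1) pp))
prime∣product⇒∈ (r ∷ D) pp (pr ∷ pD) p∣ with euclidsLemma r (product D) pp p∣
... | inj₂ p∣D = there (prime∣product⇒∈ D pp pD p∣D)
... | inj₁ p∣r with prime⇒irreducible pr p∣r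
...   | inj₁ refl = ⊥-elim (¬prime[1] pp)
...   | inj₂ refl = here refl

prime-∤⇒coprime : ∀ {p n} → Prime p → ¬ p ∣ n → Coprime p n
prime-∤⇒coprime pp p∤n (d∣p , d∣n) with prime⇒irreducible pp d∣p
... | inj₁ d≡1 = d≡1
... | inj₂ refl = ⊥-elim (p∤n d∣n)

primes⇒coprimeFactors : ∀ {D} → Unique D → All Prime D → CoprimeFactors D
primes⇒coprimeFactors [] [] = []
primes⇒coprimeFactors {p ∷ D} (p∉D ∷ uD) (pp ∷ pD) =
  (prime⇒nonZero pp , prime-∤⇒coprime pp (λ p∣D → Allₚ.All¬⇒¬Any p∉D (prime∣product⇒∈ D pp pD p∣D)))
  ∷ primes⇒coprimeFactors uD pD

primes-product-∣ : ∀ {k D} → Unique D → All Prime D → All (_∣ k) D → product D ∣ k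
primes-product-∣ [] [] [] = 1∣ _
primes-product-∣ {k} {p ∷ D} (p∉D ∷ uD) (pp ∷ pD) (p∣k ∷ D∣k) with primes-product-∣ uD pD D∣k
... | divides j refl with euclidsLemma j (product D) pp p∣k
...   | inj₁ p∣j = *-monoˡ-∣ (product D) p∣j
...   | inj₂ p∣D = ⊥-elim (Allₚ.All¬⇒¬Any p∉D (prime∣product⇒∈ D pp pD p∣D))

primesOf : ℕ → List ℕ
primesOf k = filter (λ p → prime? p ×-dec p ∣? k) (upTo (suc k))

module _ (k : ℕ) where

  ∈-primesOf⁺ : .{{_ : NonZero k}} → ∀ {p} → Prime p → p ∣ k → p ∈ primesOf k
  ∈-primesOf⁺ pp p∣k = ∈ₚ.∈-filter⁺ (λ p → prime? p ×-dec p ∣? k) (∈ₚ.∈-upTo⁺ (s≤s (∣⇒≤ p∣k))) (pp , p∣k)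

  primesOf-all : All (λ p → Prime p × p ∣ k) (primesOf k)
  primesOf-all = Allₚ.all-filter (λ p → prime? p ×-dec p ∣? k) (upTo (suc k))

  primesOf-prime : All Prime (primesOf k)
  primesOf-prime = All.map proj₁ primesOf-all

  primesOf-∣ : All (_∣ k) (primesOf k)
  primesOf-∣ = All.map proj₂ primesOf-all

  primesOf-unique : Unique (primesOf k)
  primesOf-unique = Uniqueₚ.filter⁺ (λ p → prime? p ×-dec p ∣? k) (Uniqueₚ.upTo⁺ (suc k))

  primesOf-product-∣ : product (primesOf k) ∣ k
  primesOf-product-∣ = primes-product-∣ primesOf-unique primesOf-prime primesOf-∣

  primesOf-coprimeFactors : CoprimeFactors (primesOf k)
  primesOf-coprimeFactors = primes⇒coprimeFactors primesOf-unique primesOf-prime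

-- The totient and W

∑-range : ∀ a n f → ∑ (range a n) f ≡ ∑< n (λ i → f (a + i))
∑-range a zero f = refl
∑-range a (suc n) f = trans
  (cong₂ _+ᶻ_ (cong f (sym (ℕₚ.+-identityʳ a)))
    (trans (∑-range (suc a) n f) (∑-cong (upTo n) (λ i → cong f (sym (ℕₚ.+-suc a i))))))
  (sym (∑<-suc n (λ i → f (a + i))))

countB-⌊⌋ : ∀ {a} {A : ℕ → Set a} (A? : ∀ i → Dec (A i)) xs → + countB (λ i → ⌊ A? i ⌋) xs ≡ ∑ xs (λ i → ⟦ A? i ⟧)
countB-⌊⌋ A? [] = refl
countB-⌊⌋ A? (x ∷ xs) with A? x
... | yes _ = cong (1ℤ +ᶻ_) (countB-⌊⌋ A? xs)
... | no _ = trans (countB-⌊⌋ A? xs) (sym (ℤₚ.+-identityˡ _))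

unsieved⇒coprime : ∀ k .{{_ : NonZero k}} a → All (λ p → ¬ p ∣ a) (primesOf k) → Coprime a k
unsieved⇒coprime k@(suc _) a none {zero} (_ , 0∣k) with () ← 0∣⇒≡0 0∣k
unsieved⇒coprime k@(suc _) a none {d@(suc _)} (d∣a , d∣k) with d ℕₚ.≟ 1
... | yes d≡1 = d≡1
... | no d≢1 with p , pp , p∣d ← prime-divisor d d≢1 =
  ⊥-elim (All.lookup none (∈-primesOf⁺ k pp (∣-trans p∣d d∣k)) (∣-trans p∣d d∣a))

coprime⇒unsieved : ∀ k a → Coprime a k → All (λ p → ¬ p ∣ a) (primesOf k)
coprime⇒unsieved k a cop = All.map (λ { (pp , p∣k) p∣a → ¬prime[1] (subst Prime (cop (p∣a , p∣k)) pp) }) (primesOf-all k)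

-- The integers coprime to `k` are those that survive the sieve by the primes of `k`, and the sieve
-- sum over whole periods of length rad k is known exactly.
totient-primes : ∀ k .{{_ : NonZero k}} → + product (primesOf k) *ᶻ + totient k ≡ + k *ᶻ φ (primesOf k)
totient-primes k = begin
  + product P *ᶻ + totient k ≡⟨ cong (+ product P *ᶻ_) (trans (countB-⌊⌋ (λ i → coprime? i k) (range 1 k)) (∑-range 1 k _)) ⟩
  + product P *ᶻ ∑< k (λ i → ⟦ coprime? (1 + i) k ⟧) ≡⟨ sym (∑-*ˡ (upTo k) (+ product P) _) ⟩
  ∑< k (λ i → + product P *ᶻ ⟦ coprime? (1 + i) k ⟧)
    ≡⟨ ∑-cong (upTo k) (λ i → sym (trans (sieve-value P (1 + i))
         (cong (+ product P *ᶻ_) (⟦⟧-cong (unsieved? P (1 + i)) (coprime? (1 + i) k)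
           (unsieved⇒coprime k (1 + i)) (coprime⇒unsieved k (1 + i)))))) ⟩
  -- `totient` counts among 1, ..., k, whereas the sieve sum runs over 0, ..., k - 1; periodicity
  -- absorbs the shift.
  ∑< k (λ i → sieve P (1 + i)) ≡⟨ ∑<-shift (periodic-∣ (primesOf-product-∣ k) (sieve-periodic P)) 1 ⟩
  ∑< k (sieve P) ≡⟨ sieve-sum P (sifted [] (primesOf-coprimeFactors k) (Coprimality.1-coprimeTo (product P))
                      (subst (_∣ k) (sym (ℕₚ.+-identityʳ (product P))) (primesOf-product-∣ k))) ⟩
  + k *ᶻ φ P ∎
  where
  open ≡-Reasoning
  P = primesOf k

-- For the primes of `k` these products over subsets are squarefree divisors of `k`, that is,
-- members of the set counted by `W k`.
subproducts : List ℕ → List ℕ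
subproducts [] = 1 ∷ []
subproducts (p ∷ P) = subproducts P ++ map (p *_) (subproducts P)

length-subproducts : ∀ P → + length (subproducts P) ≡ 2^∣ P ∣
length-subproducts [] = refl
length-subproducts (p ∷ P) = begin
  + length (subproducts P ++ map (p *_) (subproducts P))
    ≡⟨ cong +_ (trans (length-++ (subproducts P)) (cong (λ z → length (subproducts P) + z)
         (trans (length-map (p *_) (subproducts P)) (sym (ℕₚ.+-identityʳ _))))) ⟩
  + (2 * length (subproducts P)) ≡⟨ ℤₚ.pos-* 2 (length (subproducts P)) ⟩
  + 2 *ᶻ + length (subproducts P) ≡⟨ cong (+ 2 *ᶻ_) (length-subproducts P) ⟩
  + 2 *ᶻ 2^∣ P ∣ ∎
  where open ≡-Reasoning

subproducts-∣ : ∀ {d} P → d ∈ subproducts P → d ∣ product P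
subproducts-∣ [] (here refl) = 1∣ 1
subproducts-∣ (p ∷ P) d∈ with ∈ₚ.∈-++⁻ (subproducts P) d∈
... | inj₁ d∈P = ∣n⇒∣m*n p (subproducts-∣ P d∈P)
... | inj₂ d∈pP with e , e∈P , refl ← ∈ₚ.∈-map⁻ (p *_) d∈pP = *-monoʳ-∣ p (subproducts-∣ P e∈P)

subproducts-squarefree : ∀ {d ℓ} P → Unique P → All Prime P → d ∈ subproducts P → Prime ℓ → ¬ ℓ * ℓ ∣ d
subproducts-squarefree {ℓ = ℓ} [] _ _ (here refl) pℓ ℓ²∣1 = ¬prime[1] (subst Prime (∣1⇒≡1 (∣-trans (m∣m*n ℓ) ℓ²∣1)) pℓ)
subproducts-squarefree {d} {ℓ} (p ∷ P) (p∉P ∷ uP) (pp ∷ pP) d∈ pℓ ℓ²∣d with ∈ₚ.∈-++⁻ (subproducts P) d∈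
... | inj₁ d∈P = subproducts-squarefree P uP pP d∈P pℓ ℓ²∣d
... | inj₂ d∈pP with e , e∈P , refl ← ∈ₚ.∈-map⁻ (p *_) d∈pP with ℓ ℕₚ.≟ p
...   | yes refl = Allₚ.All¬⇒¬Any p∉P (prime∣product⇒∈ P pp pP
          (∣-trans (*-cancelˡ-∣ p {{prime⇒nonZero pp}} ℓ²∣d) (subproducts-∣ P e∈P)))
...   | no ℓ≢p = subproducts-squarefree P uP pP e∈P pℓ (Coprimality.coprime-divisor (coprime-* ℓ⊥p ℓ⊥p) ℓ²∣d)
  where
  ℓ⊥p : Coprime ℓ p
  ℓ⊥p = prime-∤⇒coprime pℓ (λ ℓ∣p → [ (λ ℓ≡1 → ¬prime[1] (subst Prime ℓ≡1 pℓ)) , ℓ≢p ]′ (prime⇒irreducible pp ℓ∣p))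

subproducts-unique : ∀ P → Unique P → All Prime P → Unique (subproducts P)
subproducts-unique [] _ _ = [] ∷ []
subproducts-unique (p ∷ P) (p∉P ∷ uP) (pp ∷ pP) = Uniqueₚ.++⁺ (subproducts-unique P uP pP)
  (Uniqueₚ.map⁺ (λ {x} {y} → ℕₚ.*-cancelˡ-≡ x y p {{prime⇒nonZero pp}}) (subproducts-unique P uP pP))
  disjoint
  where
  disjoint : ∀ {d} → ¬ (d ∈ subproducts P × d ∈ map (p *_) (subproducts P))
  disjoint (d∈P , d∈pP) with e , _ , refl ← ∈ₚ.∈-map⁻ (p *_) d∈pP =
    Allₚ.All¬⇒¬Any p∉P (prime∣product⇒∈ P pp pP (∣-trans (m∣m*n e) (subproducts-∣ P d∈P)))

∈-range : ∀ a n {x} → a ≤ x → x < a + n → x ∈ range a n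
∈-range a zero a≤x x<a = ⊥-elim (ℕₚ.<⇒≱ (subst (_ <_) (ℕₚ.+-identityʳ a) x<a) a≤x)
∈-range a (suc n) {x} a≤x x< with a ℕₚ.≟ x
... | yes refl = here refl
... | no a≢x = there (∈-range (suc a) n (ℕₚ.≤∧≢⇒< a≤x a≢x) (subst (x <_) (ℕₚ.+-suc a n) x<))

-- Squares of primes are enough, since m² ∣ d with m ≥ 2 gives ℓ² ∣ d for every prime ℓ ∣ m.
squareFreeB-true : ∀ d → (∀ {ℓ} → Prime ℓ → ¬ ℓ * ℓ ∣ d) → squareFreeB d ≡ true
squareFreeB-true d sf = go 2 d (s≤s (s≤s z≤n))
  where
  go : ∀ a n → 2 ≤ a → allB (λ m → not ⌊ (m * m) ∣? d ⌋) (range a n) ≡ true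
  go a zero 2≤a = refl
  go a@(suc _) (suc n) 2≤a with (a * a) ∣? d
  ... | no _ = go (suc a) n (ℕₚ.m≤n⇒m≤1+n 2≤a)
  ... | yes a²∣d with ℓ , pℓ , ℓ∣a ← prime-divisor a (λ a≡1 → ℕₚ.<-irrefl (sym a≡1) 2≤a) =
    ⊥-elim (sf pℓ (∣-trans (∣-trans (*-monoˡ-∣ ℓ ℓ∣a) (*-monoʳ-∣ a ℓ∣a)) a²∣d))

-- `W k` enters the final bound as a factor of the error weight, so embedding the subset products
-- into the counted list suffices.
2^primes≤W : ∀ k .{{_ : NonZero k}} → 2^∣ primesOf k ∣ ≤ᶻ + W k
2^primes≤W k = subst (_≤ᶻ + W k) (length-subproducts P) (ℤ.+≤+
  (distinct-⊆⇒length≤ (subproducts-unique P (primesOf-unique k) (primesOf-prime k)) counted))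
  where
  P = primesOf k
  open Distinctness (setoid ℕ)
  test : ℕ → Bool
  test d = ⌊ d ∣? k ⌋ ∧ squareFreeB d
  test-true : ∀ {d} → d ∣ k → squareFreeB d ≡ true → test d ≡ true
  test-true {d} d∣k sf with d ∣? k
  ... | yes _ = sf
  ... | no d∤k = ⊥-elim (d∤k d∣k)
  positive : ∀ {d} → d ∣ k → 1 ≤ d
  positive {zero} 0∣k = ⊥-elim (ℕₚ.m<n⇒n≢0 (ℕ.>-nonZero⁻¹ k) (0∣⇒≡0 0∣k))
  positive {suc d} _ = s≤s z≤n
  counted : ∀ {d} → d ∈ subproducts P → d ∈ filter (λ x → Bool._≟_ (test x) true) (range 1 k)
  counted {d} d∈P = ∈ₚ.∈-filter⁺ (λ x → Bool._≟_ (test x) true)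
    (∈-range 1 k (positive d∣k) (s≤s (∣⇒≤ d∣k)))
    (test-true d∣k (squareFreeB-true d (subproducts-squarefree P (primesOf-unique k) (primesOf-prime k) d∈P)))
    where
    d∣k : d ∣ k
    d∣k = ∣-trans (subproducts-∣ P d∈P) (primesOf-product-∣ k)

-- Primes and factorials

prime∣!⇒≤ : ∀ {p} n → Prime p → p ∣ n ! → p ≤ n
prime∣!⇒≤ zero pp p∣1 = ⊥-elim (¬prime[1] (subst Prime (∣1⇒≡1 p∣1) pp))
prime∣!⇒≤ (suc n) pp p∣ with euclidsLemma (suc n) (n !) pp p∣
... | inj₁ p∣1+n = ∣⇒≤ p∣1+n
... | inj₂ p∣n! = ℕₚ.m≤n⇒m≤1+n (prime∣!⇒≤ n pp p∣n!)

∣! : ∀ {m} n → 1 ≤ m → m ≤ n → m ∣ n !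
∣! zero 1≤m m≤0 = ⊥-elim (ℕₚ.<⇒≱ 1≤m m≤0)
∣! {m} (suc n) 1≤m m≤1+n with m ℕₚ.≟ suc n
... | yes refl = m∣m*n (n !)
... | no m≢ = ∣n⇒∣m*n (suc n) (∣! n 1≤m (ℕₚ.≤-pred (ℕₚ.≤∧≢⇒< m≤1+n m≢)))

-- Finite fields: roots of polynomials and a generator of the multiplicative group

module Field {c ℓ : Level} (F : FiniteField c ℓ) where

  module R = FiniteField F
  open R using (Carrier; _≈_; _≈?_; 0#; 1#; 1≉0; inverse; elems; complete; distinct; card; pow) public
  open R using () renaming (_+_ to _⊕_; _*_ to _·_; -_ to ⊖_; refl to ≈-refl; sym to ≈-sym; trans to ≈-trans;
    setoid to ≈-setoid; +-cong to ⊕-cong; *-cong to ·-cong; *-comm to ·-comm; *-assoc to ·-assoc;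
    +-comm to ⊕-comm; +-assoc to ⊕-assoc; *-identityˡ to ·-identityˡ; *-identityʳ to ·-identityʳ;
    +-identityˡ to ⊕-identityˡ; +-identityʳ to ⊕-identityʳ; zeroˡ to ·-zeroˡ; zeroʳ to ·-zeroʳ;
    distribˡ to ·-distribˡ; distribʳ to ·-distribʳ; reflexive to ≈-reflexive; -‿inverseˡ to ⊖-inverseˡ;
    -‿inverseʳ to ⊖-inverseʳ; -‿cong to ⊖-cong) public
  open SetoidReasoning ≈-setoid
  open RingProperties R.ring using () renaming (+-cancelˡ to ⊕-cancelˡ; +-cancelʳ to ⊕-cancelʳ; -‿distribˡ-* to ⊖-distribˡ-·) public
  open Distinctness ≈-setoid public
  open Permutation ≈-setoid using (_↭_; ↭-sym) public
  open Permutationₚ ≈-setoid using (∈-resp-↭; Unique-resp-↭; xs↭ys⇒|xs|≡|ys|; foldr-commMonoid) public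
  open Membership ≈-setoid using () renaming (_∈_ to _∈ᶠ_) public
  open SemiringSolver R.commutativeSemiring using (solve; _:+_; _:*_; _:=_) public
  open SemiringExp R.semiring using () renaming (_^_ to _^ᶠ_) public

  pow≡^ : ∀ x n → pow x n ≡ x ^ᶠ n
  pow≡^ x zero = refl
  pow≡^ x (suc n) = cong (x ·_) (pow≡^ x n)

  pow-cong : ∀ {x y} n → x ≈ y → pow x n ≈ pow y n
  pow-cong zero x≈y = ≈-refl
  pow-cong (suc n) x≈y = ·-cong x≈y (pow-cong n x≈y)

  pow-+ : ∀ x m n → pow x (m + n) ≈ pow x m · pow x n
  pow-+ x zero n = ≈-sym (·-identityˡ _)
  pow-+ x (suc m) n = ≈-trans (·-cong ≈-refl (pow-+ x m n)) (≈-sym (·-assoc _ _ _))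

  pow-1# : ∀ n → pow 1# n ≈ 1#
  pow-1# zero = ≈-refl
  pow-1# (suc n) = ≈-trans (·-identityˡ _) (pow-1# n)

  pow-· : ∀ x y n → pow (x · y) n ≈ pow x n · pow y n
  pow-· x y zero = ≈-sym (·-identityˡ _)
  pow-· x y (suc n) = ≈-trans (·-cong ≈-refl (pow-· x y n))
    (solve 4 (λ x y a b → x :* y :* (a :* b) := x :* a :* (y :* b)) ≈-refl x y (pow x n) (pow y n))

  pow-* : ∀ x m n → pow x (m * n) ≈ pow (pow x m) n
  pow-* x m zero = ≈-reflexive (cong (pow x) (ℕₚ.*-zeroʳ m))
  pow-* x m (suc n) = begin
    pow x (m * suc n) ≡⟨ cong (pow x) (ℕₚ.*-suc m n) ⟩
    pow x (m + m * n) ≈⟨ pow-+ x m (m * n) ⟩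
    pow x m · pow x (m * n) ≈⟨ ·-cong ≈-refl (pow-* x m n) ⟩
    pow x m · pow (pow x m) n ∎

  pow-*′ : ∀ x m n → pow x (m * n) ≈ pow (pow x n) m
  pow-*′ x m n = ≈-trans (≈-reflexive (cong (pow x) (ℕₚ.*-comm m n))) (pow-* x n m)

  pow-multiple : ∀ {x m n} → pow x m ≈ 1# → m ∣ n → pow x n ≈ 1#
  pow-multiple {x} {m} xᵐ≈1 (divides j refl) =
    ≈-trans (pow-*′ x j m) (≈-trans (pow-cong j xᵐ≈1) (pow-1# j))

  ·-cancelˡ : ∀ {x y z} → ¬ x ≈ 0# → x · y ≈ x · z → y ≈ z
  ·-cancelˡ {x} {y} {z} x≉0 xy≈xz with u , xu≈1 ← inverse x x≉0 = begin
    y ≈⟨ ·-identityˡ y ⟨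
    1# · y ≈⟨ ·-cong (≈-trans (·-comm u x) xu≈1) ≈-refl ⟨
    (u · x) · y ≈⟨ ·-assoc u x y ⟩
    u · (x · y) ≈⟨ ·-cong ≈-refl xy≈xz ⟩
    u · (x · z) ≈⟨ ·-assoc u x z ⟨
    (u · x) · z ≈⟨ ·-cong (≈-trans (·-comm u x) xu≈1) ≈-refl ⟩
    1# · z ≈⟨ ·-identityˡ z ⟩
    z ∎

  ·-cancelʳ : ∀ {x y z} → ¬ x ≈ 0# → y · x ≈ z · x → y ≈ z
  ·-cancelʳ {x} {y} {z} x≉0 yx≈zx = ·-cancelˡ x≉0 (≈-trans (·-comm x y) (≈-trans yx≈zx (·-comm z x)))

  ·-nonzero : ∀ {x y} → ¬ x ≈ 0# → ¬ y ≈ 0# → ¬ x · y ≈ 0#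
  ·-nonzero {x} x≉0 y≉0 xy≈0 = y≉0 (·-cancelˡ x≉0 (≈-trans xy≈0 (≈-sym (·-zeroʳ x))))

  pow-nonzero : ∀ {x} n → ¬ x ≈ 0# → ¬ pow x n ≈ 0#
  pow-nonzero zero x≉0 = 1≉0
  pow-nonzero (suc n) x≉0 = ·-nonzero x≉0 (pow-nonzero n x≉0)

  pow-0# : ∀ n .{{_ : NonZero n}} → pow 0# n ≈ 0#
  pow-0# (suc n) = ·-zeroˡ _

  pow-bezout : ∀ {x d a b} → pow x a ≈ 1# → pow x b ≈ 1# → Bézout.Identity d a b → pow x d ≈ 1#
  pow-bezout {x} {d} {a} {b} xᵃ≈1 xᵇ≈1 (Bézout.+- u v eq) = begin
    pow x d ≈⟨ ·-identityʳ _ ⟨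
    pow x d · 1# ≈⟨ ·-cong ≈-refl (pow-multiple xᵇ≈1 (n∣m*n v)) ⟨
    pow x d · pow x (v * b) ≈⟨ pow-+ x d (v * b) ⟨
    pow x (d + v * b) ≡⟨ cong (pow x) eq ⟩
    pow x (u * a) ≈⟨ pow-multiple xᵃ≈1 (n∣m*n u) ⟩
    1# ∎
  pow-bezout {x} {d} {a} {b} xᵃ≈1 xᵇ≈1 (Bézout.-+ u v eq) = begin
    pow x d ≈⟨ ·-identityʳ _ ⟨
    pow x d · 1# ≈⟨ ·-cong ≈-refl (pow-multiple xᵃ≈1 (n∣m*n u)) ⟨
    pow x d · pow x (u * a) ≈⟨ pow-+ x d (u * a) ⟨
    pow x (d + u * a) ≡⟨ cong (pow x) eq ⟩
    pow x (v * b) ≈⟨ pow-multiple xᵇ≈1 (n∣m*n v) ⟩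
    1# ∎

  -- Polynomial functions and their roots

  -- Polynomials appear as functions with a Horner form, `a` plus `x` times a polynomial of lower
  -- degree. Only the functions matter, so coefficients are never compared.
  data Degree< : ℕ → (Carrier → Carrier) → Set (c ⊔ ℓ) where
    zero : ∀ {f} → (∀ x → f x ≈ 0#) → Degree< 0 f
    step : ∀ {d f g} a → Degree< d g → (∀ x → f x ≈ a ⊕ x · g x) → Degree< (suc d) f

  data Monic : ℕ → (Carrier → Carrier) → Set (c ⊔ ℓ) where
    one : ∀ {f} → (∀ x → f x ≈ 1#) → Monic 0 f
    step : ∀ {d f g} a → Monic d g → (∀ x → f x ≈ a ⊕ x · g x) → Monic (suc d) f

  degree-zero : ∀ d → Degree< d (λ _ → 0#)
  degree-zero zero = zero (λ _ → ≈-refl)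
  degree-zero (suc d) = step 0# (degree-zero d) (λ x → ≈-sym (≈-trans (⊕-identityˡ _) (·-zeroʳ x)))

  degree-≤ : ∀ {d e f} → d ≤ e → Degree< d f → Degree< e f
  degree-≤ {e = zero} z≤n df = df
  degree-≤ {e = suc e} z≤n (zero f≈0) =
    step 0# (degree-zero e) (λ x → ≈-trans (f≈0 x) (≈-sym (≈-trans (⊕-identityˡ _) (·-zeroʳ x))))
  degree-≤ (s≤s d≤e) (step a dg f≈) = step a (degree-≤ d≤e dg) f≈

  degree-+ : ∀ {d f g} → Degree< d f → Degree< d g → Degree< d (λ x → f x ⊕ g x)
  degree-+ (zero f≈0) (zero g≈0) = zero (λ x → ≈-trans (⊕-cong (f≈0 x) (g≈0 x)) (⊕-identityˡ 0#))
  degree-+ {f = f} {g} (step {g = f′} a df f≈) (step {g = g′} b dg g≈) = step (a ⊕ b) (degree-+ df dg) (λ x →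
    ≈-trans (⊕-cong (f≈ x) (g≈ x))
      (solve 5 (λ a b x u v → a :+ x :* u :+ (b :+ x :* v) := a :+ b :+ x :* (u :+ v)) ≈-refl a b x (f′ x) (g′ x)))

  monic-+ : ∀ {d f g} → Monic d f → Degree< d g → Monic d (λ x → f x ⊕ g x)
  monic-+ (one f≈1) (zero g≈0) = one (λ x → ≈-trans (⊕-cong (f≈1 x) (g≈0 x)) (⊕-identityʳ 1#))
  monic-+ {f = f} {g} (step {g = f′} a df f≈) (step {g = g′} b dg g≈) = step (a ⊕ b) (monic-+ df dg) (λ x →
    ≈-trans (⊕-cong (f≈ x) (g≈ x))
      (solve 5 (λ a b x u v → a :+ x :* u :+ (b :+ x :* v) := a :+ b :+ x :* (u :+ v)) ≈-refl a b x (f′ x) (g′ x)))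

  monic-scale : ∀ {d f} r → Monic d f → Degree< (suc d) (λ x → r · f x)
  monic-scale r (one f≈1) = step r (zero (λ _ → ≈-refl)) (λ x →
    ≈-trans (·-cong ≈-refl (f≈1 x)) (≈-trans (·-identityʳ r) (≈-sym (≈-trans (⊕-cong ≈-refl (·-zeroʳ x)) (⊕-identityʳ r)))))
  monic-scale r (step {g = g} a mg f≈) = step (r · a) (monic-scale r mg) (λ x → ≈-trans (·-cong ≈-refl (f≈ x))
    (solve 4 (λ r a x u → r :* (a :+ x :* u) := r :* a :+ x :* (r :* u)) ≈-refl r a x (g x)))

  monic-degree : ∀ {d f} → Monic d f → Degree< (suc d) f
  monic-degree (one f≈1) = step 1# (zero (λ _ → ≈-refl)) (λ x →
    ≈-trans (f≈1 x) (≈-sym (≈-trans (⊕-cong ≈-refl (·-zeroʳ x)) (⊕-identityʳ 1#))))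
  monic-degree (step a mg f≈) = step a (monic-degree mg) f≈

  monic-pow : ∀ d → Monic d (λ x → pow x d)
  monic-pow zero = one (λ _ → ≈-refl)
  monic-pow (suc d) = step 0# (monic-pow d) (λ x → ≈-sym (⊕-identityˡ _))

  monic-const : ∀ {d f} a → Monic (suc d) f → Monic (suc d) (λ x → a ⊕ f x)
  monic-const a (step b mg f≈) = step (a ⊕ b) mg (λ x → ≈-trans (⊕-cong ≈-refl (f≈ x)) (≈-sym (⊕-assoc _ _ _)))

  -- The factor theorem f x - f r = (x - r) h x, with both sides moved so that no subtraction occurs.
  factor : ∀ {d f} → Monic (suc d) f → ∀ r →
    Σ (Carrier → Carrier) λ h → Monic d h × (∀ x → f x ⊕ r · h x ≈ f r ⊕ x · h x)
  factor {zero} {f} (step a (one {f = g} g≈1) f≈) r = (λ _ → 1#) , one (λ _ → ≈-refl) , λ x → begin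
    f x ⊕ r · 1# ≈⟨ ⊕-cong (≈-trans (f≈ x) (⊕-cong ≈-refl (·-cong ≈-refl (g≈1 x)))) ≈-refl ⟩
    (a ⊕ x · 1#) ⊕ r · 1# ≈⟨ solve 4 (λ a x r o → a :+ x :* o :+ r :* o := a :+ r :* o :+ x :* o) ≈-refl a x r 1# ⟩
    (a ⊕ r · 1#) ⊕ x · 1# ≈⟨ ⊕-cong (≈-trans (f≈ r) (⊕-cong ≈-refl (·-cong ≈-refl (g≈1 r)))) ≈-refl ⟨
    f r ⊕ x · 1# ∎
  factor {suc d} {f} (step {g = g} a mg f≈) r with h , mh , g≈ ← factor mg r =
    (λ x → g x ⊕ r · h x) , monic-+ mg (monic-scale r mh) , λ x → begin
    f x ⊕ r · (g x ⊕ r · h x) ≈⟨ ⊕-cong (f≈ x) (·-cong ≈-refl (g≈ x)) ⟩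
    (a ⊕ x · g x) ⊕ r · (g r ⊕ x · h x)
      ≈⟨ solve 6 (λ a x r gx gr h → a :+ x :* gx :+ r :* (gr :+ x :* h) := a :+ r :* gr :+ x :* (gx :+ r :* h))
           ≈-refl a x r (g x) (g r) (h x) ⟩
    (a ⊕ r · g r) ⊕ x · (g x ⊕ r · h x) ≈⟨ ⊕-cong (f≈ r) ≈-refl ⟨
    f r ⊕ x · (g x ⊕ r · h x) ∎

  roots≤degree : ∀ {d f} → Monic d f → ∀ {xs} → Distinct xs → All (λ x → f x ≈ 0#) xs → length xs ≤ d
  roots≤degree mf {[]} [] [] = z≤n
  roots≤degree {zero} (one f≈1) {x ∷ xs} _ (fx≈0 ∷ _) = ⊥-elim (1≉0 (≈-trans (≈-sym (f≈1 x)) fx≈0))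
  roots≤degree {suc d} {f} mf {r ∷ xs} (r∉xs ∷ dxs) (fr≈0 ∷ fxs≈0)
    with h , mh , f≈ ← factor mf r = s≤s (roots≤degree mh dxs (root r∉xs fxs≈0))
    where
    root : ∀ {xs} → All (λ x → ¬ r ≈ x) xs → All (λ x → f x ≈ 0#) xs → All (λ x → h x ≈ 0#) xs
    root [] [] = []
    root {x ∷ _} (r≉x ∷ r∉) (fx≈0 ∷ fxs) with h x ≈? 0#
    ... | yes hx≈0 = hx≈0 ∷ root r∉ fxs
    ... | no hx≉0 = ⊥-elim (r≉x (·-cancelʳ hx≉0 (begin
      r · h x ≈⟨ ⊕-identityˡ _ ⟨
      0# ⊕ r · h x ≈⟨ ⊕-cong fx≈0 ≈-refl ⟨
      f x ⊕ r · h x ≈⟨ f≈ x ⟩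
      f r ⊕ x · h x ≈⟨ ⊕-cong fr≈0 ≈-refl ⟩
      0# ⊕ x · h x ≈⟨ ⊕-identityˡ _ ⟩
      x · h x ∎)))

  -- The multiplicative group

  private
    zero-split : Σ (List Carrier) λ nz → elems ↭ 0# ∷ nz
    zero-split = ∈⇒↭∷ (complete 0#)

  nonzeros : List Carrier
  nonzeros = proj₁ zero-split

  elems↭ : elems ↭ 0# ∷ nonzeros
  elems↭ = proj₂ zero-split

  N : ℕ
  N = length nonzeros

  card≡1+N : card ≡ suc N
  card≡1+N = xs↭ys⇒|xs|≡|ys| elems↭

  zero-nonzeros-distinct : Distinct (0# ∷ nonzeros)
  zero-nonzeros-distinct = Unique-resp-↭ elems↭ distinct

  nonzeros-distinct : Distinct nonzeros
  nonzeros-distinct with _ ∷ d ← zero-nonzeros-distinct = d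

  ∈-nonzeros⁻ : ∀ {x} → x ∈ᶠ nonzeros → ¬ x ≈ 0#
  ∈-nonzeros⁻ x∈ x≈0 with 0∉ ∷ _ ← zero-nonzeros-distinct = Allₚ.All¬⇒¬Any 0∉ (Membershipₚ.∈-resp-≈ ≈-setoid x≈0 x∈)

  ∈-nonzeros : ∀ {x} → ¬ x ≈ 0# → x ∈ᶠ nonzeros
  ∈-nonzeros {x} x≉0 with ∈-resp-↭ elems↭ (complete x)
  ... | here x≈0 = ⊥-elim (x≉0 x≈0)
  ... | there x∈ = x∈

  map-distinct : ∀ {f : Carrier → Carrier} → (∀ {x y} → f x ≈ f y → x ≈ y) → ∀ {xs} → Distinct xs → Distinct (map f xs)
  map-distinct inj dxs = AllPairsₚ.map⁺ (AllPairs.map (λ x≉y fx≈fy → x≉y (inj fx≈fy)) dxs)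

  product# : List Carrier → Carrier
  product# = foldr _·_ 1#

  product#-nonzero : ∀ {xs} → All (λ x → ¬ x ≈ 0#) xs → ¬ product# xs ≈ 0#
  product#-nonzero [] = 1≉0
  product#-nonzero (x≉0 ∷ xs≉0) = ·-nonzero x≉0 (product#-nonzero xs≉0)

  product#-map : ∀ x ys → product# (map (x ·_) ys) ≈ pow x (length ys) · product# ys
  product#-map x [] = ≈-sym (·-identityˡ 1#)
  product#-map x (y ∷ ys) = ≈-trans (·-cong ≈-refl (product#-map x ys))
    (solve 4 (λ x y a b → x :* y :* (a :* b) := x :* a :* (y :* b)) ≈-refl x y (pow x (length ys)) (product# ys))

  -- Multiplication by `x` permutes the nonzero elements, so their product is unchanged by the
  -- factor `pow x N` and can be cancelled.
  pow-N : ∀ {x} → ¬ x ≈ 0# → pow x N ≈ 1#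
  pow-N {x} x≉0 = ·-cancelʳ (product#-nonzero (All.tabulateₛ ≈-setoid ∈-nonzeros⁻)) (begin
    pow x N · product# nonzeros ≈⟨ product#-map x nonzeros ⟨
    product# (map (x ·_) nonzeros) ≈⟨ foldr-commMonoid R.*-isCommutativeMonoid (distinct-⊆-length⇒↭
      (map-distinct (·-cancelˡ x≉0) nonzeros-distinct) ⊆nonzeros
      (ℕₚ.≤-reflexive (sym (length-map (x ·_) nonzeros)))) ⟨
    product# nonzeros ≈⟨ ·-identityˡ _ ⟨
    1# · product# nonzeros ∎)
    where
    ⊆nonzeros : ∀ {z} → z ∈ᶠ map (x ·_) nonzeros → z ∈ᶠ nonzeros
    ⊆nonzeros z∈ with y , y∈ , z≈xy ← Membershipₚ.∈-map⁻ ≈-setoid ≈-setoid z∈ =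
      ∈-nonzeros (λ z≈0 → ·-nonzero x≉0 (∈-nonzeros⁻ y∈) (≈-trans (≈-sym z≈xy) z≈0))

  N-positive : 1 ≤ N
  N-positive with nonzeros | ∈-nonzeros 1≉0
  ... | _ ∷ _ | _ = s≤s z≤n

  private
    -- Xᵐ - 1 has at most m roots, fewer than the N nonzero elements.
    non-root : ∀ m → 1 ≤ m → m < N → Σ Carrier λ y → ¬ y ≈ 0# × ¬ pow y m ≈ 1#
    non-root m@(suc _) 1≤m m<N with All.all? (λ y → pow y m ≈? 1#) nonzeros
    ... | yes all = ⊥-elim (ℕₚ.<⇒≱ m<N (roots≤degree (monic-const (⊖ 1#) (monic-pow m)) nonzeros-distinct
            (All.map (λ yᵐ≈1 → ≈-trans (⊕-cong ≈-refl yᵐ≈1) (⊖-inverseˡ 1#)) all)))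
    ... | no ¬all with y , y∈ , y≉ ← Membership.find ≈-setoid (Allₚ.¬All⇒Any¬ (λ y → pow y m ≈? 1#) nonzeros ¬all) =
      y , ∈-nonzeros⁻ y∈ , y≉

    -- Here `m` is N / r, given through `m * r ≡ N` instead of a division. Once `b` exceeds every
    -- prime divisor of N, the condition forces `g` to have order N.
    NoSmallOrder : ℕ → Carrier → Set ℓ
    NoSmallOrder b g = ∀ r m → Prime r → r < b → m * r ≡ N → ¬ pow g m ≈ 1#

    -- An element y with y ^ (N / b) ≠ 1 is multiplied in with the exponent (b - 1)!, which is divisible by
    -- all smaller primes but not by b.
    extend : ∀ b₁ m g → Prime (suc b₁) → N ≡ m * suc b₁ → ¬ g ≈ 0# → NoSmallOrder (suc b₁) g → pow g m ≈ 1# →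
      Σ Carrier λ g → ¬ g ≈ 0# × NoSmallOrder (suc (suc b₁)) g
    extend b₁ m g pb N≡m*b g≉0 ord gᵐ≈1 = g · pow y t , ·-nonzero g≉0 (pow-nonzero t y≉0) , ord′
      where
      b = suc b₁
      t = b₁ !
      m<N : m < N
      m<N = subst (m <_) (sym N≡m*b) (ℕₚ.m<m*n m b {{m≢0}} (ℕ.nonTrivial⇒n>1 b {{prime⇒nonTrivial pb}}))
        where
        m≢0 : NonZero m
        m≢0 = ℕ.≢-nonZero λ m≡0 → ℕₚ.<⇒≱ N-positive (ℕₚ.≤-reflexive (trans N≡m*b (cong (_* b) m≡0)))
      1≤m : 1 ≤ m
      1≤m = ℕₚ.n≢0⇒n>0 λ m≡0 → ℕₚ.<⇒≱ N-positive (ℕₚ.≤-reflexive (trans N≡m*b (cong (_* b) m≡0)))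
      y = proj₁ (non-root m 1≤m m<N)
      y≉0 = proj₁ (proj₂ (non-root m 1≤m m<N))
      yᵐ≉1 = proj₂ (proj₂ (non-root m 1≤m m<N))
      b⊥t : Coprime b t
      b⊥t = prime-∤⇒coprime pb (λ b∣t → ℕₚ.<⇒≱ (ℕₚ.n<1+n b₁) (prime∣!⇒≤ b₁ pb b∣t))
      ord′ : NoSmallOrder (suc b) (g · pow y t)
      ord′ r m′ pr r<1+b m′*r≡N eq with ℕₚ.m≤n⇒m<n∨m≡n (ℕₚ.≤-pred r<1+b)
      ... | inj₁ r<b = ord r m′ pr r<b m′*r≡N (begin
        pow g m′ ≈⟨ ·-identityʳ _ ⟨
        pow g m′ · 1# ≈⟨ ·-cong ≈-refl (≈-trans (≈-sym (pow-* y t m′)) (pow-multiple (pow-N y≉0) N∣t*m′)) ⟨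
        pow g m′ · pow (pow y t) m′ ≈⟨ pow-· g (pow y t) m′ ⟨
        pow (g · pow y t) m′ ≈⟨ eq ⟩
        1# ∎)
        where
        N∣t*m′ : N ∣ t * m′
        N∣t*m′ = subst (_∣ t * m′) (trans (ℕₚ.*-comm r m′) m′*r≡N) (*-monoˡ-∣ m′
          (∣! b₁ (ℕ.>-nonZero⁻¹ r {{prime⇒nonZero pr}}) (ℕₚ.≤-pred r<b)))
      -- Here `r = b`. As `pow g m` is 1, the element `pow y m` would have order dividing both `b`
      -- and `t`, which are coprime, and so would be 1.
      ... | inj₂ refl = yᵐ≉1 (≈-trans (≈-sym (·-identityʳ _))
        (pow-bezout ωᵇ≈1 ωᵗ≈1 (Coprimality.coprime-Bézout b⊥t)))
        where
        m≡m′ : m ≡ m′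
        m≡m′ = ℕₚ.*-cancelʳ-≡ m m′ b (trans (sym N≡m*b) (sym m′*r≡N))
        ωᵇ≈1 : pow (pow y m) b ≈ 1#
        ωᵇ≈1 = ≈-trans (≈-sym (pow-* y m b)) (≈-trans (≈-reflexive (cong (pow y) (sym N≡m*b))) (pow-N y≉0))
        ωᵗ≈1 : pow (pow y m) t ≈ 1#
        ωᵗ≈1 = begin
          pow (pow y m) t ≈⟨ pow-*′ y t m ⟨
          pow y (t * m) ≈⟨ pow-* y t m ⟩
          pow (pow y t) m ≈⟨ ·-identityˡ _ ⟨
          1# · pow (pow y t) m ≈⟨ ·-cong gᵐ≈1 ≈-refl ⟨
          pow g m · pow (pow y t) m ≈⟨ pow-· g (pow y t) m ⟨
          pow (g · pow y t) m ≡⟨ cong (pow (g · pow y t)) m≡m′ ⟩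
          pow (g · pow y t) m′ ≈⟨ eq ⟩
          1# ∎

    build : ∀ b → Σ Carrier λ g → ¬ g ≈ 0# × NoSmallOrder b g
    build zero = 1# , 1≉0 , λ _ _ _ ()
    build (suc b) with build b
    ... | g , g≉0 , ord with prime? b ×-dec b ∣? N
    ...   | no ¬bN = g , g≉0 , λ r m pr r<1+b m*r≡N → [ (λ r<b → ord r m pr r<b m*r≡N) ,
              (λ { refl → ⊥-elim (¬bN (pr , divides m (sym m*r≡N))) }) ]′ (ℕₚ.m≤n⇒m<n∨m≡n (ℕₚ.≤-pred r<1+b))
    ...   | yes (pb , divides m N≡m*b) with pow g m ≈? 1#
    ...     | no gᵐ≉1 = g , g≉0 , λ r m′ pr r<1+b m*r≡N → [ (λ r<b → ord r m′ pr r<b m*r≡N) ,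
              (λ { refl → λ g≈1 → gᵐ≉1 (≈-trans (≈-reflexive (cong (pow g)
                   (ℕₚ.*-cancelʳ-≡ m m′ b {{prime⇒nonZero pb}} (trans (sym N≡m*b) (sym m*r≡N))))) g≈1) }) ]′
              (ℕₚ.m≤n⇒m<n∨m≡n (ℕₚ.≤-pred r<1+b))
    build (suc zero) | g , g≉0 , ord | yes (pb , divides m N≡m*b) | yes gᵐ≈1 = ⊥-elim (¬prime[0] pb)
    build (suc (suc b₁)) | g , g≉0 , ord | yes (pb , divides m N≡m*b) | yes gᵐ≈1 =
      extend b₁ m g pb N≡m*b g≉0 ord gᵐ≈1

  generator : Carrier
  -- The bound `suc N` is strict, so that every prime divisor of N, possibly N itself, is covered.
  generator = proj₁ (build (suc N))

  generator≉0 : ¬ generator ≈ 0#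
  generator≉0 = proj₁ (proj₂ (build (suc N)))

  -- By Bézout the power with exponent d = gcd(a, N) is 1 as well. If d were not N, a prime p
  -- dividing N / d would make the power with exponent N / p trivial.
  generator-order : ∀ {a} → pow generator a ≈ 1# → N ∣ a
  generator-order {a} gᵃ≈1 with gcd[m,n]∣n a N
  ... | divides j N≡j*d with j ℕₚ.≟ 1
  ...   | yes refl = subst (_∣ a) (sym (trans N≡j*d (ℕₚ.+-identityʳ _))) (gcd[m,n]∣m a N)
  ...   | no j≢1 = ⊥-elim (impossible (prime-divisor j {{j≢0}} j≢1))
    where
    d = gcd a N
    j≢0 : NonZero j
    j≢0 = ℕ.≢-nonZero λ j≡0 → ℕₚ.<⇒≱ N-positive (ℕₚ.≤-reflexive (trans N≡j*d (cong (_* d) j≡0)))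
    gᵈ≈1 : pow generator d ≈ 1#
    gᵈ≈1 = pow-bezout gᵃ≈1 (pow-N generator≉0) (Bézout.identity (gcd-GCD a N))
    impossible : ¬ (Σ ℕ λ p → Prime p × p ∣ j)
    impossible (p , pp , divides i j≡i*p) = proj₂ (proj₂ (build (suc N))) p (i * d) pp
      (s≤s (∣⇒≤ {{ℕ.>-nonZero N-positive}} (∣-trans (divides i j≡i*p) (divides d (trans N≡j*d (ℕₚ.*-comm j d))))))
      (trans (e i d p) (sym (trans N≡j*d (cong (_* d) j≡i*p))))
      (pow-multiple gᵈ≈1 (n∣m*n i))
      where
      e : ∀ i d p → i * d * p ≡ i * p * d
      e = ℕ-Solver.solve-∀

-- `p` divides p! = C(p, k) k! (p - k)!, but neither of the two factorials on the right, whose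
-- arguments lie below `p`.
prime∣nCk : ∀ {p k} → Prime p → 1 ≤ k → k < p → p ∣ p C k
prime∣nCk {p@(suc p₁)} {k} pp 1≤k k<p with euclidsLemma (p C k) (k ! * (p ∸ k) !) pp p∣
  where
  k≤p = ℕₚ.<⇒≤ k<p
  nonZero = ℕₚ._!*_!≢0 k (p ∸ k)
  eq : (p C k) * (k ! * (p ∸ k) !) ≡ p !
  eq = trans (cong (_* (k ! * (p ∸ k) !)) (nCk≡n!/k![n-k]! k≤p)) (m/n*n≡m {{nonZero}} (k![n∸k]!∣n! k≤p))
  p∣ : p ∣ (p C k) * (k ! * (p ∸ k) !)
  p∣ = subst (p ∣_) (sym eq) (m∣m*n (p₁ !))
... | inj₁ p∣C = p∣C
... | inj₂ p∣k!l! with euclidsLemma (k !) ((p ∸ k) !) pp p∣k!l!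
...   | inj₁ p∣k! = ⊥-elim (ℕₚ.<⇒≱ k<p (prime∣!⇒≤ k pp p∣k!))
...   | inj₂ p∣l! = ⊥-elim (ℕₚ.<⇒≱ (ℕₚ.∸-monoʳ-< 1≤k (ℕₚ.<⇒≤ k<p)) (prime∣!⇒≤ (p ∸ k) pp p∣l!))

∑-cong-All : ∀ {a b} {A : Set a} {P : A → Set b} {xs : List A} {f g : A → ℤ} → All P xs →
  (∀ x → P x → f x ≡ g x) → ∑ xs f ≡ ∑ xs g
∑-cong-All [] f≡g = refl
∑-cong-All (px ∷ pxs) f≡g = cong₂ _+ᶻ_ (f≡g _ px) (∑-cong-All pxs f≡g)

-- Sums over the field and over the powers of the generator

module FieldSums {c ℓ : Level} (F : FiniteField c ℓ) where

  open Field F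
  open SetoidReasoning ≈-setoid

  Respects≈ : (Carrier → ℤ) → Set (c ⊔ ℓ)
  Respects≈ G = ∀ {x y} → x ≈ y → G x ≡ G y

  ∑-↭ : ∀ {G} → Respects≈ G → ∀ {xs ys} → xs ↭ ys → ∑ xs G ≡ ∑ ys G
  ∑-↭ {G} resp (Permutation.refl xs≋ys) = go xs≋ys
    where
    go : ∀ {xs ys} → Pointwise _≈_ xs ys → ∑ xs G ≡ ∑ ys G
    go [] = refl
    go (x≈y ∷ xs≋ys) = cong₂ _+ᶻ_ (resp x≈y) (go xs≋ys)
  ∑-↭ resp (Permutation.prep x≈y p) = cong₂ _+ᶻ_ (resp x≈y) (∑-↭ resp p)
  ∑-↭ {G} resp {x ∷ y ∷ xs} {y′ ∷ x′ ∷ ys} (Permutation.swap x≈x′ y≈y′ p) =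
    trans (e (G x) (G y) (∑ xs G)) (cong₂ _+ᶻ_ (resp y≈y′) (cong₂ _+ᶻ_ (resp x≈x′) (∑-↭ resp p)))
    where
    e : ∀ a b s → a +ᶻ (b +ᶻ s) ≡ b +ᶻ (a +ᶻ s)
    e = solve-∀
  ∑-↭ resp (Permutation.trans p q) = trans (∑-↭ resp p) (∑-↭ resp q)

  -- An injective map of a finite set into itself is a permutation. This serves for translations and
  -- for multiplication by nonzero elements alike.
  ∑-injection : ∀ {G} → Respects≈ G → (f : Carrier → Carrier) → (∀ {x y} → f x ≈ f y → x ≈ y) →
    ∑ elems (λ x → G (f x)) ≡ ∑ elems G
  ∑-injection {G} resp f inj = trans (sym (∑-map f elems G)) (sym (∑-↭ resp
    (distinct-⊆-length⇒↭ (map-distinct inj distinct) (λ {z} _ → complete z) (ℕₚ.≤-reflexive (sym (length-map f elems))))))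

  ∑-delta : ∀ {xs} z → Distinct xs → z ∈ᶠ xs → ∑ xs (λ x → ⟦ x ≈? z ⟧) ≡ 1ℤ
  ∑-delta {x ∷ xs} z (x∉xs ∷ _) (here z≈x) = cong₂ _+ᶻ_ (⟦⟧-true (x ≈? z) (≈-sym z≈x))
    (trans (∑-cong-All x∉xs (λ y x≉y → ⟦⟧-false (y ≈? z) (λ y≈z → x≉y (≈-sym (≈-trans y≈z z≈x)))))
      (∑-zero xs (λ _ → refl)))
  ∑-delta {x ∷ xs} z (x∉xs ∷ dxs) (there z∈xs) = cong₂ _+ᶻ_
    (⟦⟧-false (x ≈? z) (λ x≈z → Allₚ.All¬⇒¬Any x∉xs (Membershipₚ.∈-resp-≈ ≈-setoid (≈-sym x≈z) z∈xs))) (∑-delta z dxs z∈xs)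

  private
    g = generator

  pow-generator-injective-≤ : ∀ {a b} → a ≤ b → pow g a ≈ pow g b → N ∣ b ∸ a
  pow-generator-injective-≤ {a} {b} a≤b eq = generator-order (·-cancelˡ (pow-nonzero a generator≉0) (begin
    pow g a · pow g (b ∸ a) ≈⟨ pow-+ g a (b ∸ a) ⟨
    pow g (a + (b ∸ a)) ≡⟨ cong (pow g) (ℕₚ.m+[n∸m]≡n a≤b) ⟩
    pow g b ≈⟨ eq ⟨
    pow g a ≈⟨ ·-identityʳ _ ⟨
    pow g a · 1# ∎))

  powers-distinct : Distinct (map (pow g) (upTo N))
  powers-distinct = AllPairsₚ.map⁺ (AllPairsₚ.applyUpTo⁺₁ id N
    (λ {i} {j} i<j j<N eq → ℕₚ.<⇒≱ (ℕₚ.≤-<-trans (ℕₚ.m∸n≤m j i) j<N)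
      (∣⇒≤ {{ℕ.>-nonZero (ℕₚ.m<n⇒0<n∸m i<j)}} (pow-generator-injective-≤ (ℕₚ.<⇒≤ i<j) eq))))

  nonzeros↭powers : nonzeros ↭ map (pow g) (upTo N)
  nonzeros↭powers = distinct-⊆-length⇒↭ powers-distinct
    (λ z∈ → let a , _ , z≈ = Membershipₚ.∈-map⁻ (setoid ℕ) ≈-setoid z∈
            in ∈-nonzeros (λ z≈0 → pow-nonzero a generator≉0 (≈-trans (≈-sym z≈) z≈0)))
    (ℕₚ.≤-reflexive (sym (trans (length-map (pow g) (upTo N)) (length-upTo N))))

  discrete-log : ∀ {x} → ¬ x ≈ 0# → Σ ℕ λ a → a < N × x ≈ pow g a
  discrete-log x≉0 = let a , a∈ , x≈ = Membershipₚ.∈-map⁻ (setoid ℕ) ≈-setoid (∈-resp-↭ nonzeros↭powers (∈-nonzeros x≉0))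
                     in a , ∈ₚ.∈-upTo⁻ a∈ , x≈

  ∑-elems : ∀ {G} → Respects≈ G → ∑ elems G ≡ G 0# +ᶻ ∑< N (λ a → G (pow g a))
  ∑-elems {G} resp = trans (∑-↭ resp elems↭)
    (cong (G 0# +ᶻ_) (trans (∑-↭ resp nonzeros↭powers) (∑-map (pow g) (upTo N) G)))

  pow-generator-periodic : ∀ {G} → Respects≈ G → Periodic N (λ a → G (pow g a))
  pow-generator-periodic resp i = resp (≈-trans (pow-+ g N i)
    (≈-trans (·-cong (pow-N generator≉0) ≈-refl) (·-identityˡ _)))

-- Frobenius and the trace of F over the subfield of p ^ (r + 1) elements

module Trace {c ℓ : Level} (F : FiniteField c ℓ) (p r n₁ : ℕ) (pp : Prime p)
  (card≡ : FiniteField.card F ≡ (p ^ suc r) ^ suc n₁) where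

  open Field F
  open SetoidReasoning ≈-setoid
  open FieldSums F

  q n : ℕ
  q = p ^ suc r
  n = suc n₁

  private
    open MonoidMult R.+-monoid using (×-congʳ; ×-assocˡ) renaming (_×_ to _×ᶠ_)
    open SemiringMult R.semiring using (×1-homo-*; ×-assoc-*)

    sum# : List Carrier → Carrier
    sum# = foldr _⊕_ 0#

    sum#-map : ∀ x ys → sum# (map (x ⊕_) ys) ≈ length ys ×ᶠ x ⊕ sum# ys
    sum#-map x [] = ≈-sym (⊕-identityˡ 0#)
    sum#-map x (y ∷ ys) = ≈-trans (⊕-cong ≈-refl (sum#-map x ys))
      (solve 4 (λ x y a b → x :+ y :+ (a :+ b) := x :+ a :+ (y :+ b)) ≈-refl x y (length ys ×ᶠ x) (sum# ys))

    -- Translation by 1 permutes the field, so the sum of all elements equals itself plus `card`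
    -- times 1.
    card×1≈0 : card ×ᶠ 1# ≈ 0#
    card×1≈0 = ⊕-cancelʳ (sum# elems) _ _ (begin
      card ×ᶠ 1# ⊕ sum# elems ≈⟨ sum#-map 1# elems ⟨
      sum# (map (1# ⊕_) elems) ≈⟨ foldr-commMonoid R.+-isCommutativeMonoid (distinct-⊆-length⇒↭
        (map-distinct (⊕-cancelˡ 1# _ _) distinct) (λ {z} _ → complete z)
        (ℕₚ.≤-reflexive (sym (length-map (1# ⊕_) elems)))) ⟨
      sum# elems ≈⟨ ⊕-identityˡ _ ⟨
      0# ⊕ sum# elems ∎)

    p^m×1 : ∀ m → (p ^ m) ×ᶠ 1# ≈ pow (p ×ᶠ 1#) m
    p^m×1 zero = ⊕-identityʳ 1#
    p^m×1 (suc m) = ≈-trans (×1-homo-* p (p ^ m)) (·-cong ≈-refl (p^m×1 m))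

    -- The characteristic is read off the cardinality: a power of p times 1 is `card` times 1, hence
    -- 0, and there are no zero divisors.
    p×1≈0 : p ×ᶠ 1# ≈ 0#
    p×1≈0 with (p ×ᶠ 1#) ≈? 0#
    ... | yes eq = eq
    ... | no neq = ⊥-elim (pow-nonzero (suc r * suc n₁) neq (begin
      pow (p ×ᶠ 1#) (suc r * suc n₁) ≈⟨ p^m×1 (suc r * suc n₁) ⟨
      (p ^ (suc r * suc n₁)) ×ᶠ 1# ≡⟨ cong (_×ᶠ 1#) (sym (trans card≡ (ℕₚ.^-*-assoc p (suc r) (suc n₁)))) ⟩
      card ×ᶠ 1# ≈⟨ card×1≈0 ⟩
      0# ∎))

    ∣⇒×≈0 : ∀ {m} x → p ∣ m → m ×ᶠ x ≈ 0#
    ∣⇒×≈0 x (divides j refl) = begin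
      (j * p) ×ᶠ x ≡⟨ cong (_×ᶠ x) (ℕₚ.*-comm j p) ⟩
      (p * j) ×ᶠ x ≈⟨ ×-assocˡ x p j ⟨
      p ×ᶠ (j ×ᶠ x) ≈⟨ ×-congʳ p (·-identityˡ (j ×ᶠ x)) ⟨
      p ×ᶠ (1# · (j ×ᶠ x)) ≈⟨ ×-assoc-* p 1# (j ×ᶠ x) ⟨
      (p ×ᶠ 1#) · (j ×ᶠ x) ≈⟨ ·-cong p×1≈0 ≈-refl ⟩
      0# · (j ×ᶠ x) ≈⟨ ·-zeroˡ _ ⟩
      0# ∎

    frobenius : ∀ p₁ → p ≡ suc p₁ → ∀ x y → pow (x ⊕ y) p ≈ pow x p ⊕ pow y p
    frobenius p₁ refl x y = begin
      pow (x ⊕ y) p ≡⟨ pow≡^ (x ⊕ y) p ⟩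
      (x ⊕ y) ^ᶠ p ≈⟨ Binomial.theorem R.commutativeSemiring p x y ⟩
      term Fin.zero ⊕ sum (λ i → term (Fin.suc i)) ≈⟨ ⊕-cong first (≈-trans (sum-init-last (λ i → term (Fin.suc i))) (⊕-cong middle last)) ⟩
      pow y p ⊕ (0# ⊕ pow x p) ≈⟨ ⊕-cong ≈-refl (⊕-identityˡ _) ⟩
      pow y p ⊕ pow x p ≈⟨ ⊕-comm _ _ ⟩
      pow x p ⊕ pow y p ∎
      where
      open MonoidSum R.+-monoid using (sum; sum-init-last; sum-cong-≋; sum-replicate-zero)
      term : Fin (suc p) → Carrier
      term = Binomial.binomialTerm R.commutativeSemiring x y p
      first : term Fin.zero ≈ pow y p
      first = ≈-trans (⊕-identityʳ _) (≈-trans (·-identityˡ _) (≈-reflexive (sym (pow≡^ y p))))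
      middle : sum (λ i → term (Fin.suc (inject₁ i))) ≈ 0#
      middle = ≈-trans (sum-cong-≋ (λ i → ∣⇒×≈0 _ (prime∣nCk pp (s≤s z≤n)
          (s≤s (subst (_< p₁) (sym (Finₚ.toℕ-inject₁ i)) (Finₚ.toℕ<n i))))))
        (sum-replicate-zero p₁)
      last : term (Fin.suc (fromℕ p₁)) ≈ pow x p
      last = begin
        (p C suc (toℕ (fromℕ p₁))) ×ᶠ (x ^ᶠ suc (toℕ (fromℕ p₁)) · y ^ᶠ (p₁ ∸ toℕ (fromℕ p₁)))
          ≡⟨ cong (λ m → (p C suc m) ×ᶠ (x ^ᶠ suc m · y ^ᶠ (p₁ ∸ m))) (Finₚ.toℕ-fromℕ p₁) ⟩
        (p C p) ×ᶠ (x ^ᶠ p · y ^ᶠ (p₁ ∸ p₁)) ≡⟨ cong₂ (λ m k → m ×ᶠ (x ^ᶠ p · y ^ᶠ k)) (nCn≡1 p) (ℕₚ.n∸n≡0 p₁) ⟩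
        1 ×ᶠ (x ^ᶠ p · 1#) ≈⟨ ⊕-identityʳ _ ⟩
        x ^ᶠ p · 1# ≈⟨ ·-identityʳ _ ⟩
        x ^ᶠ p ≡⟨ pow≡^ x p ⟨
        pow x p ∎

    prime≡suc : ∀ p′ → Prime p′ → Σ ℕ λ p₁ → p′ ≡ suc p₁
    prime≡suc zero p0 = ⊥-elim (¬prime[0] p0)
    prime≡suc (suc p₁) _ = p₁ , refl

  frobenius-^ : ∀ j x y → pow (x ⊕ y) (p ^ j) ≈ pow x (p ^ j) ⊕ pow y (p ^ j)
  frobenius-^ zero x y = ≈-trans (·-identityʳ _) (⊕-cong (≈-sym (·-identityʳ _)) (≈-sym (·-identityʳ _)))
  frobenius-^ (suc j) x y = begin
    pow (x ⊕ y) (p * p ^ j) ≈⟨ pow-* (x ⊕ y) p (p ^ j) ⟩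
    pow (pow (x ⊕ y) p) (p ^ j) ≈⟨ pow-cong (p ^ j) (frobenius (proj₁ p≡) (proj₂ p≡) x y) ⟩
    pow (pow x p ⊕ pow y p) (p ^ j) ≈⟨ frobenius-^ j (pow x p) (pow y p) ⟩
    pow (pow x p) (p ^ j) ⊕ pow (pow y p) (p ^ j) ≈⟨ ⊕-cong (pow-* x p (p ^ j)) (pow-* y p (p ^ j)) ⟨
    pow x (p * p ^ j) ⊕ pow y (p * p ^ j) ∎
    where
    p≡ = prime≡suc p pp

  pow-q^-+ : ∀ i x y → pow (x ⊕ y) (q ^ i) ≈ pow x (q ^ i) ⊕ pow y (q ^ i)
  pow-q^-+ i x y = subst (λ m → pow (x ⊕ y) m ≈ pow x m ⊕ pow y m) (sym (ℕₚ.^-*-assoc p (suc r) i))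
    (frobenius-^ (suc r * i) x y)

  pow-q-+ : ∀ x y → pow (x ⊕ y) q ≈ pow x q ⊕ pow y q
  pow-q-+ = frobenius-^ (suc r)

  1<p : 1 < p
  1<p = ℕ.nonTrivial⇒n>1 p {{prime⇒nonTrivial pp}}

  1<q : 1 < q
  1<q = ℕₚ.<-≤-trans 1<p (ℕₚ.m≤m*n p (p ^ r) {{ℕₚ.m^n≢0 p r {{prime⇒nonZero pp}}}})

  instance
    q≢0 : NonZero q
    q≢0 = ℕ.>-nonZero (ℕₚ.<-trans (s≤s z≤n) 1<q)

  tr : Carrier → Carrier
  tr = R.Tr q n

  private
    Tr-cong : ∀ i {x y} → x ≈ y → R.Tr q i x ≈ R.Tr q i y
    Tr-cong zero x≈y = ≈-refl
    Tr-cong (suc i) x≈y = ⊕-cong (Tr-cong i x≈y) (pow-cong (q ^ i) x≈y)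

    Tr-+ : ∀ i x y → R.Tr q i (x ⊕ y) ≈ R.Tr q i x ⊕ R.Tr q i y
    Tr-+ zero x y = ≈-sym (⊕-identityˡ 0#)
    Tr-+ (suc i) x y = ≈-trans (⊕-cong (Tr-+ i x y) (pow-q^-+ i x y))
      (solve 4 (λ a b c d → a :+ b :+ (c :+ d) := a :+ c :+ (b :+ d)) ≈-refl _ _ _ _)

  tr-cong : ∀ {x y} → x ≈ y → tr x ≈ tr y
  tr-cong = Tr-cong n

  tr-+ : ∀ x y → tr (x ⊕ y) ≈ tr x ⊕ tr y
  tr-+ = Tr-+ n

  -- Membership in the subfield of `q` elements, as invariance under the q-th power.
  Fixed : Carrier → Set ℓ
  Fixed z = pow z q ≈ z

  fixed-q^ : ∀ {z} → Fixed z → ∀ i → pow z (q ^ i) ≈ z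
  fixed-q^ fz zero = ·-identityʳ _
  fixed-q^ {z} fz (suc i) = ≈-trans (pow-* z q (q ^ i)) (≈-trans (pow-cong (q ^ i) fz) (fixed-q^ fz i))

  private
    Tr-scale : ∀ {z} → Fixed z → ∀ i x → R.Tr q i (z · x) ≈ z · R.Tr q i x
    Tr-scale fz zero x = ≈-sym (·-zeroʳ _)
    Tr-scale {z} fz (suc i) x = ≈-trans (⊕-cong (Tr-scale fz i x)
      (≈-trans (pow-· z x (q ^ i)) (·-cong (fixed-q^ fz i) ≈-refl))) (≈-sym (·-distribˡ z _ _))

  tr-scale : ∀ {z} → Fixed z → ∀ x → tr (z · x) ≈ z · tr x
  tr-scale fz = Tr-scale fz n

  pow-card : ∀ x → pow x (q ^ n) ≈ x
  pow-card x = subst (λ m → pow x m ≈ x) card≡ (subst (λ m → pow x m ≈ x) (sym card≡1+N) frob)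
    where
    frob : pow x (suc N) ≈ x
    frob with x ≈? 0#
    ... | yes x≈0 = ≈-trans (·-cong x≈0 ≈-refl) (≈-trans (·-zeroˡ _) (≈-sym x≈0))
    ... | no x≉0 = ≈-trans (·-cong ≈-refl (pow-N x≉0)) (·-identityʳ x)

  private
    -- The telescoping identity for Tr(x)^q - Tr(x), with `x` moved to the left to avoid
    -- subtraction. For `i = n` the two extreme powers agree, so the trace is fixed.
    Tr-pow-q : ∀ i x → pow (R.Tr q i x) q ⊕ x ≈ R.Tr q i x ⊕ pow x (q ^ i)
    Tr-pow-q zero x = ⊕-cong (pow-0# q) (≈-sym (·-identityʳ x))
    Tr-pow-q (suc i) x = begin
      pow (R.Tr q i x ⊕ pow x (q ^ i)) q ⊕ x ≈⟨ ⊕-cong (pow-q-+ _ _) ≈-refl ⟩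
      (pow (R.Tr q i x) q ⊕ pow (pow x (q ^ i)) q) ⊕ x
        ≈⟨ solve 3 (λ a b c → a :+ b :+ c := a :+ c :+ b) ≈-refl _ _ _ ⟩
      (pow (R.Tr q i x) q ⊕ x) ⊕ pow (pow x (q ^ i)) q ≈⟨ ⊕-cong (Tr-pow-q i x) (≈-sym (pow-*′ x q (q ^ i))) ⟩
      (R.Tr q i x ⊕ pow x (q ^ i)) ⊕ pow x (q * q ^ i) ∎

  tr-fixed : ∀ x → Fixed (tr x)
  tr-fixed x = ⊕-cancelʳ x _ _ (≈-trans (Tr-pow-q n x) (⊕-cong ≈-refl (pow-card x)))

  private
    Tr-degree : ∀ i → Degree< (q ^ i) (R.Tr q i)
    Tr-degree zero = degree-zero 1
    Tr-degree (suc i) = degree-≤ (ℕₚ.^-monoʳ-< q 1<q (ℕₚ.n<1+n i))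
      (degree-+ (degree-≤ (ℕₚ.n≤1+n _) (Tr-degree i)) (monic-degree (monic-pow (q ^ i))))

    monic-respects : ∀ {d f g} → (∀ x → g x ≈ f x) → Monic d f → Monic d g
    monic-respects g≈f (one f≈1) = one (λ x → ≈-trans (g≈f x) (f≈1 x))
    monic-respects g≈f (step a mf f≈) = step a mf (λ x → ≈-trans (g≈f x) (f≈ x))

    tr-monic : Monic (q ^ n₁) tr
    tr-monic = monic-respects (λ x → ⊕-comm _ _) (monic-+ (monic-pow (q ^ n₁)) (Tr-degree n₁))

  -- The trace is a monic polynomial of degree q^(n-1), so it has fewer roots than the field has
  -- elements.
  tr-nontrivial : Σ Carrier λ w → ¬ tr w ≈ 0#
  tr-nontrivial with All.all? (λ x → tr x ≈? 0#) elems
  ... | yes all = ⊥-elim (ℕₚ.<⇒≱ (ℕₚ.^-monoʳ-< q 1<q (ℕₚ.n<1+n n₁))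
          (subst (_≤ q ^ n₁) card≡ (roots≤degree tr-monic distinct all)))
  ... | no ¬all with w , _ , trw≉0 ← Membership.find ≈-setoid (Allₚ.¬All⇒Any¬ (λ x → tr x ≈? 0#) elems ¬all) = w , trw≉0

-- The subfield, and the orthogonality of the dilates of the trace function

module TraceSums {c ℓ : Level} (F : FiniteField c ℓ) (p r n₁ : ℕ) (pp : Prime p)
  (card≡ : FiniteField.card F ≡ (p ^ suc r) ^ suc n₁)
  (Q : ℕ) (Q≡ : Q * (p ^ suc r ∸ 1) ≡ (p ^ suc r) ^ suc n₁ ∸ 1) where

  open Field F
  open SetoidReasoning ≈-setoid
  open FieldSums F
  open Trace F p r n₁ pp card≡

  private
    g = generator

  1+N≡qⁿ : suc N ≡ q ^ n
  1+N≡qⁿ = trans (sym card≡1+N) card≡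

  Q*[q-1]≡N : Q * (q ∸ 1) ≡ N
  Q*[q-1]≡N = trans Q≡ (cong (_∸ 1) (sym 1+N≡qⁿ))

  Q∣N : Q ∣ N
  Q∣N = subst (Q ∣_) Q*[q-1]≡N (m∣m*n (q ∸ 1))

  1+[q-1]≡q : suc (q ∸ 1) ≡ q
  1+[q-1]≡q = ℕₚ.m+[n∸m]≡n {1} (ℕₚ.<⇒≤ 1<q)

  q-1≢0 : NonZero (q ∸ 1)
  q-1≢0 = ℕ.>-nonZero (ℕₚ.m<n⇒0<n∸m 1<q)

  instance
    N≢0 : NonZero N
    N≢0 = ℕ.>-nonZero N-positive

    Q≢0 : NonZero Q
    Q≢0 = ℕ.≢-nonZero λ Q≡0 → ℕₚ.<⇒≱ N-positive (ℕₚ.≤-reflexive (trans (sym Q*[q-1]≡N) (cong (_* (q ∸ 1)) Q≡0)))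

  pow-q : ∀ x → pow x q ≈ x · pow x (q ∸ 1)
  pow-q x = ≈-reflexive (cong (pow x) (sym 1+[q-1]≡q))

  Q∣⇒fixed : ∀ e → Q ∣ e → Fixed (pow g e)
  Q∣⇒fixed e (divides j refl) = ≈-trans (pow-q (pow g e)) (≈-trans (·-cong ≈-refl (begin
    pow (pow g e) (q ∸ 1) ≈⟨ pow-* g e (q ∸ 1) ⟨
    pow g (j * Q * (q ∸ 1)) ≈⟨ pow-multiple (pow-N generator≉0) (divides j (trans (ℕₚ.*-assoc j Q (q ∸ 1)) (cong (j *_) Q*[q-1]≡N))) ⟩
    1# ∎)) (·-identityʳ _))

  -- With `Q∣⇒fixed` this places the nonzero elements of the subfield: the power is fixed exactly if
  -- N = Q (q - 1) divides e (q - 1).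
  fixed⇒Q∣ : ∀ e → Fixed (pow g e) → Q ∣ e
  fixed⇒Q∣ e fix = *-cancelʳ-∣ (q ∸ 1) {{q-1≢0}} (subst (_∣ e * (q ∸ 1)) (sym Q*[q-1]≡N)
    (generator-order (·-cancelˡ (pow-nonzero e generator≉0) (begin
      pow g e · pow g (e * (q ∸ 1)) ≈⟨ ·-cong ≈-refl (pow-* g e (q ∸ 1)) ⟩
      pow g e · pow (pow g e) (q ∸ 1) ≈⟨ pow-q (pow g e) ⟨
      pow (pow g e) q ≈⟨ fix ⟩
      pow g e ≈⟨ ·-identityʳ _ ⟨
      pow g e · 1# ∎))))

  subfield : List Carrier
  subfield = 0# ∷ map (λ j → pow g (Q * j)) (upTo (q ∸ 1))

  length-subfield : length subfield ≡ q
  length-subfield = trans (cong suc (trans (length-map (λ j → pow g (Q * j)) (upTo (q ∸ 1))) (length-upTo (q ∸ 1)))) 1+[q-1]≡q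

  subfield-fixed : All Fixed subfield
  subfield-fixed = pow-0# q ∷ Allₚ.map⁺ (All.universal (λ j → Q∣⇒fixed (Q * j) (m∣m*n j)) (upTo (q ∸ 1)))

  subfield-distinct : Distinct subfield
  subfield-distinct =
    Allₚ.map⁺ (All.universal (λ j 0≈ → pow-nonzero (Q * j) generator≉0 (≈-sym 0≈)) (upTo (q ∸ 1)))
    ∷ AllPairsₚ.map⁺ (AllPairsₚ.applyUpTo⁺₁ id (q ∸ 1) λ {i} {j} i<j j<q-1 eq →
      ℕₚ.<⇒≱ (subst (Q * j ∸ Q * i <_) Q*[q-1]≡N (ℕₚ.≤-<-trans (ℕₚ.m∸n≤m (Q * j) (Q * i)) (ℕₚ.*-monoʳ-< Q j<q-1)))
        (∣⇒≤ {{ℕ.>-nonZero (ℕₚ.m<n⇒0<n∸m (ℕₚ.*-monoʳ-< Q i<j))}}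
          (pow-generator-injective-≤ (ℕₚ.*-monoʳ-≤ Q (ℕₚ.<⇒≤ i<j)) eq)))

  subfield-complete : ∀ {z} → Fixed z → z ∈ᶠ subfield
  subfield-complete {z} fz with z ≈? 0#
  ... | yes z≈0 = here z≈0
  ... | no z≉0 with discrete-log z≉0
  ...   | a , a<N , z≈gᵃ with fixed⇒Q∣ a (≈-trans (pow-cong q (≈-sym z≈gᵃ)) (≈-trans fz z≈gᵃ))
  ...     | divides j refl = there (Membershipₚ.∈-resp-≈ ≈-setoid
    (≈-sym (≈-trans z≈gᵃ (≈-reflexive (cong (pow g) (ℕₚ.*-comm j Q)))))
    (Membershipₚ.∈-map⁺ (setoid ℕ) ≈-setoid (λ {x} {y} x≡y → ≈-reflexive (cong (λ j → pow g (Q * j)) x≡y))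
      (∈ₚ.∈-upTo⁺ (ℕₚ.*-cancelʳ-< Q j (q ∸ 1) (subst (j * Q <_) (trans (sym Q*[q-1]≡N) (ℕₚ.*-comm Q (q ∸ 1))) a<N)))))

  -- In the language of characters this is the sum of ψ(c Tr x) over the nonzero `c` of the
  -- subfield, for a nontrivial additive character ψ of the subfield.
  t : Carrier → ℤ
  t x = + q *ᶻ ⟦ tr x ≈? 0# ⟧ -ᶻ 1ℤ

  t-cong′ : ∀ {x y} → (tr x ≈ 0# → tr y ≈ 0#) → (tr y ≈ 0# → tr x ≈ 0#) → t x ≡ t y
  t-cong′ {x} {y} x⇒y y⇒x = cong (λ i → + q *ᶻ i -ᶻ 1ℤ) (⟦⟧-cong (tr x ≈? 0#) (tr y ≈? 0#) x⇒y y⇒x)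

  t-cong : Respects≈ t
  t-cong x≈y = t-cong′ (≈-trans (tr-cong (≈-sym x≈y))) (≈-trans (tr-cong x≈y))

  t-scale : ∀ {z} → Fixed z → ¬ z ≈ 0# → ∀ x → t (z · x) ≡ t x
  t-scale {z} fz z≉0 x = t-cong′
    (λ zx≈0 → ·-cancelˡ z≉0 (≈-trans (≈-sym (tr-scale fz x)) (≈-trans zx≈0 (≈-sym (·-zeroʳ z)))))
    (λ x≈0 → ≈-trans (tr-scale fz x) (≈-trans (·-cong ≈-refl x≈0) (·-zeroʳ z)))

  -- The trace is affine along the line with nonzero slope `tr w`, so it vanishes at exactly one of
  -- the q points, and the sum is q - q.
  t-line : ∀ {w} → ¬ tr w ≈ 0# → ∀ x → ∑ subfield (λ z → t (x ⊕ z · w)) ≡ 0ℤ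
  t-line {w} trw≉0 x = trans (∑-cong-All subfield-fixed pointwise)
    (trans (∑-- subfield (λ z → + q *ᶻ ⟦ z ≈? z₀ ⟧) (λ _ → 1ℤ))
      (trans (cong₂ _-ᶻ_
        (trans (∑-*ˡ subfield (+ q) (λ z → ⟦ z ≈? z₀ ⟧))
          (cong (+ q *ᶻ_) (∑-delta z₀ subfield-distinct (subfield-complete z₀-fixed))))
        (trans (∑-const subfield 1ℤ) (cong (λ m → + m *ᶻ 1ℤ) length-subfield)))
        (ℤₚ.+-inverseʳ (+ q *ᶻ 1ℤ))))
    where
    ι = proj₁ (inverse (tr w) trw≉0)
    -- The zero of z ↦ tr x + z tr w. It has to be shown to lie in the subfield, since only such `z`
    -- are summed.
    z₀ = ⊖ (tr x) · ι
    z₀-trw : z₀ · tr w ≈ ⊖ (tr x)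
    z₀-trw = begin
      ⊖ (tr x) · ι · tr w ≈⟨ ·-assoc _ _ _ ⟩
      ⊖ (tr x) · (ι · tr w) ≈⟨ ·-cong ≈-refl (≈-trans (·-comm _ _) (proj₂ (inverse (tr w) trw≉0))) ⟩
      ⊖ (tr x) · 1# ≈⟨ ·-identityʳ _ ⟩
      ⊖ (tr x) ∎
    ⊖-fixed : Fixed (⊖ (tr x))
    ⊖-fixed = ⊕-cancelʳ (tr x) _ _ (begin
      pow (⊖ (tr x)) q ⊕ tr x ≈⟨ ⊕-cong ≈-refl (tr-fixed x) ⟨
      pow (⊖ (tr x)) q ⊕ pow (tr x) q ≈⟨ pow-q-+ (⊖ (tr x)) (tr x) ⟨
      pow (⊖ (tr x) ⊕ tr x) q ≈⟨ pow-cong q (⊖-inverseˡ (tr x)) ⟩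
      pow 0# q ≈⟨ pow-0# q ⟩
      0# ≈⟨ ⊖-inverseˡ (tr x) ⟨
      ⊖ (tr x) ⊕ tr x ∎)
    z₀-fixed : Fixed z₀
    z₀-fixed = ·-cancelʳ trw≉0 (begin
      pow z₀ q · tr w ≈⟨ ·-cong ≈-refl (tr-fixed w) ⟨
      pow z₀ q · pow (tr w) q ≈⟨ pow-· z₀ (tr w) q ⟨
      pow (z₀ · tr w) q ≈⟨ pow-cong q z₀-trw ⟩
      pow (⊖ (tr x)) q ≈⟨ ⊖-fixed ⟩
      ⊖ (tr x) ≈⟨ z₀-trw ⟨
      z₀ · tr w ∎)
    tr-line : ∀ z → Fixed z → tr (x ⊕ z · w) ≈ tr x ⊕ z · tr w
    tr-line z fz = ≈-trans (tr-+ x (z · w)) (⊕-cong ≈-refl (tr-scale fz w))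
    pointwise : ∀ z → Fixed z → t (x ⊕ z · w) ≡ + q *ᶻ ⟦ z ≈? z₀ ⟧ -ᶻ 1ℤ
    pointwise z fz = cong (λ i → + q *ᶻ i -ᶻ 1ℤ) (⟦⟧-cong (tr (x ⊕ z · w) ≈? 0#) (z ≈? z₀)
      (λ eq → ·-cancelʳ trw≉0 (⊕-cancelˡ (tr x) _ _ (begin
        tr x ⊕ z · tr w ≈⟨ tr-line z fz ⟨
        tr (x ⊕ z · w) ≈⟨ eq ⟩
        0# ≈⟨ ⊖-inverseʳ (tr x) ⟨
        tr x ⊕ ⊖ (tr x) ≈⟨ ⊕-cong ≈-refl z₀-trw ⟨
        tr x ⊕ z₀ · tr w ∎)))
      (λ z≈z₀ → begin
        tr (x ⊕ z · w) ≈⟨ tr-line z fz ⟩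
        tr x ⊕ z · tr w ≈⟨ ⊕-cong ≈-refl (≈-trans (·-cong z≈z₀ ≈-refl) z₀-trw) ⟩
        tr x ⊕ ⊖ (tr x) ≈⟨ ⊖-inverseʳ (tr x) ⟩
        0# ∎))

  -- Each translate of `G` by a multiple of `w` has the same sum over the field, so q times the sum
  -- is a sum over the lines in direction `w`.
  average-zero : ∀ {G} → Respects≈ G → ∀ w → (∀ x → ∑ subfield (λ z → G (x ⊕ z · w)) ≡ 0ℤ) → ∑ elems G ≡ 0ℤ
  average-zero {G} resp w line = ℤₚ.*-cancelˡ-≡ (+ q) (∑ elems G) 0ℤ (trans q*sum (sym (ℤₚ.*-zeroʳ (+ q))))
    where
    q*sum : + q *ᶻ ∑ elems G ≡ 0ℤ
    q*sum = trans (cong (λ m → + m *ᶻ ∑ elems G) (sym length-subfield))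
      (trans (sym (∑-const subfield (∑ elems G)))
        (trans (∑-cong subfield (λ z → sym (∑-injection resp (_⊕ z · w) (⊕-cancelʳ (z · w) _ _))))
          (trans (∑-swap subfield elems (λ z x → G (x ⊕ z · w))) (∑-zero elems line))))

  ∑-t : ∑ elems t ≡ 0ℤ
  ∑-t = average-zero t-cong (proj₁ tr-nontrivial) (t-line (proj₂ tr-nontrivial))

  -- `t` takes only the values q - 1 and -1, the roots of X² - (q - 2) X - (q - 1); the linear term
  -- has sum zero.
  ∑-t² : ∑ elems (λ x → t x *ᶻ t x) ≡ + (q ^ n) *ᶻ (+ q -ᶻ 1ℤ)
  ∑-t² = trans (∑-cong elems pointwise)
    (trans (∑-+ elems (λ x → (+ q -ᶻ + 2) *ᶻ t x) (λ _ → + q -ᶻ 1ℤ))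
      (trans (cong₂ _+ᶻ_ (trans (∑-*ˡ elems (+ q -ᶻ + 2) t) (trans (cong ((+ q -ᶻ + 2) *ᶻ_) ∑-t) (ℤₚ.*-zeroʳ (+ q -ᶻ + 2))))
        (trans (∑-const elems (+ q -ᶻ 1ℤ)) (cong (λ m → + m *ᶻ (+ q -ᶻ 1ℤ)) card≡)))
        (ℤₚ.+-identityˡ _)))
    where
    e : ∀ q i → (q *ᶻ i -ᶻ 1ℤ) *ᶻ (q *ᶻ i -ᶻ 1ℤ)
      ≡ (q -ᶻ + 2) *ᶻ (q *ᶻ i -ᶻ 1ℤ) +ᶻ (q -ᶻ 1ℤ) +ᶻ q *ᶻ q *ᶻ (i *ᶻ i -ᶻ i)
    e = solve-∀
    idempotent : ∀ {a} {A : Set a} (A? : Dec A) → ⟦ A? ⟧ *ᶻ ⟦ A? ⟧ -ᶻ ⟦ A? ⟧ ≡ 0ℤ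
    idempotent (yes _) = refl
    idempotent (no _) = refl
    pointwise : ∀ x → t x *ᶻ t x ≡ (+ q -ᶻ + 2) *ᶻ t x +ᶻ (+ q -ᶻ 1ℤ)
    pointwise x = trans (e (+ q) i)
      (trans (cong (λ z → (+ q -ᶻ + 2) *ᶻ t x +ᶻ (+ q -ᶻ 1ℤ) +ᶻ + q *ᶻ + q *ᶻ z) (idempotent (tr x ≈? 0#)))
        (trans (cong ((+ q -ᶻ + 2) *ᶻ t x +ᶻ (+ q -ᶻ 1ℤ) +ᶻ_) (ℤₚ.*-zeroʳ (+ q *ᶻ + q))) (ℤₚ.+-identityʳ _)))
      where
      i = ⟦ tr x ≈? 0# ⟧

  -- Otherwise the kernel of x ↦ tr x would lie in the kernel of x ↦ tr (x s), making the two proportional.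
  separate : ∀ {s} → ¬ Fixed s → Σ Carrier λ w → tr w ≈ 0# × ¬ tr (w · s) ≈ 0#
  separate {s} ¬fs with Any.any? (λ w → (tr w ≈? 0#) ×-dec ¬? (tr (w · s) ≈? 0#)) elems
  ... | yes any = let w , _ , trw≈0 , trws≉0 = Membership.find ≈-setoid any in w , trw≈0 , trws≉0
  ... | no ¬any = ⊥-elim (trw₀≉0 (begin
    tr w₀ ≈⟨ tr-cong w₀≈ ⟩
    tr (x · u) ≈⟨ tr-xu ⟩
    0# ∎))
    where
    w₀ = proj₁ tr-nontrivial
    trw₀≉0 = proj₂ tr-nontrivial
    ι = proj₁ (inverse (tr w₀) trw₀≉0)
    ι-inverse : ι · tr w₀ ≈ 1#
    ι-inverse = ≈-trans (·-comm _ _) (proj₂ (inverse (tr w₀) trw₀≉0))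
    kernel : ∀ w → tr w ≈ 0# → tr (w · s) ≈ 0#
    kernel w trw≈0 with tr (w · s) ≈? 0#
    ... | yes eq = eq
    ... | no neq = ⊥-elim (¬any (Any.map (λ w≈y → ≈-trans (tr-cong (≈-sym w≈y)) trw≈0 ,
                     λ eq → neq (≈-trans (tr-cong (·-cong w≈y ≈-refl)) eq)) (complete w)))
    ι-fixed : Fixed ι
    ι-fixed = ·-cancelʳ trw₀≉0 (begin
      pow ι q · tr w₀ ≈⟨ ·-cong ≈-refl (tr-fixed w₀) ⟨
      pow ι q · pow (tr w₀) q ≈⟨ pow-· ι (tr w₀) q ⟨
      pow (ι · tr w₀) q ≈⟨ pow-cong q ι-inverse ⟩
      pow 1# q ≈⟨ pow-1# q ⟩
      1# ≈⟨ ι-inverse ⟨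
      ι · tr w₀ ∎)
    fixed-· : ∀ {x y} → Fixed x → Fixed y → Fixed (x · y)
    fixed-· {x} {y} fx fy = ≈-trans (pow-· x y q) (·-cong fx fy)
    -- The only possible ratio of tr (w s) to tr w, read off at `w₀`. It lies in the subfield while
    -- `s` does not, hence `u` = s - λ₀ is invertible.
    λ₀ = tr (w₀ · s) · ι
    λ₀-fixed : Fixed λ₀
    λ₀-fixed = fixed-· (tr-fixed (w₀ · s)) ι-fixed
    u = s ⊕ ⊖ λ₀
    u+λ₀ : u ⊕ λ₀ ≈ s
    u+λ₀ = ≈-trans (⊕-assoc _ _ _) (≈-trans (⊕-cong ≈-refl (⊖-inverseˡ λ₀)) (⊕-identityʳ s))
    u≉0 : ¬ u ≈ 0#
    u≉0 u≈0 = ¬fs (≈-trans (pow-cong q s≈λ₀) (≈-trans λ₀-fixed (≈-sym s≈λ₀)))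
      where
      s≈λ₀ : s ≈ λ₀
      s≈λ₀ = ≈-trans (≈-sym u+λ₀) (≈-trans (⊕-cong u≈0 ≈-refl) (⊕-identityˡ λ₀))
    -- Chosen so that tr (x u) is the nonzero `tr w₀`, whereas proportionality of the two
    -- functionals makes tr (x u) vanish.
    x = w₀ · proj₁ (inverse u u≉0)
    w₀≈ : w₀ ≈ x · u
    w₀≈ = ≈-sym (≈-trans (·-assoc _ _ _) (≈-trans (·-cong ≈-refl (≈-trans (·-comm _ _) (proj₂ (inverse u u≉0)))) (·-identityʳ w₀)))
    -- The component of `x` along `w₀`: subtracting it leaves `v` in the kernel of the trace, where
    -- the assumption applies.
    κ = tr x · ι
    κ-fixed : Fixed κ
    κ-fixed = fixed-· (tr-fixed x) ι-fixed
    v = x ⊕ ⊖ (κ · w₀)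
    v+κw₀ : v ⊕ κ · w₀ ≈ x
    v+κw₀ = ≈-trans (⊕-assoc _ _ _) (≈-trans (⊕-cong ≈-refl (⊖-inverseˡ (κ · w₀))) (⊕-identityʳ x))
    trv≈0 : tr v ≈ 0#
    trv≈0 = ⊕-cancelʳ (tr x) _ _ (begin
      tr v ⊕ tr x ≈⟨ ⊕-cong ≈-refl (≈-trans (·-assoc _ _ _) (≈-trans (·-cong ≈-refl ι-inverse) (·-identityʳ _))) ⟨
      tr v ⊕ κ · tr w₀ ≈⟨ ⊕-cong ≈-refl (tr-scale κ-fixed w₀) ⟨
      tr v ⊕ tr (κ · w₀) ≈⟨ tr-+ v (κ · w₀) ⟨
      tr (v ⊕ κ · w₀) ≈⟨ tr-cong v+κw₀ ⟩
      tr x ≈⟨ ⊕-identityˡ _ ⟨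
      0# ⊕ tr x ∎)
    tr-xs : tr (x · s) ≈ λ₀ · tr x
    tr-xs = begin
      tr (x · s) ≈⟨ tr-cong (·-cong v+κw₀ ≈-refl) ⟨
      tr ((v ⊕ κ · w₀) · s) ≈⟨ tr-cong (≈-trans (·-distribʳ s v (κ · w₀)) (⊕-cong ≈-refl (·-assoc κ w₀ s))) ⟩
      tr (v · s ⊕ κ · (w₀ · s)) ≈⟨ tr-+ (v · s) (κ · (w₀ · s)) ⟩
      tr (v · s) ⊕ tr (κ · (w₀ · s)) ≈⟨ ⊕-cong (kernel v trv≈0) (tr-scale κ-fixed (w₀ · s)) ⟩
      0# ⊕ κ · tr (w₀ · s) ≈⟨ ⊕-identityˡ _ ⟩
      tr x · ι · tr (w₀ · s) ≈⟨ solve 3 (λ a b c → a :* b :* c := c :* b :* a) ≈-refl (tr x) ι (tr (w₀ · s)) ⟩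
      λ₀ · tr x ∎
    tr-xu : tr (x · u) ≈ 0#
    tr-xu = ⊕-cancelʳ (λ₀ · tr x) _ _ (begin
      tr (x · u) ⊕ λ₀ · tr x ≈⟨ ⊕-cong ≈-refl (tr-scale λ₀-fixed x) ⟨
      tr (x · u) ⊕ tr (λ₀ · x) ≈⟨ tr-+ (x · u) (λ₀ · x) ⟨
      tr (x · u ⊕ λ₀ · x) ≈⟨ tr-cong (≈-trans (⊕-cong ≈-refl (·-comm λ₀ x)) (≈-sym (·-distribˡ x u λ₀))) ⟩
      tr (x · (u ⊕ λ₀)) ≈⟨ tr-cong (·-cong ≈-refl u+λ₀) ⟩
      tr (x · s) ≈⟨ tr-xs ⟩
      λ₀ · tr x ≈⟨ ⊕-identityˡ _ ⟨
      0# ⊕ λ₀ · tr x ∎)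

  correlation : ℕ → ℤ
  correlation e = ∑ elems (λ x → t x *ᶻ t (x · pow g e))

  -- If Q ∣ e, the dilation is by a subfield element and leaves `t` unchanged. Otherwise the `w`
  -- from `separate` gives lines on which the first factor is constant and the second sums to zero.
  correlation-value : ∀ e → correlation e ≡ + (q ^ n) *ᶻ (+ q -ᶻ 1ℤ) *ᶻ ⟦ Q ∣? e ⟧
  correlation-value e with Q ∣? e
  ... | yes Q∣e = trans
    (∑-cong elems (λ x → cong (t x *ᶻ_) (trans (t-cong (·-comm x (pow g e)))
      (t-scale (Q∣⇒fixed e Q∣e) (pow-nonzero e generator≉0) x))))
    (trans ∑-t² (sym (ℤₚ.*-identityʳ _)))
  ... | no Q∤e with separate (λ fix → Q∤e (fixed⇒Q∣ e fix))
  ...   | w , trw≈0 , trws≉0 = trans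
    (average-zero (λ x≈y → cong₂ _*ᶻ_ (t-cong x≈y) (t-cong (·-cong x≈y ≈-refl))) w line)
    (sym (ℤₚ.*-zeroʳ (+ (q ^ n) *ᶻ (+ q -ᶻ 1ℤ))))
    where
    s = pow g e
    line : ∀ x → ∑ subfield (λ z → t (x ⊕ z · w) *ᶻ t ((x ⊕ z · w) · s)) ≡ 0ℤ
    line x = trans
      (∑-cong-All subfield-fixed (λ z fz → cong₂ _*ᶻ_
        (t-cong′ (≈-trans (≈-sym (tr-line z fz))) (≈-trans (tr-line z fz)))
        (t-cong (≈-trans (·-distribʳ s x (z · w)) (⊕-cong ≈-refl (·-assoc z w s))))))
      (trans (∑-*ˡ subfield (t x) (λ z → t (x · s ⊕ z · (w · s))))
        (trans (cong (t x *ᶻ_) (t-line trws≉0 (x · s))) (ℤₚ.*-zeroʳ (t x))))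
      where
      tr-line : ∀ z → Fixed z → tr (x ⊕ z · w) ≈ tr x
      tr-line z fz = begin
        tr (x ⊕ z · w) ≈⟨ tr-+ x (z · w) ⟩
        tr x ⊕ tr (z · w) ≈⟨ ⊕-cong ≈-refl (≈-trans (tr-scale fz w) (≈-trans (·-cong ≈-refl trw≈0) (·-zeroʳ z))) ⟩
        tr x ⊕ 0# ≈⟨ ⊕-identityʳ _ ⟩
        tr x ∎

-- The operator bound for the matrix T (a + b)

module Operator {c ℓ : Level} (F : FiniteField c ℓ) (p r n₁ : ℕ) (pp : Prime p)
  (card≡ : FiniteField.card F ≡ (p ^ suc r) ^ suc n₁)
  (Q : ℕ) (Q≡ : Q * (p ^ suc r ∸ 1) ≡ (p ^ suc r) ^ suc n₁ ∸ 1) where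
  open Field F
  open FieldSums F
  open Trace F p r n₁ pp card≡
  open TraceSums F p r n₁ pp card≡ Q Q≡
  private
    g = generator

  T : ℕ → ℤ
  T a = t (pow g (a * 2))

  T-periodic : Periodic N T
  T-periodic a = trans (cong (λ e → t (pow g e)) (e N a)) (periodic-multiple {N} {λ e → t (pow g e)} (pow-generator-periodic {t} t-cong) 2 (a * 2))
    where
    e : ∀ N a → (N + a) * 2 ≡ 2 * N + a * 2
    e = ℕ-Solver.solve-∀

  1+[N-1]≡N : suc (N ∸ 1) ≡ N
  1+[N-1]≡N = ℕₚ.m+[n∸m]≡n {1} N-positive

  -- The substitution of g^(-x) z for z; the inverse power is written with the exponent (N - 1) x.
  correlation-shift : ∀ x y → ∑ elems (λ z → t (pow g x · z) *ᶻ t (pow g y · z)) ≡ correlation (y + (N ∸ 1) * x)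
  correlation-shift x y = trans
    (sym (∑-injection {λ z → t (pow g x · z) *ᶻ t (pow g y · z)} (λ z≈z′ → cong₂ _*ᶻ_ (t-cong (·-cong ≈-refl z≈z′)) (t-cong (·-cong ≈-refl z≈z′)))
      (s ·_) (·-cancelˡ (pow-nonzero ((N ∸ 1) * x) generator≉0))))
    (∑-cong elems (λ z → cong₂ _*ᶻ_ (t-cong (first z)) (t-cong (second z))))
    where
    s = pow g ((N ∸ 1) * x)
    gˣs≈1 : pow g x · s ≈ 1#
    gˣs≈1 = ≈-trans (≈-sym (pow-+ g x ((N ∸ 1) * x)))
      (pow-multiple (pow-N generator≉0) (divides x (trans (cong (_* x) 1+[N-1]≡N) (ℕₚ.*-comm N x))))
    first : ∀ z → pow g x · (s · z) ≈ z
    first z = ≈-trans (≈-sym (·-assoc _ _ _)) (≈-trans (·-cong gˣs≈1 ≈-refl) (·-identityˡ z))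
    second : ∀ z → pow g y · (s · z) ≈ z · pow g (y + (N ∸ 1) * x)
    second z = ≈-trans (≈-sym (·-assoc _ _ _)) (≈-trans (·-comm _ z) (·-cong ≈-refl (≈-sym (pow-+ g y ((N ∸ 1) * x)))))

  private
    I : ℕ → ℤ
    I e = ⟦ Q ∣? e ⟧

    I-periodic : Periodic N I
    I-periodic = periodic-∣ Q∣N (⟦∣⟧-periodic Q)

    ∑-I : ∑< N I ≡ + (q ∸ 1)
    ∑-I = begin
      ∑< N I ≡⟨ cong (λ m → ∑< m I) (trans (sym Q*[q-1]≡N) (ℕₚ.*-comm Q (q ∸ 1))) ⟩
      ∑< ((q ∸ 1) * Q) I ≡⟨ ∑<-periods (⟦∣⟧-periodic Q) (q ∸ 1) ⟩
      + (q ∸ 1) *ᶻ ∑< Q I ≡⟨ cong (+ (q ∸ 1) *ᶻ_) (∑<-count-∣ Q) ⟩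
      + (q ∸ 1) *ᶻ 1ℤ ≡⟨ ℤₚ.*-identityʳ _ ⟩
      + (q ∸ 1) ∎
      where open ≡-Reasoning

    row-bound : ∀ s → ∑< N (λ a → I (a * 2 + s)) ≤ᶻ + 2 *ᶻ + (q ∸ 1)
    row-bound s = subst (λ z → ∑< N (λ a → I (a * 2 + s)) ≤ᶻ + 2 *ᶻ z)
      (trans (∑-cong (upTo N) (λ e → cong I (ℕₚ.+-comm e s))) (trans (∑<-shift I-periodic s) ∑-I))
      (∑<-even (λ e → trans (cong I (ℕₚ.+-assoc N e s)) (I-periodic (e + s))) (λ e → ⟦⟧-nonneg (Q ∣? (e + s))))

    column-bound : ∀ s → ∑< N (λ a → I (s + (N ∸ 1) * (a * 2))) ≤ᶻ + 2 *ᶻ + (q ∸ 1)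
    column-bound s = subst (λ z → ∑< N (λ a → I (s + (N ∸ 1) * (a * 2))) ≤ᶻ + 2 *ᶻ z)
      (trans (∑<-stretch N (N ∸ 1) I s I-periodic (subst (Coprime (N ∸ 1)) 1+[N-1]≡N (coprime-pred (N ∸ 1)))) ∑-I)
      (∑<-even (periodic-affine I-periodic s (N ∸ 1)) (λ e → ⟦⟧-nonneg (Q ∣? (s + (N ∸ 1) * e))))

    -- The Schur test: 2 u_a u_b ≤ u_a² + u_b², after which only row and column sums of the 0-1
    -- matrix matter. Each is at most 2 (q - 1), there being q - 1 multiples of Q modulo N and
    -- doubling being at most two-to-one.
    quadratic-bound : ∀ (u : ℕ → ℤ) → ∑< N (λ a → ∑< N (λ b → u a *ᶻ u b *ᶻ I (b * 2 + (N ∸ 1) * (a * 2))))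
      ≤ᶻ + 2 *ᶻ + (q ∸ 1) *ᶻ ∑< N (λ a → u a *ᶻ u a)
    quadratic-bound u = ℤₚ.*-cancelˡ-≤-pos X (R′ *ᶻ U) (+ 2) (begin
      + 2 *ᶻ X ≡⟨ trans (sym (∑-*ˡ (upTo N) (+ 2) _)) (∑-cong (upTo N) (λ a → sym (∑-*ˡ (upTo N) (+ 2) _))) ⟩
      ∑< N (λ a → ∑< N (λ b → + 2 *ᶻ (u a *ᶻ u b *ᶻ j a b)))
        ≤⟨ ∑-mono (upTo N) (λ a → ∑-mono (upTo N) (λ b → am-gm a b)) ⟩
      ∑< N (λ a → ∑< N (λ b → u a *ᶻ u a *ᶻ j a b +ᶻ u b *ᶻ u b *ᶻ j a b))
        ≡⟨ trans (∑-cong (upTo N) (λ a → ∑-+ (upTo N) _ _)) (∑-+ (upTo N) _ _) ⟩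
      ∑< N (λ a → ∑< N (λ b → u a *ᶻ u a *ᶻ j a b)) +ᶻ ∑< N (λ a → ∑< N (λ b → u b *ᶻ u b *ᶻ j a b))
        ≡⟨ cong (∑< N (λ a → ∑< N (λ b → u a *ᶻ u a *ᶻ j a b)) +ᶻ_) (∑-swap (upTo N) (upTo N) _) ⟩
      ∑< N (λ a → ∑< N (λ b → u a *ᶻ u a *ᶻ j a b)) +ᶻ ∑< N (λ b → ∑< N (λ a → u b *ᶻ u b *ᶻ j a b))
        ≤⟨ ℤₚ.+-mono-≤
             (∑-mono (upTo N) (λ a → factored a (j a) (row-bound ((N ∸ 1) * (a * 2)))))
             (∑-mono (upTo N) (λ b → factored b (λ a → j a b) (column-bound (b * 2)))) ⟩
      ∑< N (λ a → R′ *ᶻ (u a *ᶻ u a)) +ᶻ ∑< N (λ a → R′ *ᶻ (u a *ᶻ u a))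
        ≡⟨ cong₂ _+ᶻ_ (∑-*ˡ (upTo N) R′ _) (∑-*ˡ (upTo N) R′ _) ⟩
      R′ *ᶻ U +ᶻ R′ *ᶻ U ≡⟨ double (R′ *ᶻ U) ⟩
      + 2 *ᶻ (R′ *ᶻ U) ∎)
      where
      open ℤₚ.≤-Reasoning
      j : ℕ → ℕ → ℤ
      j a b = I (b * 2 + (N ∸ 1) * (a * 2))
      X = ∑< N (λ a → ∑< N (λ b → u a *ᶻ u b *ᶻ j a b))
      R′ = + 2 *ᶻ + (q ∸ 1)
      U = ∑< N (λ a → u a *ᶻ u a)
      double : ∀ x → x +ᶻ x ≡ + 2 *ᶻ x
      double = solve-∀
      e : ∀ x y i → + 2 *ᶻ (x *ᶻ y *ᶻ i) +ᶻ i *ᶻ ((x -ᶻ y) *ᶻ (x -ᶻ y)) ≡ x *ᶻ x *ᶻ i +ᶻ y *ᶻ y *ᶻ i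
      e = solve-∀
      am-gm : ∀ a b → + 2 *ᶻ (u a *ᶻ u b *ᶻ j a b) ≤ᶻ u a *ᶻ u a *ᶻ j a b +ᶻ u b *ᶻ u b *ᶻ j a b
      am-gm a b = subst₂ _≤ᶻ_ (ℤₚ.+-identityʳ _) (e (u a) (u b) (j a b))
        (ℤₚ.+-monoʳ-≤ (+ 2 *ᶻ (u a *ᶻ u b *ᶻ j a b))
          (*ᶻ-nonneg (⟦⟧-nonneg (Q ∣? (b * 2 + (N ∸ 1) * (a * 2)))) (square-nonneg (u a -ᶻ u b))))
      factored : ∀ a (f : ℕ → ℤ) → ∑< N f ≤ᶻ R′ → ∑< N (λ b → u a *ᶻ u a *ᶻ f b) ≤ᶻ R′ *ᶻ (u a *ᶻ u a)
      factored a f bound = subst₂ _≤ᶻ_ (sym (∑-*ˡ (upTo N) (u a *ᶻ u a) f)) (ℤₚ.*-comm (u a *ᶻ u a) R′)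
        (*ᶻ-monoˡ (square-nonneg (u a)) bound)

  Λ² : ℤ
  Λ² = + 4 *ᶻ (+ (q ∸ 1) *ᶻ + (q ∸ 1)) *ᶻ + (q ^ n)

  -- The exponents 2 b are first extended to all exponents, at the cost of a factor 2, and then to
  -- the whole field. There `correlation-value` turns the sum of squares into qⁿ (q - 1) times the
  -- form in `quadratic-bound`, which supplies the remaining 2 (q - 1).
  operator-bound : ∀ (u : ℕ → ℤ) →
    ∑< N (λ b → ∑< N (λ a → u a *ᶻ T (a + b)) *ᶻ ∑< N (λ a → u a *ᶻ T (a + b))) ≤ᶻ Λ² *ᶻ ∑< N (λ a → u a *ᶻ u a)
  operator-bound u = begin
    ∑< N (λ b → ∑< N (λ a → u a *ᶻ T (a + b)) *ᶻ ∑< N (λ a → u a *ᶻ T (a + b)))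
      ≡⟨ ∑-cong (upTo N) (λ b → cong (λ z → z *ᶻ z) (∑-cong (upTo N) (λ a →
           cong (λ e → u a *ᶻ t (pow g e)) (ℕₚ.*-distribʳ-+ 2 a b)))) ⟩
    ∑< N (λ b → V′ (b * 2) *ᶻ V′ (b * 2))
      ≤⟨ ∑<-even {N} {λ e → V′ e *ᶻ V′ e} (periodic-* V-periodic V-periodic) (λ e → square-nonneg (V′ e)) ⟩
    + 2 *ᶻ ∑< N (λ e → V′ e *ᶻ V′ e) ≤⟨ *ᶻ-monoˡ {+ 2} (ℤ.+≤+ z≤n) sum-bound ⟩
    + 2 *ᶻ (M *ᶻ (+ 2 *ᶻ + (q ∸ 1) *ᶻ U)) ≡⟨ e (+ (q ∸ 1)) (+ (q ^ n)) U ⟩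
    Λ² *ᶻ U ∎
    where
    open ℤₚ.≤-Reasoning
    U = ∑< N (λ a → u a *ᶻ u a)
    M = + (q ^ n) *ᶻ + (q ∸ 1)
    M≡ : + (q ^ n) *ᶻ (+ q -ᶻ 1ℤ) ≡ M
    M≡ = cong (λ z → + (q ^ n) *ᶻ (z -ᶻ 1ℤ)) (cong +_ (sym 1+[q-1]≡q))
    e : ∀ m z U → + 2 *ᶻ (z *ᶻ m *ᶻ (+ 2 *ᶻ m *ᶻ U)) ≡ + 4 *ᶻ (m *ᶻ m) *ᶻ z *ᶻ U
    e = solve-∀
    V′ : ℕ → ℤ
    V′ e = ∑< N (λ a → u a *ᶻ t (pow g (a * 2 + e)))
    V-periodic : Periodic N V′
    V-periodic e = ∑-cong (upTo N) (λ a → cong (u a *ᶻ_) (trans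
      (cong (λ i → t (pow g i)) (e′ a N e)) (pow-generator-periodic {t} t-cong (a * 2 + e))))
      where
      e′ : ∀ a N e → a * 2 + (N + e) ≡ N + (a * 2 + e)
      e′ = ℕ-Solver.solve-∀
    W′ : Carrier → ℤ
    W′ x = ∑< N (λ a → u a *ᶻ t (pow g (a * 2) · x))
    W-cong : Respects≈ W′
    W-cong x≈y = ∑-cong (upTo N) (λ a → cong (u a *ᶻ_) (t-cong (·-cong ≈-refl x≈y)))
    rearrange : ∀ x y a b → x *ᶻ a *ᶻ (y *ᶻ b) ≡ x *ᶻ y *ᶻ (a *ᶻ b)
    rearrange = solve-∀
    pull : ∀ x y M j → x *ᶻ y *ᶻ (M *ᶻ j) ≡ M *ᶻ (x *ᶻ y *ᶻ j)
    pull = solve-∀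
    expand : ∑ elems (λ x → W′ x *ᶻ W′ x)
      ≡ M *ᶻ ∑< N (λ a → ∑< N (λ b → u a *ᶻ u b *ᶻ I (b * 2 + (N ∸ 1) * (a * 2))))
    expand = begin-equality
      ∑ elems (λ x → W′ x *ᶻ W′ x)
        ≡⟨ ∑-cong elems (λ x → trans (∑-square (upTo N) (λ a → u a *ᶻ t (pow g (a * 2) · x)))
             (∑-cong (upTo N) (λ a → ∑-cong (upTo N) (λ b → rearrange (u a) (u b) (t (pow g (a * 2) · x)) (t (pow g (b * 2) · x)))))) ⟩
      ∑ elems (λ x → ∑< N (λ a → ∑< N (λ b → u a *ᶻ u b *ᶻ (t (pow g (a * 2) · x) *ᶻ t (pow g (b * 2) · x)))))
        ≡⟨ ∑-swap elems (upTo N) _ ⟩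
      ∑< N (λ a → ∑ elems (λ x → ∑< N (λ b → u a *ᶻ u b *ᶻ (t (pow g (a * 2) · x) *ᶻ t (pow g (b * 2) · x)))))
        ≡⟨ ∑-cong (upTo N) (λ a → ∑-swap elems (upTo N) _) ⟩
      ∑< N (λ a → ∑< N (λ b → ∑ elems (λ x → u a *ᶻ u b *ᶻ (t (pow g (a * 2) · x) *ᶻ t (pow g (b * 2) · x)))))
        ≡⟨ ∑-cong (upTo N) (λ a → ∑-cong (upTo N) (λ b → trans (∑-*ˡ elems (u a *ᶻ u b) _)
             (trans (cong (u a *ᶻ u b *ᶻ_) (trans (correlation-shift (a * 2) (b * 2))
               (trans (correlation-value (b * 2 + (N ∸ 1) * (a * 2)))
                 (cong (_*ᶻ I (b * 2 + (N ∸ 1) * (a * 2))) M≡))))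
               (pull (u a) (u b) M (I (b * 2 + (N ∸ 1) * (a * 2))))))) ⟩
      ∑< N (λ a → ∑< N (λ b → M *ᶻ (u a *ᶻ u b *ᶻ I (b * 2 + (N ∸ 1) * (a * 2)))))
        ≡⟨ trans (∑-cong (upTo N) (λ a → ∑-*ˡ (upTo N) M _)) (∑-*ˡ (upTo N) M _) ⟩
      M *ᶻ ∑< N (λ a → ∑< N (λ b → u a *ᶻ u b *ᶻ I (b * 2 + (N ∸ 1) * (a * 2)))) ∎
    sum-bound : ∑< N (λ e → V′ e *ᶻ V′ e) ≤ᶻ M *ᶻ (+ 2 *ᶻ + (q ∸ 1) *ᶻ U)
    sum-bound = begin
      ∑< N (λ e → V′ e *ᶻ V′ e)
        ≡⟨ ∑-cong (upTo N) (λ e → cong (λ z → z *ᶻ z) (∑-cong (upTo N) (λ a → cong (u a *ᶻ_) (t-cong (pow-+ g (a * 2) e))))) ⟩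
      ∑< N (λ e → W′ (pow g e) *ᶻ W′ (pow g e)) ≡⟨ ℤₚ.+-identityˡ _ ⟨
      -- The powers of the generator miss only 0, whose square may be added.
      0ℤ +ᶻ ∑< N (λ e → W′ (pow g e) *ᶻ W′ (pow g e)) ≤⟨ ℤₚ.+-monoˡ-≤ _ (square-nonneg (W′ 0#)) ⟩
      W′ 0# *ᶻ W′ 0# +ᶻ ∑< N (λ e → W′ (pow g e) *ᶻ W′ (pow g e))
        ≡⟨ ∑-elems (λ x≈y → cong (λ z → z *ᶻ z) (W-cong x≈y)) ⟨
      ∑ elems (λ x → W′ x *ᶻ W′ x) ≡⟨ expand ⟩
      M *ᶻ ∑< N (λ a → ∑< N (λ b → u a *ᶻ u b *ᶻ I (b * 2 + (N ∸ 1) * (a * 2))))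
        ≤⟨ *ᶻ-monoˡ {M} (*ᶻ-nonneg {+ (q ^ n)} {+ (q ∸ 1)} (ℤ.+≤+ z≤n) (ℤ.+≤+ z≤n)) (quadratic-bound u) ⟩
      M *ᶻ (+ 2 *ᶻ + (q ∸ 1) *ᶻ U) ∎

-- The final estimate over the integers: d = δ Π, d + v = (s - 1 + 2 δ) Π, f = θ(k) rad k, b = 2 ^ ω(k), w = W(k),
-- m = q - 1 and Z = q ^ n; err is the error of the sieve, and replacing
-- its factor 2 m by 2 (m + 1) makes room for the term d f.

integer-estimate : ∀ {d v f b w m Z z err} → 0ℤ <ᶻ d → 0ℤ ≤ᶻ v → 0ℤ <ᶻ f → 1ℤ ≤ᶻ b → b ≤ᶻ w → 0ℤ ≤ᶻ m → 1ℤ ≤ᶻ Z →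
  Bounded (+ 4 *ᶻ (m *ᶻ m) *ᶻ Z) ((d +ᶻ v) *ᶻ (f *ᶻ b)) err → z ≤ᶻ d *ᶻ f -ᶻ err →
  z <ᶻ 0ℤ ⊎ z *ᶻ z <ᶻ + 2 *ᶻ (m +ᶻ 1ℤ) *ᶻ f *ᶻ (d +ᶻ v) *ᶻ w *ᶻ (+ 2 *ᶻ (m +ᶻ 1ℤ) *ᶻ f *ᶻ (d +ᶻ v) *ᶻ w) *ᶻ Z
integer-estimate {d} {v} {f} {b} {w} {m} {Z} {z} {err} 0<d 0≤v 0<f 1≤b b≤w 0≤m 1≤Z (bounded 0≤ω err²) z≤y with z ℤₚ.<? 0ℤ
... | yes z<0 = inj₁ z<0
... | no z≮0 = inj₂ (ℤₚ.≤-<-trans (*ᶻ-mono 0≤z (ℤₚ.≤-trans 0≤z z≤y) z≤y z≤y)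
    (ℤₚ.≤-<-trans (square≤ y-bounded) (ℤₚ.*-monoʳ-<-pos Z {{ℤ.positive 0<Z}} w₁²<w₂²)))
  where
  0≤z = ℤₚ.≮⇒≥ z≮0
  0≤d = ℤₚ.<⇒≤ 0<d
  0≤f = ℤₚ.<⇒≤ 0<f
  0<Z : 0ℤ <ᶻ Z
  0<Z = ℤₚ.<-≤-trans (ℤ.+<+ (s≤s z≤n)) 1≤Z
  0≤b : 0ℤ ≤ᶻ b
  0≤b = ℤₚ.≤-trans (ℤ.+≤+ z≤n) 1≤b
  ω = (d +ᶻ v) *ᶻ (f *ᶻ b)
  w₁ = d *ᶻ f +ᶻ ω *ᶻ (+ 2 *ᶻ m)
  w₂ = + 2 *ᶻ (m +ᶻ 1ℤ) *ᶻ f *ᶻ (d +ᶻ v) *ᶻ w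
  0≤2m : 0ℤ ≤ᶻ + 2 *ᶻ m
  0≤2m = *ᶻ-nonneg {+ 2} (ℤ.+≤+ z≤n) 0≤m
  err-bounded : Bounded Z (ω *ᶻ (+ 2 *ᶻ m)) err
  err-bounded = bounded (*ᶻ-nonneg 0≤ω 0≤2m) (subst (err *ᶻ err ≤ᶻ_) (e ω m Z) err²)
    where
    e : ∀ ω m Z → ω *ᶻ ω *ᶻ (+ 4 *ᶻ (m *ᶻ m) *ᶻ Z) ≡ ω *ᶻ (+ 2 *ᶻ m) *ᶻ (ω *ᶻ (+ 2 *ᶻ m)) *ᶻ Z
    e = solve-∀
  -- The term d f is the unit by which N falls short of qⁿ; it is charged as d f √Z, which is
  -- allowed since Z ≥ 1.
  df-bounded : Bounded Z (d *ᶻ f) (d *ᶻ f)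
  df-bounded = bounded (*ᶻ-nonneg 0≤d 0≤f)
    (subst (_≤ᶻ d *ᶻ f *ᶻ (d *ᶻ f) *ᶻ Z) (ℤₚ.*-identityʳ _) (*ᶻ-monoˡ (square-nonneg (d *ᶻ f)) 1≤Z))
  y-bounded : Bounded Z w₁ (d *ᶻ f -ᶻ err)
  y-bounded = bounded-+ (ℤₚ.<⇒≤ 0<Z) df-bounded (bounded-neg err-bounded)
  0≤w₁ : 0ℤ ≤ᶻ w₁
  0≤w₁ = weight≥0 y-bounded
  0<dfb : 0ℤ <ᶻ d *ᶻ f *ᶻ b
  0<dfb = *ᶻ-positive (*ᶻ-positive 0<d 0<f) (ℤₚ.<-≤-trans (ℤ.+<+ (s≤s z≤n)) 1≤b)
  -- `w₂` exceeds `w₁` by `slack` plus d f b; the summand d f b is kept apart because its positivity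
  -- gives the strict inequality.
  slack = + 2 *ᶻ (m +ᶻ 1ℤ) *ᶻ f *ᶻ (d +ᶻ v) *ᶻ (w -ᶻ b) +ᶻ (d *ᶻ f *ᶻ (b -ᶻ 1ℤ) +ᶻ + 2 *ᶻ v *ᶻ f *ᶻ b)
  0≤slack : 0ℤ ≤ᶻ slack
  0≤slack = +ᶻ-nonneg
    (*ᶻ-nonneg (*ᶻ-nonneg (*ᶻ-nonneg (*ᶻ-nonneg {+ 2} (ℤ.+≤+ z≤n) (+ᶻ-nonneg {m} {1ℤ} 0≤m (ℤ.+≤+ z≤n))) 0≤f) (+ᶻ-nonneg 0≤d 0≤v)) (ℤₚ.i≤j⇒0≤j-i b≤w))
    (+ᶻ-nonneg (*ᶻ-nonneg (*ᶻ-nonneg 0≤d 0≤f) (ℤₚ.i≤j⇒0≤j-i 1≤b))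
               (*ᶻ-nonneg (*ᶻ-nonneg (*ᶻ-nonneg {+ 2} (ℤ.+≤+ z≤n) 0≤v) 0≤f) 0≤b))
  w₁<w₂ : w₁ <ᶻ w₂
  w₁<w₂ = subst₂ _<ᶻ_ (ℤₚ.+-identityʳ w₁) (e d v f b w m)
    (ℤₚ.+-monoʳ-< w₁ (ℤₚ.≤-<-trans 0≤slack (subst (_<ᶻ slack +ᶻ d *ᶻ f *ᶻ b) (ℤₚ.+-identityʳ slack) (ℤₚ.+-monoʳ-< slack 0<dfb))))
    where
    e : ∀ d v f b w m → d *ᶻ f +ᶻ (d +ᶻ v) *ᶻ (f *ᶻ b) *ᶻ (+ 2 *ᶻ m)
      +ᶻ (+ 2 *ᶻ (m +ᶻ 1ℤ) *ᶻ f *ᶻ (d +ᶻ v) *ᶻ (w -ᶻ b) +ᶻ (d *ᶻ f *ᶻ (b -ᶻ 1ℤ) +ᶻ + 2 *ᶻ v *ᶻ f *ᶻ b) +ᶻ d *ᶻ f *ᶻ b)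
      ≡ + 2 *ᶻ (m +ᶻ 1ℤ) *ᶻ f *ᶻ (d +ᶻ v) *ᶻ w
    e = solve-∀
  w₁²<w₂² : w₁ *ᶻ w₁ <ᶻ w₂ *ᶻ w₂
  w₁²<w₂² = ℤₚ.≤-<-trans (*ᶻ-monoˡ 0≤w₁ (ℤₚ.<⇒≤ w₁<w₂))
    (ℤₚ.*-monoʳ-<-pos w₂ {{ℤ.positive (ℤₚ.≤-<-trans 0≤w₁ w₁<w₂)}} w₁<w₂)

V-nonneg : ∀ {ps} → All Prime ps → 0ℤ ≤ᶻ V ps
V-nonneg [] = ℤₚ.≤-refl
V-nonneg {zero ∷ ps} (p0 ∷ _) = ⊥-elim (¬prime[0] p0)
V-nonneg {suc p ∷ ps} (_ ∷ pps) = +ᶻ-nonneg (*ᶻ-nonneg {+ suc p} (ℤ.+≤+ z≤n) (V-nonneg pps))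
  (*ᶻ-nonneg {+ product ps} {+ p} (ℤ.+≤+ z≤n) (ℤ.+≤+ z≤n))

φ-positive : ∀ {P} → All Prime P → 0ℤ <ᶻ φ P
φ-positive [] = ℤ.+<+ (s≤s z≤n)
φ-positive {zero ∷ P} (p0 ∷ _) = ⊥-elim (¬prime[0] p0)
φ-positive {suc zero ∷ P} (p1 ∷ _) = ⊥-elim (¬prime[1] p1)
φ-positive {suc (suc p) ∷ P} (_ ∷ pP) = subst (_<ᶻ + suc p *ᶻ φ P) (ℤₚ.*-zeroʳ (+ suc p)) (ℤₚ.*-monoˡ-<-pos (+ suc p) (φ-positive pP))

1≤2^ : ∀ P → 1ℤ ≤ᶻ 2^∣ P ∣
1≤2^ P = subst (1ℤ ≤ᶻ_) (length-subproducts P) (ℤ.+≤+ (nonempty P))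
  where
  nonempty : ∀ P → 1 ≤ length (subproducts P)
  nonempty [] = s≤s z≤n
  nonempty (p ∷ P) = subst (1 ≤_) (sym (length-++ (subproducts P))) (ℕₚ.m≤n⇒m≤n+o _ (nonempty P))

-- Embedding ℤ into ℚ

ℚ-ring : AlmostCommutativeRing _ _
ℚ-ring = fromCommutativeRing ℚₚ.+-*-commutativeRing (λ _ → nothing)

ι : ℤ → ℚ
ι = ℤtoℚ

toℚᵘ-ι : ∀ z → ℚ.toℚᵘ (ι z) ≃ mkℚᵘ z 0
toℚᵘ-ι z = ℚₚ.toℚᵘ-fromℚᵘ (mkℚᵘ z 0)

ι-+ : ∀ x y → ι (x +ᶻ y) ≡ ι x +ℚ ι y
ι-+ x y = ℚₚ.toℚᵘ-injective (ℚᵘₚ.≃-trans (toℚᵘ-ι (x +ᶻ y)) (ℚᵘₚ.≃-trans (*≡* (e x y))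
  (ℚᵘₚ.≃-trans (ℚᵘₚ.≃-sym (ℚᵘₚ.+-cong (toℚᵘ-ι x) (toℚᵘ-ι y))) (ℚᵘₚ.≃-sym (ℚₚ.toℚᵘ-homo-+ (ι x) (ι y))))))
  where
  e : ∀ x y → (x +ᶻ y) *ᶻ 1ℤ ≡ (x *ᶻ 1ℤ +ᶻ y *ᶻ 1ℤ) *ᶻ 1ℤ
  e = solve-∀

ι-* : ∀ x y → ι (x *ᶻ y) ≡ ι x *ℚ ι y
ι-* x y = ℚₚ.toℚᵘ-injective (ℚᵘₚ.≃-trans (toℚᵘ-ι (x *ᶻ y)) (ℚᵘₚ.≃-trans (*≡* refl)
  (ℚᵘₚ.≃-trans (ℚᵘₚ.≃-sym (ℚᵘₚ.*-cong (toℚᵘ-ι x) (toℚᵘ-ι y))) (ℚᵘₚ.≃-sym (ℚₚ.toℚᵘ-homo-* (ι x) (ι y))))))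

ι-neg : ∀ x → ι (-ᶻ x) ≡ ℚ.- ι x
ι-neg x = ℚₚ.toℚᵘ-injective (ℚᵘₚ.≃-trans (toℚᵘ-ι (-ᶻ x))
  (ℚᵘₚ.≃-trans (ℚᵘₚ.≃-sym (ℚᵘₚ.-‿cong (toℚᵘ-ι x))) (ℚᵘₚ.≃-sym (ℚₚ.toℚᵘ-homo‿- (ι x)))))

ι-- : ∀ x y → ι (x -ᶻ y) ≡ ι x -ℚ ι y
ι-- x y = trans (ι-+ x (-ᶻ y)) (cong (ι x +ℚ_) (ι-neg y))

ι-mono-< : ∀ {x y} → x <ᶻ y → ι x ℚ.< ι y
ι-mono-< {x} {y} x<y = ℚₚ.toℚᵘ-cancel-< (ℚᵘₚ.<-respˡ-≃ (ℚᵘₚ.≃-sym (toℚᵘ-ι x)) (ℚᵘₚ.<-respʳ-≃ (ℚᵘₚ.≃-sym (toℚᵘ-ι y))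
  (*<* (subst₂ _<ᶻ_ (sym (ℤₚ.*-identityʳ x)) (sym (ℤₚ.*-identityʳ y)) x<y))))

ι-cancel-< : ∀ {x y} → ι x ℚ.< ι y → x <ᶻ y
ι-cancel-< {x} {y} ιx<ιy with ℚᵘₚ.<-respˡ-≃ (toℚᵘ-ι x) (ℚᵘₚ.<-respʳ-≃ (toℚᵘ-ι y) (ℚₚ.toℚᵘ-mono-< ιx<ιy))
... | *<* lt = subst₂ _<ᶻ_ (ℤₚ.*-identityʳ x) (ℤₚ.*-identityʳ y) lt

ι-nonzero : ∀ {x} → 0ℤ <ᶻ x → ¬ ι x ≡ 0ℚ
ι-nonzero {x} 0<x eq = ℚₚ.<-irrefl (sym eq) (ι-mono-< {0ℤ} 0<x)

ι-positive : ∀ {x} → 0ℤ <ᶻ x → ℚ.Positive (ι x)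
ι-positive 0<x = ℚ.positive (ι-mono-< {0ℤ} 0<x)

divℚ-* : ∀ x {y} → ¬ y ≡ 0ℚ → divℚ x y *ℚ y ≡ x
divℚ-* x {y} y≢0 with y ℚ.≟ 0ℚ
... | yes y≡0 = ⊥-elim (y≢0 y≡0)
... | no y≢0′ = trans (ℚₚ.*-assoc x (ℚ.1/_ y {{nz}}) y)
    (trans (cong (x *ℚ_) (ℚₚ.*-inverseˡ y {{nz}})) (ℚₚ.*-identityʳ x))
  where
  nz = ℚ.≢-nonZero y≢0′

sumRecip-* : ∀ {ps} → All Prime ps → sumRecip ps *ℚ ι (+ product ps) ≡ ι (E ps)
sumRecip-* [] = ℚₚ.*-zeroˡ (ι 1ℤ)
sumRecip-* {p ∷ ps} (pp ∷ pps) = begin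
  (ρ +ℚ S) *ℚ ι (+ (p * product ps)) ≡⟨ cong ((ρ +ℚ S) *ℚ_) (trans (cong ι (ℤₚ.pos-* p (product ps))) (ι-* (+ p) Π)) ⟩
  (ρ +ℚ S) *ℚ (ι (+ p) *ℚ ι Π) ≡⟨ e ρ S (ι (+ p)) (ι Π) ⟩
  ι (+ p) *ℚ (S *ℚ ι Π) +ℚ (ρ *ℚ ι (+ p)) *ℚ ι Π
    ≡⟨ cong₂ _+ℚ_ (cong (ι (+ p) *ℚ_) (sumRecip-* pps))
         (trans (cong (_*ℚ ι Π) (divℚ-* 1ℚ (ι-nonzero (ℤ.+<+ (ℕ.>-nonZero⁻¹ p {{prime⇒nonZero pp}}))))) (ℚₚ.*-identityˡ (ι Π))) ⟩
  ι (+ p) *ℚ ι (E ps) +ℚ ι Π ≡⟨ trans (cong (_+ℚ ι Π) (sym (ι-* (+ p) (E ps)))) (sym (ι-+ (+ p *ᶻ E ps) Π)) ⟩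
  ι (+ p *ᶻ E ps +ᶻ Π) ∎
  where
  open ≡-Reasoning
  Π = + product ps
  ρ = divℚ 1ℚ (ℕtoℚ p)
  S = sumRecip ps
  e : ∀ ρ S p Π → (ρ +ℚ S) *ℚ (p *ℚ Π) ≡ p *ℚ (S *ℚ Π) +ℚ (ρ *ℚ p) *ℚ Π
  e = RingSolver.solve-∀ ℚ-ring

ℚ-cancelʳ : ∀ {x y c} → ¬ c ≡ 0ℚ → x *ℚ c ≡ y *ℚ c → x ≡ y
ℚ-cancelʳ {x} {y} {c} c≢0 eq = trans (sym (undo x)) (trans (cong (_*ℚ ℚ.1/_ c {{nz}}) eq) (undo y))
  where
  nz = ℚ.≢-nonZero c≢0
  undo : ∀ x → x *ℚ c *ℚ ℚ.1/_ c {{nz}} ≡ x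
  undo x = trans (ℚₚ.*-assoc x c _) (trans (cong (x *ℚ_) (ℚₚ.*-inverseʳ c {{nz}})) (ℚₚ.*-identityʳ x))

θ-* : ∀ k .{{_ : NonZero k}} → θ k *ℚ ι (+ product (primesOf k)) ≡ ι (φ (primesOf k))
θ-* k = ℚ-cancelʳ k≢0 (begin
  θ k *ℚ ι rad *ℚ ι (+ k) ≡⟨ e (θ k) (ι rad) (ι (+ k)) ⟩
  ι rad *ℚ (θ k *ℚ ι (+ k)) ≡⟨ cong (ι rad *ℚ_) (divℚ-* (ℕtoℚ (totient k)) k≢0) ⟩
  ι rad *ℚ ι (+ totient k) ≡⟨ sym (ι-* rad (+ totient k)) ⟩
  ι (rad *ᶻ + totient k) ≡⟨ cong ι (trans (totient-primes k) (ℤₚ.*-comm (+ k) (φ P))) ⟩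
  ι (φ P *ᶻ + k) ≡⟨ ι-* (φ P) (+ k) ⟩
  ι (φ P) *ℚ ι (+ k) ∎)
  where
  open ≡-Reasoning
  P = primesOf k
  rad = + product P
  k≢0 : ¬ ι (+ k) ≡ 0ℚ
  k≢0 = ι-nonzero (ℤ.+<+ (ℕ.>-nonZero⁻¹ k))
  e : ∀ θ r k → θ *ℚ r *ℚ k ≡ r *ℚ (θ *ℚ k)
  e = RingSolver.solve-∀ ℚ-ring

-- A restatement of `H-sum-bound`, whose modulus has the form `suc n` so that `n` can stand for -1.
character-sum-bound : ∀ N .{{_ : NonZero N}} (T : ℕ → ℤ) → Periodic N T → ∀ L →
  (∀ (u : ℕ → ℤ) → ∑< N (λ b → ∑< N (λ a → u a *ᶻ T (a + b)) *ᶻ ∑< N (λ a → u a *ᶻ T (a + b)))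
    ≤ᶻ L *ᶻ ∑< N (λ a → u a *ᶻ u a)) →
  ∀ {D} → CoprimeFactors D → product D ∣ N → Bounded L (φ D) (∑< N (λ a → H D a *ᶻ T a))
character-sum-bound (suc n) = H-sum-bound n

⟦×⟧ : ∀ {a b} {A : Set a} {B : Set b} (A? : Dec A) (B? : Dec B) → ⟦ A? ×-dec B? ⟧ ≡ ⟦ A? ⟧ *ᶻ ⟦ B? ⟧
⟦×⟧ (yes _) (yes _) = refl
⟦×⟧ (yes _) (no _) = refl
⟦×⟧ (no _) (yes _) = refl
⟦×⟧ (no _) (no _) = refl

∑-⟦⟧ : ∀ {a} {A : ℕ → Set a} (A? : ∀ i → Dec (A i)) xs → ∑ xs (λ i → ⟦ A? i ⟧) ≡ + length (filter A? xs)
∑-⟦⟧ A? [] = refl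
∑-⟦⟧ A? (x ∷ xs) with A? x
... | yes _ = cong (1ℤ +ᶻ_) (∑-⟦⟧ A? xs)
... | no _ = trans (ℤₚ.+-identityˡ _) (∑-⟦⟧ A? xs)

square-ring : ∀ c x → c *ℚ x *ℚ (c *ℚ x) ≡ c *ℚ c *ℚ (x *ℚ x)
square-ring = RingSolver.solve-∀ ℚ-ring

scaled-ring : ∀ c x z → c *ℚ x *ℚ (c *ℚ x) *ℚ z ≡ c *ℚ c *ℚ (x *ℚ x *ℚ z)
scaled-ring = RingSolver.solve-∀ ℚ-ring

<·√-scaled : ∀ {a D Ω z w Z} → 0ℤ <ᶻ Ω → ι Ω *ℚ a ≡ ι z → ι Ω *ℚ D ≡ ι w →
  z <ᶻ 0ℤ ⊎ z *ᶻ z <ᶻ w *ᶻ w *ᶻ Z → a < D ·√ ι Z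
<·√-scaled {a} {D} {Ω} {z} {w} {Z} 0<Ω Ωa≡z ΩD≡w (inj₁ z<0) = inj₁
  (ℚₚ.*-cancelˡ-<-nonNeg (ι Ω) {{ℚₚ.pos⇒nonNeg (ι Ω) {{ι-positive 0<Ω}}}}
    (subst₂ ℚ._<_ (sym Ωa≡z) (sym (ℚₚ.*-zeroʳ (ι Ω))) (ι-mono-< z<0)))
<·√-scaled {a} {D} {Ω} {z} {w} {Z} 0<Ω Ωa≡z ΩD≡w (inj₂ z²<w²Z) = inj₂
  (ℚₚ.*-cancelˡ-<-nonNeg (ι Ω *ℚ ι Ω) {{ℚₚ.pos⇒nonNeg (ι Ω *ℚ ι Ω) {{ℚₚ.pos*pos⇒pos (ι Ω) {{ι-positive 0<Ω}} (ι Ω) {{ι-positive 0<Ω}}}}}}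
    (subst₂ ℚ._<_
      (trans (ι-* z z) (trans (cong (λ x → x *ℚ x) (sym Ωa≡z)) (square-ring (ι Ω) a)))
      (trans (ι-* (w *ᶻ w) Z) (trans (cong (_*ℚ ι Z) (trans (ι-* w w) (cong (λ x → x *ℚ x) (sym ΩD≡w)))) (scaled-ring (ι Ω) D (ι Z))))
      (ι-mono-< z²<w²Z)))

-- Nonnegativity of `x` excludes the alternative that the left side of the root comparison is
-- negative, so the squares can be compared.
·√<-scaled : ∀ {y d x Z} → 0ℤ <ᶻ d → 0ℤ ≤ᶻ x → ι d *ℚ y ≡ ι x → y < 1ℚ ·√ ι Z → x *ᶻ x <ᶻ d *ᶻ d *ᶻ Z
·√<-scaled {y} {d} {x} 0<d 0≤x dy≡x (inj₁ y<0) = ⊥-elim (ℤₚ.<⇒≱ (ι-cancel-< {x} {0ℤ}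
  (subst₂ ℚ._<_ dy≡x (ℚₚ.*-zeroʳ (ι d)) (ℚₚ.*-monoʳ-<-pos (ι d) {{ι-positive 0<d}} y<0))) 0≤x)
·√<-scaled {y} {d} {x} {Z} 0<d 0≤x dy≡x (inj₂ y²<Z) = ι-cancel-< (subst₂ ℚ._<_
  (trans (sym (square-ring (ι d) y)) (trans (cong (λ z → z *ℚ z) dy≡x) (sym (ι-* x x))))
  (trans (cong (λ z → ι d *ℚ ι d *ℚ z) (ℚₚ.*-identityˡ (ι Z))) (sym (trans (ι-* (d *ᶻ d) Z) (cong (_*ℚ ι Z) (ι-* d d)))))
  (ℚₚ.*-monoʳ-<-pos (ι d *ℚ ι d) {{ℚₚ.pos*pos⇒pos (ι d) {{ι-positive 0<d}} (ι d) {{ι-positive 0<d}}}} y²<Z))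

-- Exponents of Q-free and of primitive elements with Tr (ξ²) = 0

module Counting {c ℓ : Level} (F : FiniteField c ℓ) (p r n₁ : ℕ) (pp : Prime p)
  (card≡ : FiniteField.card F ≡ (p ^ suc r) ^ suc n₁)
  (Q : ℕ) (Q≡ : Q * (p ^ suc r ∸ 1) ≡ (p ^ suc r) ^ suc n₁ ∸ 1)
  (k : ℕ) (ps : List ℕ) (primes : All Prime ps) (∤k : All (λ p → ¬ p ∣ k) ps)
  (Q-factored : Q ≡ k * product ps) where

  open Field F
  open FieldSums F
  open Trace F p r n₁ pp card≡
  open TraceSums F p r n₁ pp card≡ Q Q≡
  open Operator F p r n₁ pp card≡ Q Q≡

  private
    g = generator

  instance
    k≢0 : NonZero k
    k≢0 = ℕ.≢-nonZero λ k≡0 → ℕ.≢-nonZero⁻¹ Q (trans Q-factored (cong (_* product ps) k≡0))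

  P : List ℕ
  P = primesOf k

  good? : ∀ a → Dec (All (λ p → ¬ p ∣ a) P × All (λ p → ¬ p ∣ a) ps × tr (pow g (a * 2)) ≈ 0#)
  good? a = unsieved? P a ×-dec (unsieved? ps a ×-dec (tr (pow g (a * 2)) ≈? 0#))

  goods : List ℕ
  goods = filter good? (upTo N)

  -- `Ω` collects the cleared denominators: rad k for θ(k), `product ps` for δ, and `q` because
  -- `T + 1` is q times the indicator of the trace condition.
  d Z Ω : ℤ
  d = + product ps -ᶻ E ps
  Z = + (q ^ n)
  Ω = + product P *ᶻ + product ps *ᶻ + q

  -- `Ω` times the deficit δ θ(k) q^(n-1) - m of a count `m` against the main term.
  z : ℕ → ℤ
  z m = d *ᶻ φ P *ᶻ Z -ᶻ Ω *ᶻ + m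

  -- `Ω` times the coefficient of √qⁿ in the theorem; q appears as (q - 1) + 1 to fit
  -- `integer-estimate`.
  weight : ℤ
  weight = + 2 *ᶻ (+ (q ∸ 1) +ᶻ 1ℤ) *ᶻ φ P *ᶻ (d +ᶻ V ps) *ᶻ + W k

  private
    P-product∣N : product P ∣ N
    P-product∣N = ∣-trans (primesOf-product-∣ k) (∣-trans (subst (k ∣_) (sym Q-factored) (m∣m*n (product ps))) Q∣N)

    base : Sifted N [] P
    base = sifted [] (primesOf-coprimeFactors k) (Coprimality.1-coprimeTo (product P))
      (subst (_∣ N) (sym (ℕₚ.+-identityʳ (product P))) P-product∣N)

    extended : ∀ {r} → r ∈ ps → Prime r → ¬ r ∣ k → Sifted N (r ∷ []) P
    extended {r} r∈ps pr r∤k = sifted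
      ((prime⇒nonZero pr , Coprimality.sym (Coprimality.1-coprimeTo r)) ∷ [])
      (primesOf-coprimeFactors k)
      (coprime-* (prime-∤⇒coprime pr (λ r∣P → r∤k (∣-trans r∣P (primesOf-product-∣ k)))) (Coprimality.1-coprimeTo (product P)))
      (∣-trans (subst (r * 1 * product P ∣_) (trans (ℕₚ.*-comm (product ps) k) (sym Q-factored))
        (*-pres-∣ (subst (_∣ product ps) (sym (ℕₚ.*-identityʳ r)) (∈⇒∣product r∈ps)) (primesOf-product-∣ k))) Q∣N)

    extensions : All (λ r → Sifted N (r ∷ []) P) ps
    extensions = All.tabulate (λ r∈ps → extended r∈ps (All.lookup primes r∈ps) (All.lookup ∤k r∈ps))

    T+1 : ∀ a → T a +ᶻ 1ℤ ≡ + q *ᶻ ⟦ tr (pow g (a * 2)) ≈? 0# ⟧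
    T+1 a = e (+ q *ᶻ ⟦ tr (pow g (a * 2)) ≈? 0# ⟧)
      where
      e : ∀ x → x -ᶻ 1ℤ +ᶻ 1ℤ ≡ x
      e = solve-∀

    sifted-sum : ∑< N (λ a → sieve P a *ᶻ sieve ps a *ᶻ (T a +ᶻ 1ℤ)) ≡ Ω *ᶻ + length goods
    sifted-sum = trans (∑-cong (upTo N) pointwise)
      (trans (∑-*ˡ (upTo N) Ω (λ a → ⟦ good? a ⟧)) (cong (Ω *ᶻ_) (∑-⟦⟧ good? (upTo N))))
      where
      e : ∀ x y z i j l → x *ᶻ i *ᶻ (y *ᶻ j) *ᶻ (z *ᶻ l) ≡ x *ᶻ y *ᶻ z *ᶻ (i *ᶻ (j *ᶻ l))
      e = solve-∀
      pointwise : ∀ a → sieve P a *ᶻ sieve ps a *ᶻ (T a +ᶻ 1ℤ) ≡ Ω *ᶻ ⟦ good? a ⟧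
      pointwise a = trans (cong₂ _*ᶻ_ (cong₂ _*ᶻ_ (sieve-value P a) (sieve-value ps a)) (T+1 a))
        (trans (e (+ product P) (+ product ps) (+ q) ⟦ unsieved? P a ⟧ ⟦ unsieved? ps a ⟧ ⟦ tr (pow g (a * 2)) ≈? 0# ⟧)
          (cong (Ω *ᶻ_) (sym (trans (⟦×⟧ (unsieved? P a) (unsieved? ps a ×-dec (tr (pow g (a * 2)) ≈? 0#)))
            (cong (⟦ unsieved? P a ⟧ *ᶻ_) (⟦×⟧ (unsieved? ps a) (tr (pow g (a * 2)) ≈? 0#)))))))

    0≤Λ² : 0ℤ ≤ᶻ Λ²
    0≤Λ² = *ᶻ-nonneg {+ 4 *ᶻ (+ (q ∸ 1) *ᶻ + (q ∸ 1))} (*ᶻ-nonneg {+ 4} (ℤ.+≤+ z≤n) (square-nonneg (+ (q ∸ 1)))) (ℤ.+≤+ {0} {q ^ n} z≤n)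

  0≤Ω : 0ℤ ≤ᶻ Ω
  0≤Ω = *ᶻ-nonneg {+ product P *ᶻ + product ps} {+ q} (*ᶻ-nonneg {+ product P} {+ product ps} (ℤ.+≤+ z≤n) (ℤ.+≤+ z≤n)) (ℤ.+≤+ z≤n)

  private
    sifted-lower-bound : 0ℤ <ᶻ d → Σ ℤ λ err → Bounded Λ² ((d +ᶻ V ps) *ᶻ (φ P *ᶻ 2^∣ P ∣)) err ×
      d *ᶻ (+ N *ᶻ φ P) +ᶻ err ≤ᶻ ∑< N (λ a → sieve P a *ᶻ sieve ps a *ᶻ (T a +ᶻ 1ℤ))
    sifted-lower-bound 0<d = sieve-inequality N T Λ² 0≤Λ² (character-sum-bound N T T-periodic Λ² operator-bound)
      (λ a → subst (0ℤ ≤ᶻ_) (sym (T+1 a)) (*ᶻ-nonneg {+ q} (ℤ.+≤+ z≤n) (⟦⟧-nonneg (tr (pow g (a * 2)) ≈? 0#))))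
      ps base extensions (ℤₚ.<⇒≤ 0<d)

    z-upper-bound : ∀ {m err} → length goods ≤ m →
      d *ᶻ (+ N *ᶻ φ P) +ᶻ err ≤ᶻ ∑< N (λ a → sieve P a *ᶻ sieve ps a *ᶻ (T a +ᶻ 1ℤ)) → z m ≤ᶻ d *ᶻ φ P -ᶻ err
    z-upper-bound {m} {err} M≤m lower = subst (z m ≤ᶻ_) e₂
      (ℤₚ.+-monoʳ-≤ (d *ᶻ φ P *ᶻ Z) (ℤₚ.neg-mono-≤ (ℤₚ.≤-trans lower
        (subst (_≤ᶻ Ω *ᶻ + m) (sym sifted-sum) (*ᶻ-monoˡ {Ω} 0≤Ω (ℤ.+≤+ M≤m))))))
      where
      e₃ : ∀ d f N err → d *ᶻ f *ᶻ (1ℤ +ᶻ N) +ᶻ -ᶻ (d *ᶻ (N *ᶻ f) +ᶻ err) ≡ d *ᶻ f -ᶻ err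
      e₃ = solve-∀
      e₂ : d *ᶻ φ P *ᶻ Z +ᶻ -ᶻ (d *ᶻ (+ N *ᶻ φ P) +ᶻ err) ≡ d *ᶻ φ P -ᶻ err
      e₂ = trans (cong (λ y → d *ᶻ φ P *ᶻ y +ᶻ -ᶻ (d *ᶻ (+ N *ᶻ φ P) +ᶻ err)) (cong +_ (sym 1+N≡qⁿ))) (e₃ d (φ P) (+ N) err)

  count-estimate : 0ℤ <ᶻ d → ∀ {m} → length goods ≤ m → z m <ᶻ 0ℤ ⊎ z m *ᶻ z m <ᶻ weight *ᶻ weight *ᶻ Z
  count-estimate 0<d {m} M≤m =
    integer-estimate {d} {V ps} {φ P} {2^∣ P ∣} {+ W k} {+ (q ∸ 1)} {Z} {z m} {proj₁ (sifted-lower-bound 0<d)}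
      0<d (V-nonneg primes) (φ-positive (primesOf-prime k)) (1≤2^ P) (2^primes≤W k) (ℤ.+≤+ z≤n)
      (ℤ.+≤+ (ℕₚ.m^n>0 q n)) (proj₁ (proj₂ (sifted-lower-bound 0<d)))
      (z-upper-bound M≤m (proj₂ (proj₂ (sifted-lower-bound 0<d))))

  -- If the power with exponent a is an e-th power with e ∣ m, then a is congruent modulo N to a
  -- multiple of e. As e divides N, it divides a, and so does any prime factor of e.
  free : ∀ {m a} → m ∣ N → (∀ {r} → Prime r → r ∣ m → ¬ r ∣ a) → R.Free m (pow g a)
  free {m} {a} m∣N avoid e e∣m ζ ζ≉0 gᵃ≈ζᵉ with e ℕₚ.≟ 1
  ... | yes e≡1 = e≡1
  ... | no e≢1 with discrete-log ζ≉0
  ...   | b , _ , ζ≈gᵇ = let r , pr , r∣e = prime-divisor e {{e≢0}} e≢1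
                         in ⊥-elim (avoid pr (∣-trans r∣e e∣m) (∣-trans r∣e e∣a))
    where
    e≢0 : NonZero e
    e≢0 = ℕ.≢-nonZero λ { refl → ℕ.≢-nonZero⁻¹ N (0∣⇒≡0 (∣-trans e∣m m∣N)) }
    gᵃ≈gᵇᵉ : pow g a ≈ pow g (b * e)
    gᵃ≈gᵇᵉ = ≈-trans gᵃ≈ζᵉ (≈-trans (pow-cong e ζ≈gᵇ) (≈-sym (pow-* g b e)))
    e∣a : e ∣ a
    e∣a with ℕₚ.≤-total a (b * e)
    ... | inj₁ a≤be = ∣m+n∣m⇒∣n (subst (e ∣_) (sym (ℕₚ.m∸n+n≡m a≤be)) (n∣m*n b))
            (∣-trans (∣-trans e∣m m∣N) (pow-generator-injective-≤ a≤be gᵃ≈gᵇᵉ))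
    ... | inj₂ be≤a = subst (e ∣_) (ℕₚ.m∸n+n≡m be≤a)
            (∣m∣n⇒∣m+n (∣-trans (∣-trans e∣m m∣N) (pow-generator-injective-≤ be≤a (≈-sym gᵃ≈gᵇᵉ))) (n∣m*n b))

  power-N0 : ∀ {m a} → m ∣ N → (∀ {r} → Prime r → r ∣ m → ¬ r ∣ a) → tr (pow g (a * 2)) ≈ 0# → R.N0Prop q n m (pow g a)
  power-N0 {m} {a} m∣N avoid tr≈0 = pow-nonzero a generator≉0 , free m∣N avoid ,
    ≈-trans (tr-cong (≈-sym (≈-trans (pow-* g a 2) (·-cong ≈-refl (·-identityʳ _))))) tr≈0

  good-avoids-Q : ∀ {a} → All (λ p → ¬ p ∣ a) P → All (λ p → ¬ p ∣ a) ps → ∀ {r} → Prime r → r ∣ Q → ¬ r ∣ a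
  good-avoids-Q P∤a ps∤a {r} pr r∣Q with euclidsLemma k (product ps) pr (subst (r ∣_) Q-factored r∣Q)
  ... | inj₁ r∣k = All.lookup P∤a (∈-primesOf⁺ k pr r∣k)
  ... | inj₂ r∣ps = All.lookup ps∤a (prime∣product⇒∈ ps pr primes r∣ps)

  -- One inclusion is enough for a lower bound on the count: the powers with good exponents are
  -- distinct and all occur in the list `L`.
  goods≤N0 : ∀ {m} → R.IsN0 q n Q m → length goods ≤ m
  goods≤N0 (L , refl , _ , _ , covers) = subst (_≤ length L) (length-map (pow g) goods)
    (distinct-⊆⇒length≤
      (AllPairsₚ.map⁺ (AllPairsₚ.filter⁺ good? (AllPairsₚ.map⁻ powers-distinct)))
      (λ y∈ → let a , a∈ , y≈gᵃ = Membershipₚ.∈-map⁻ (setoid ℕ) ≈-setoid y∈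
                  P∤a , ps∤a , tr≈0 = proj₂ (∈ₚ.∈-filter⁻ good? {xs = upTo N} a∈)
              in Membershipₚ.∈-resp-≈ ≈-setoid (≈-sym y≈gᵃ) (covers (pow g a) (power-N0 Q∣N (good-avoids-Q P∤a ps∤a) tr≈0))))

  -- Multiplying by the element g ^ (Q j) of the subfield keeps the trace condition; j is the product of the
  -- primes not dividing a, so that exactly one of a and Q j is divisible by a given prime divisor of N.
  primitive-exponent : ∀ a → (∀ {r} → Prime r → r ∣ Q → ¬ r ∣ a) → tr (pow g (a * 2)) ≈ 0# →
    Σ ℕ λ b → (∀ {r} → Prime r → r ∣ N → ¬ r ∣ b) × tr (pow g (b * 2)) ≈ 0#
  primitive-exponent a avoids-Q tr≈0 = a + Q * j , avoid , (begin
    tr (pow g ((a + Q * j) * 2)) ≡⟨ cong (λ e → tr (pow g e)) (e a Q j) ⟩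
    tr (pow g (Q * (j * 2) + a * 2)) ≈⟨ tr-cong (pow-+ g (Q * (j * 2)) (a * 2)) ⟩
    tr (pow g (Q * (j * 2)) · pow g (a * 2)) ≈⟨ tr-scale (Q∣⇒fixed (Q * (j * 2)) (m∣m*n (j * 2))) _ ⟩
    pow g (Q * (j * 2)) · tr (pow g (a * 2)) ≈⟨ ·-cong ≈-refl tr≈0 ⟩
    pow g (Q * (j * 2)) · 0# ≈⟨ ·-zeroʳ _ ⟩
    0# ∎)
    where
    open SetoidReasoning ≈-setoid
    test? : ∀ r → Dec (Prime r × ¬ r ∣ a)
    test? r = prime? r ×-dec ¬? (r ∣? a)
    js : List ℕ
    js = filter test? (upTo (suc N))
    j = product js
    e : ∀ a Q j → (a + Q * j) * 2 ≡ Q * (j * 2) + a * 2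
    e = ℕ-Solver.solve-∀
    avoid : ∀ {r} → Prime r → r ∣ N → ¬ r ∣ a + Q * j
    avoid {r} pr r∣N r∣a+Qj = avoid′ (r ∣? a)
      where
      avoid′ : Dec (r ∣ a) → ⊥
      avoid′ (no r∤a) = r∤a (∣m+n∣m⇒∣n (subst (r ∣_) (ℕₚ.+-comm a (Q * j)) r∣a+Qj) (∣n⇒∣m*n Q
        (∈⇒∣product (∈ₚ.∈-filter⁺ test? (∈ₚ.∈-upTo⁺ (s≤s (∣⇒≤ r∣N))) (pr , r∤a)))))
      avoid′ (yes r∣a) = [ (λ r∣Q → avoids-Q pr r∣Q r∣a) ,
        (λ r∣j → proj₂ (proj₂ (∈ₚ.∈-filter⁻ test? {xs = upTo (suc N)}
           (prime∣product⇒∈ js pr (All.map proj₁ (Allₚ.all-filter test? (upTo (suc N)))) r∣j))) r∣a) ]′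
        (euclidsLemma Q j pr (∣m+n∣m⇒∣n r∣a+Qj r∣a))

  N0-positive : 0 < length goods → ∀ {m} → R.IsN0 q n (q ^ n ∸ 1) m → 0 < m
  N0-positive 0<M {m} (L , refl , _ , _ , covers) = first (Allₚ.all-filter good? (upTo N)) 0<M
    where
    nonempty : ∀ {b} {A : Carrier → Set b} {L} → Any A L → 0 < length L
    nonempty (here _) = s≤s z≤n
    nonempty (there _) = s≤s z≤n
    found : (Σ ℕ λ b → (∀ {r} → Prime r → r ∣ N → ¬ r ∣ b) × tr (pow g (b * 2)) ≈ 0#) → 0 < length L
    found (b , avoid , tr≈0) = nonempty (covers (pow g b)
      (subst (λ m → R.N0Prop q n m (pow g b)) (cong (_∸ 1) 1+N≡qⁿ) (power-N0 ∣-refl avoid tr≈0)))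
    first : ∀ {xs} → All (λ a → All (λ p → ¬ p ∣ a) P × All (λ p → ¬ p ∣ a) ps × tr (pow g (a * 2)) ≈ 0#) xs →
      0 < length xs → 0 < length L
    first {a ∷ _} ((P∤a , ps∤a , tr≈0) ∷ _) _ = found (primitive-exponent a (good-avoids-Q P∤a ps∤a) tr≈0)

-- Clearing denominators in the statement

module Rational (k : ℕ) .{{_ : NonZero k}} (ps : List ℕ) (primes : All Prime ps) where

  private
    Π d : ℤ
    Π = + product ps
    d = Π -ᶻ E ps

    s : ℕ
    s = length ps

    f rad : ℤ
    f = φ (primesOf k)
    rad = + product (primesOf k)

    δ x C A : ℚ
    δ = 1ℚ -ℚ sumRecip ps
    x = divℚ (ℤtoℚ (+ s -ᶻ + 1)) δ
    C = x +ℚ ℕtoℚ 2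
    A = δ *ℚ θ k

  δ-* : δ *ℚ ι Π ≡ ι d
  δ-* = trans (e (sumRecip ps) (ι Π)) (trans (cong (ι Π -ℚ_) (sumRecip-* primes)) (sym (ι-- Π (E ps))))
    where
    e : ∀ S Π → (1ℚ -ℚ S) *ℚ Π ≡ Π -ℚ S *ℚ Π
    e = RingSolver.solve-∀ ℚ-ring

  Π-positive : 0ℤ <ᶻ Π
  Π-positive = ℤ.+<+ (productOfPrimes≥1 primes)

  module _ (0<δ : 0ℚ ℚ.< δ) where

    d-positive : 0ℤ <ᶻ d
    d-positive = ι-cancel-< {0ℤ} (subst₂ ℚ._<_ (ℚₚ.*-zeroˡ (ι Π)) δ-*
      (ℚₚ.*-monoˡ-<-pos (ι Π) {{ι-positive Π-positive}} 0<δ))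

    δ≢0 : ¬ δ ≡ 0ℚ
    δ≢0 δ≡0 = ℚₚ.<-irrefl (sym δ≡0) 0<δ

    -- This is (s - 1) Π + 2 d, and it equals d + V because V = s Π - E: the weights of δ X and of Y
    -- in the sieve error add up to the constant of the theorem.
    C-* : (x *ℚ δ) *ℚ ι Π +ℚ ι (+ 2) *ℚ (δ *ℚ ι Π) ≡ ι (d +ᶻ V ps)
    C-* = begin
      (x *ℚ δ) *ℚ ι Π +ℚ ι (+ 2) *ℚ (δ *ℚ ι Π) ≡⟨ cong₂ _+ℚ_ (cong (_*ℚ ι Π) (divℚ-* (ι (+ s -ᶻ + 1)) δ≢0)) (cong (ι (+ 2) *ℚ_) δ-*) ⟩
      ι (+ s -ᶻ + 1) *ℚ ι Π +ℚ ι (+ 2) *ℚ ι d ≡⟨ cong₂ _+ℚ_ (sym (ι-* (+ s -ᶻ + 1) Π)) (sym (ι-* (+ 2) d)) ⟩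
      ι ((+ s -ᶻ + 1) *ᶻ Π) +ℚ ι (+ 2 *ᶻ d) ≡⟨ sym (ι-+ ((+ s -ᶻ + 1) *ᶻ Π) (+ 2 *ᶻ d)) ⟩
      ι ((+ s -ᶻ + 1) *ᶻ Π +ᶻ + 2 *ᶻ d) ≡⟨ cong ι (trans (e (+ s) Π (E ps)) (cong (d +ᶻ_) (sym (V-closed ps)))) ⟩
      ι (d +ᶻ V ps) ∎
      where
      open ≡-Reasoning
      e : ∀ s Π E → (s -ᶻ + 1) *ᶻ Π +ᶻ + 2 *ᶻ (Π -ᶻ E) ≡ Π -ᶻ E +ᶻ (s *ᶻ Π -ᶻ E)
      e = solve-∀

    -- `rad` turns θ(k) into `f`, `Π` turns δ into `d`, and `q` raises q^(n-1) to qⁿ when t =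
    -- q^(n-1).
    cleared-deficit : ∀ q t m → ι (rad *ᶻ Π *ᶻ + q) *ℚ (A *ℚ ℕtoℚ t -ℚ ℕtoℚ m)
      ≡ ι (d *ᶻ f *ᶻ + (q * t) -ᶻ rad *ᶻ Π *ᶻ + q *ᶻ + m)
    cleared-deficit q t m = begin
      ι Ω *ℚ (A *ℚ ι (+ t) -ℚ ι (+ m)) ≡⟨ cong (_*ℚ (A *ℚ ι (+ t) -ℚ ι (+ m))) ιΩ ⟩
      ι rad *ℚ ι Π *ℚ ι (+ q) *ℚ (A *ℚ ι (+ t) -ℚ ι (+ m)) ≡⟨ e (ι rad) (ι Π) (ι (+ q)) δ (θ k) (ι (+ t)) (ι (+ m)) ⟩
      (δ *ℚ ι Π) *ℚ (θ k *ℚ ι rad) *ℚ (ι (+ q) *ℚ ι (+ t)) -ℚ ι rad *ℚ ι Π *ℚ ι (+ q) *ℚ ι (+ m)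
        ≡⟨ cong₂ _-ℚ_ (cong₂ _*ℚ_ (cong₂ _*ℚ_ δ-* (θ-* k)) (trans (sym (ι-* (+ q) (+ t))) (cong ι (sym (ℤₚ.pos-* q t)))))
             (trans (cong (_*ℚ ι (+ m)) (sym ιΩ)) (sym (ι-* Ω (+ m)))) ⟩
      ι d *ℚ ι f *ℚ ι (+ (q * t)) -ℚ ι (Ω *ᶻ + m)
        ≡⟨ cong (_-ℚ ι (Ω *ᶻ + m)) (sym (trans (ι-* (d *ᶻ f) (+ (q * t))) (cong (_*ℚ ι (+ (q * t))) (ι-* d f)))) ⟩
      ι (d *ᶻ f *ᶻ + (q * t)) -ℚ ι (Ω *ᶻ + m) ≡⟨ sym (ι-- (d *ᶻ f *ᶻ + (q * t)) (Ω *ᶻ + m)) ⟩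
      ι (d *ᶻ f *ᶻ + (q * t) -ᶻ Ω *ᶻ + m) ∎
      where
      open ≡-Reasoning
      Ω = rad *ᶻ Π *ᶻ + q
      ιΩ : ι Ω ≡ ι rad *ℚ ι Π *ℚ ι (+ q)
      ιΩ = trans (ι-* (rad *ᶻ Π) (+ q)) (cong (_*ℚ ι (+ q)) (ι-* rad Π))
      e : ∀ r Π q δ θ t m → r *ℚ Π *ℚ q *ℚ (δ *ℚ θ *ℚ t -ℚ m) ≡ (δ *ℚ Π) *ℚ (θ *ℚ r) *ℚ (q *ℚ t) -ℚ r *ℚ Π *ℚ q *ℚ m
      e = RingSolver.solve-∀ ℚ-ring

    cleared-weight : ∀ q → ι (rad *ᶻ Π *ᶻ + q) *ℚ (((ℕtoℚ 2 *ℚ A) *ℚ C) *ℚ ℕtoℚ (W k))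
      ≡ ι (+ 2 *ᶻ + q *ᶻ f *ᶻ (d +ᶻ V ps) *ᶻ + W k)
    cleared-weight q = begin
      ι (rad *ᶻ Π *ᶻ + q) *ℚ (((ι (+ 2) *ℚ A) *ℚ C) *ℚ ι w) ≡⟨ cong (_*ℚ (((ι (+ 2) *ℚ A) *ℚ C) *ℚ ι w))
        (trans (ι-* (rad *ᶻ Π) (+ q)) (cong (_*ℚ ι (+ q)) (ι-* rad Π))) ⟩
      ι rad *ℚ ι Π *ℚ ι (+ q) *ℚ (((ι (+ 2) *ℚ A) *ℚ C) *ℚ ι w)
        ≡⟨ e (ι rad) (ι Π) (ι (+ q)) (ι (+ 2)) δ (θ k) x (ι w) ⟩
      ι (+ 2) *ℚ ι (+ q) *ℚ (θ k *ℚ ι rad) *ℚ ((x *ℚ δ) *ℚ ι Π +ℚ ι (+ 2) *ℚ (δ *ℚ ι Π)) *ℚ ι w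
        ≡⟨ cong (_*ℚ ι w) (cong₂ (λ y z → ι (+ 2) *ℚ ι (+ q) *ℚ y *ℚ z) (θ-* k) C-*) ⟩
      ι (+ 2) *ℚ ι (+ q) *ℚ ι f *ℚ ι (d +ᶻ V ps) *ℚ ι w ≡⟨ sym (trans (ι-* (+ 2 *ᶻ + q *ᶻ f *ᶻ (d +ᶻ V ps)) w) (cong (_*ℚ ι w)
        (trans (ι-* (+ 2 *ᶻ + q *ᶻ f) (d +ᶻ V ps)) (cong (_*ℚ ι (d +ᶻ V ps))
          (trans (ι-* (+ 2 *ᶻ + q) f) (cong (_*ℚ ι f) (ι-* (+ 2) (+ q)))))))) ⟩
      ι (+ 2 *ᶻ + q *ᶻ f *ᶻ (d +ᶻ V ps) *ᶻ w) ∎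
      where
      open ≡-Reasoning
      w = + W k
      e : ∀ r Π q two δ θ x w → r *ℚ Π *ℚ q *ℚ (((two *ℚ (δ *ℚ θ)) *ℚ (x +ℚ two)) *ℚ w)
        ≡ two *ℚ q *ℚ (θ *ℚ r) *ℚ ((x *ℚ δ) *ℚ Π +ℚ two *ℚ (δ *ℚ Π)) *ℚ w
      e = RingSolver.solve-∀ ℚ-ring

    cleared-condition : ι d *ℚ ((ℕtoℚ 2 *ℚ C) *ℚ ℕtoℚ (W k)) ≡ ι (+ 2 *ᶻ (d +ᶻ V ps) *ᶻ + W k)
    cleared-condition = begin
      ι d *ℚ ((ι (+ 2) *ℚ C) *ℚ ι w) ≡⟨ cong (_*ℚ ((ι (+ 2) *ℚ C) *ℚ ι w)) (sym δ-*) ⟩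
      δ *ℚ ι Π *ℚ ((ι (+ 2) *ℚ C) *ℚ ι w) ≡⟨ e δ (ι Π) (ι (+ 2)) x (ι w) ⟩
      ι (+ 2) *ℚ ((x *ℚ δ) *ℚ ι Π +ℚ ι (+ 2) *ℚ (δ *ℚ ι Π)) *ℚ ι w ≡⟨ cong (λ y → ι (+ 2) *ℚ y *ℚ ι w) C-* ⟩
      ι (+ 2) *ℚ ι (d +ᶻ V ps) *ℚ ι w ≡⟨ sym (trans (ι-* (+ 2 *ᶻ (d +ᶻ V ps)) w) (cong (_*ℚ ι w) (ι-* (+ 2) (d +ᶻ V ps)))) ⟩
      ι (+ 2 *ᶻ (d +ᶻ V ps) *ᶻ w) ∎
      where
      open ≡-Reasoning
      w = + W k
      e : ∀ δ Π two x w → δ *ℚ Π *ℚ ((two *ℚ (x +ℚ two)) *ℚ w) ≡ two *ℚ ((x *ℚ δ) *ℚ Π +ℚ two *ℚ (δ *ℚ Π)) *ℚ w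
      e = RingSolver.solve-∀ ℚ-ring

-- With no solutions the estimate reads (d f Z)² < (q f X)² Z with Z = q² Y, against X² < d² Y.
no-solution-contradiction : ∀ {d f q Y X} → 0ℤ <ᶻ d → 0ℤ <ᶻ f → 0ℤ <ᶻ q → 0ℤ <ᶻ Y → X *ᶻ X <ᶻ d *ᶻ d *ᶻ Y →
  let Z = q *ᶻ (q *ᶻ Y) in ¬ (d *ᶻ f *ᶻ Z <ᶻ 0ℤ ⊎ d *ᶻ f *ᶻ Z *ᶻ (d *ᶻ f *ᶻ Z) <ᶻ q *ᶻ f *ᶻ X *ᶻ (q *ᶻ f *ᶻ X) *ᶻ Z)
no-solution-contradiction 0<d 0<f 0<q 0<Y X²<d²Y (inj₁ dfZ<0) =
  ℤₚ.<-asym dfZ<0 (*ᶻ-positive (*ᶻ-positive 0<d 0<f) (*ᶻ-positive 0<q (*ᶻ-positive 0<q 0<Y)))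
no-solution-contradiction {d} {f} {q} {Y} {X} 0<d 0<f 0<q 0<Y X²<d²Y (inj₂ lt) =
  ℤₚ.<-asym lt (subst₂ _<ᶻ_ (e₁ f q Y X) (e₂ d f q Y)
    (ℤₚ.*-monoˡ-<-pos (q *ᶻ f *ᶻ (q *ᶻ f) *ᶻ Z) {{ℤ.positive (*ᶻ-positive (*ᶻ-positive 0<qf 0<qf) 0<Z)}} X²<d²Y))
  where
  Z = q *ᶻ (q *ᶻ Y)
  0<qf = *ᶻ-positive 0<q 0<f
  0<Z = *ᶻ-positive 0<q (*ᶻ-positive 0<q 0<Y)
  e₁ : ∀ f q Y X → q *ᶻ f *ᶻ (q *ᶻ f) *ᶻ (q *ᶻ (q *ᶻ Y)) *ᶻ (X *ᶻ X) ≡ q *ᶻ f *ᶻ X *ᶻ (q *ᶻ f *ᶻ X) *ᶻ (q *ᶻ (q *ᶻ Y))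
  e₁ = solve-∀
  e₂ : ∀ d f q Y → q *ᶻ f *ᶻ (q *ᶻ f) *ᶻ (q *ᶻ (q *ᶻ Y)) *ᶻ (d *ᶻ d *ᶻ Y) ≡ d *ᶻ f *ᶻ (q *ᶻ (q *ᶻ Y)) *ᶻ (d *ᶻ f *ᶻ (q *ᶻ (q *ᶻ Y)))
  e₂ = solve-∀

-- The lower bound and the existence of primitive solutions

module Conclusion {c ℓ : Level} (F : FiniteField c ℓ) (p r n₀ : ℕ) (pp : Prime p)
  (card≡ : FiniteField.card F ≡ (p ^ suc r) ^ suc (suc n₀))
  (Q : ℕ) (Q≡ : Q * (p ^ suc r ∸ 1) ≡ (p ^ suc r) ^ suc (suc n₀) ∸ 1)
  (k : ℕ) (ps : List ℕ) (primes : All Prime ps) (∤k : All (λ p → ¬ p ∣ k) ps)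
  (Q-factored : Q ≡ k * product ps) (0<δ : 0ℚ ℚ.< 1ℚ -ℚ sumRecip ps) where

  open Field F using (N)
  open Trace F p r (suc n₀) pp card≡ using (q; n; q≢0; 1<q)
  open TraceSums F p r (suc n₀) pp card≡ Q Q≡ using (1+[q-1]≡q)
  open Counting F p r (suc n₀) pp card≡ Q Q≡ k ps primes ∤k Q-factored
  open Rational k ps primes

  private
    s = length ps
    δ = 1ℚ -ℚ sumRecip ps
    C = divℚ (ℤtoℚ (+ s -ᶻ + 1)) δ +ℚ ℕtoℚ 2
    A = δ *ℚ θ k
    D = ((ℕtoℚ 2 *ℚ A) *ℚ C) *ℚ ℕtoℚ (W k)

    0<d = d-positive 0<δ

    0<q : 0ℤ <ᶻ + q
    0<q = ℤ.+<+ (ℕₚ.<-trans (s≤s z≤n) 1<q)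

    0<Ω : 0ℤ <ᶻ Ω
    0<Ω = *ᶻ-positive (*ᶻ-positive (ℤ.+<+ (productOfPrimes≥1 (primesOf-prime k))) Π-positive) 0<q

    X : ℤ
    X = + 2 *ᶻ (d +ᶻ V ps) *ᶻ + W k

    weight≡ : + 2 *ᶻ + q *ᶻ φ P *ᶻ (d +ᶻ V ps) *ᶻ + W k ≡ weight
    weight≡ = cong (λ y → + 2 *ᶻ y *ᶻ φ P *ᶻ (d +ᶻ V ps) *ᶻ + W k)
      (cong +_ (trans (sym 1+[q-1]≡q) (ℕₚ.+-comm 1 (q ∸ 1))))

    0≤X : 0ℤ ≤ᶻ X
    0≤X = *ᶻ-nonneg {+ 2 *ᶻ (d +ᶻ V ps)} {+ W k} (*ᶻ-nonneg {+ 2} (ℤ.+≤+ z≤n) (+ᶻ-nonneg (ℤₚ.<⇒≤ 0<d) (V-nonneg primes))) (ℤ.+≤+ z≤n)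

  lower-bound : ∀ m → FiniteField.IsN0 F q n Q m → (A *ℚ ℕtoℚ (q ^ (n ∸ 1)) -ℚ ℕtoℚ m) < D ·√ ℕtoℚ (q ^ n)
  lower-bound m isN0 = <·√-scaled {w = weight} 0<Ω (cleared-deficit 0<δ q (q ^ (n ∸ 1)) m)
    (trans (cleared-weight 0<δ q) (cong ι weight≡)) (count-estimate 0<d (goods≤N0 isN0))

  existence : ((ℕtoℚ 2 *ℚ C) *ℚ ℕtoℚ (W k)) < 1ℚ ·√ ℕtoℚ (q ^ (n ∸ 2)) →
    ∀ m → FiniteField.IsN0 F q n (q ^ n ∸ 1) m → 0 ℕ.< m
  -- A single good exponent suffices, since `N0-positive` turns a Q-free solution into a primitive
  -- one. The estimate for the count 0 contradicts the condition.
  existence condition m = N0-positive (ℕₚ.n≢0⇒n>0 no-goods)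
    where
    Y = + (q ^ n₀)
    X²<d²Y : X *ᶻ X <ᶻ d *ᶻ d *ᶻ Y
    X²<d²Y = ·√<-scaled 0<d 0≤X (cleared-condition 0<δ) condition
    Z≡ : Z ≡ + q *ᶻ (+ q *ᶻ Y)
    Z≡ = trans (ℤₚ.pos-* q (q * q ^ n₀)) (cong (λ y → + q *ᶻ y) (ℤₚ.pos-* q (q ^ n₀)))
    e₁ : ∀ y x → y -ᶻ x *ᶻ 0ℤ ≡ y
    e₁ = solve-∀
    e₂ : ∀ q f κ w → + 2 *ᶻ q *ᶻ f *ᶻ κ *ᶻ w ≡ q *ᶻ f *ᶻ (+ 2 *ᶻ κ *ᶻ w)
    e₂ = solve-∀
    z0≡ : z 0 ≡ d *ᶻ φ P *ᶻ (+ q *ᶻ (+ q *ᶻ Y))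
    z0≡ = trans (e₁ (d *ᶻ φ P *ᶻ Z) Ω) (cong (λ y → d *ᶻ φ P *ᶻ y) Z≡)
    weight≡′ : weight ≡ + q *ᶻ φ P *ᶻ X
    weight≡′ = trans (sym weight≡) (e₂ (+ q) (φ P) (d +ᶻ V ps) (+ W k))
    no-goods : ¬ length goods ≡ 0
    no-goods M≡0 = no-solution-contradiction 0<d (φ-positive (primesOf-prime k)) 0<q (ℤ.+<+ (ℕₚ.m^n>0 q n₀)) X²<d²Y
      (Sum.map (subst (_<ᶻ 0ℤ) z0≡)
        (λ lt → subst₂ _<ᶻ_ (cong (λ y → y *ᶻ y) z0≡) (cong₂ (λ y z → y *ᶻ y *ᶻ z) weight≡′ Z≡) lt)
        (count-estimate 0<d (ℕₚ.≤-reflexive M≡0)))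

theorem5p11 : ∀ {c ℓ : Level} (F : FiniteField c ℓ) (q n : ℕ) →
    Σ ℕ (λ p → Σ ℕ (λ r → Prime p × (q ≡ p ^ suc r))) → ¬ (2 ∣ q) →
    FiniteField.card F ≡ q ^ n →
    3 ≤ n → 4 ∣ (q ^ n ∸ 1) →
    (Q k : ℕ) → Q * (q ∸ 1) ≡ q ^ n ∸ 1 →
    (ps : List ℕ) → Unique ps → All Prime ps → All (λ p → ¬ (p ∣ k)) ps →
    Q ≡ k * product ps →
    let s = length ps
        δ = 1ℚ ℚ.- sumRecip ps
        C = divℚ (ℤtoℚ (+ s Data.Integer.- + 1)) δ ℚ.+ ℕtoℚ 2
        A = δ ℚ.* θ k
        D = ((ℕtoℚ 2 ℚ.* A) ℚ.* C) ℚ.* ℕtoℚ (W k)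
    in 0ℚ ℚ.< δ →
    (∀ N → FiniteField.IsN0 F q n Q N →
       (A ℚ.* ℕtoℚ (q ^ (n ∸ 1)) ℚ.- ℕtoℚ N) < D ·√ ℕtoℚ (q ^ n))
    ×
    (((ℕtoℚ 2 ℚ.* C) ℚ.* ℕtoℚ (W k)) < 1ℚ ·√ ℕtoℚ (q ^ (n ∸ 2)) →
      ∀ N → FiniteField.IsN0 F q n (q ^ n ∸ 1) N → 0 < N)
theorem5p11 F q n (p , r , pp , refl) _ card≡ (s≤s (s≤s (s≤s {n = n₀} _))) _ Q k Q≡ ps _ primes ∤k Q-factored 0<δ =
  lower-bound , existence
  where open Conclusion F p r (suc n₀) pp card≡ Q Q≡ k ps primes ∤k Q-factored 0<δ
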